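{- For all integers $n\ge 30$, $ar_{\mathcal{P}}(n, M_6)=2n+3$.
   Context: All graphs are finite and simple. $M_6$ denotes a matching with $6$ edges (six pairwise disjoint edges). A subgraph of an edge-colored graph is rainbow if all of its edges have distinct colors. For a planar graph $H$ and an integer $n\ge |H|$, let $\mathcal{T}_n(H)$ be the family of all plane triangulations on $n$ vertices that contain a subgraph isomorphic to $H$. The planar anti-Ramsey number $ar_{\mathcal{P}}(n,H)$ is the maximum number of colors in an edge-coloring of a plane triangulation $T\in\mathcal{T}_n(H)$ such that $T$ contains no rainbow copy of $H$. -}

module Defs where

open import Data.Nat using (ℕ; zero; suc; _+_; _*_; _≤_) renaming (_≟_ to _≟ℕ_)
open import Data.Bool using (Bool; true; false; not; _∨_)
import Data.Bool
open import Data.Fin using (Fin; toℕ) renaming (_≤?_ to _≤F?_; _<_ to _<F_)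
open import Data.Fin.Properties using (all?) renaming (_≟_ to _≟F_)
open import Data.Product using (Σ; Σ-syntax; ∃; ∃-syntax; _×_; _,_)
open import Function using (_∘_; id)
open import Relation.Nullary using (¬_; ⌊_⌋)
open import Relation.Binary.PropositionalEquality using (_≡_; _≢_)

iter : {A : Set} → (A → A) → ℕ → A → A
iter f zero    x = x
iter f (suc k) x = f (iter f k x)

countF : (d : ℕ) → (Fin d → Bool) → ℕ
countF zero    p = 0
countF (suc d) p with p Fin.zero
... | true  = suc (countF d (p ∘ Fin.suc))
... | false = countF d (p ∘ Fin.suc)

allB : (d : ℕ) → (Fin d → Bool) → Bool
allB zero    p = true
allB (suc d) p = p Fin.zero Data.Bool.∧ allB d (p ∘ Fin.suc)

isOrbitMin : {d : ℕ} → (Fin d → Fin d) → Fin d → Bool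
isOrbitMin {d} f x = ⌊ all? (λ (k : Fin d) → x ≤F? iter f (toℕ k) x) ⌋

numOrbits : (d : ℕ) → (Fin d → Fin d) → ℕ
numOrbits d f = countF d (isOrbitMin f)

-- Plane triangulations as combinatorial maps (rotation systems).
--
-- Darts are Fin d.  tail x is the vertex at which dart x starts,
-- α is the edge involution (the reverse dart), σ is the rotation
-- (cyclic order of darts around each vertex), φ = σ ∘ α traces faces.
-- Vertices = σ-orbits (= fibres of tail), edges = α-orbits,
-- faces = φ-orbits.

data Reach {d : ℕ} (σ α : Fin d → Fin d) : Fin d → Fin d → Set where
  here : ∀ {x} → Reach σ α x x
  viaσ : ∀ {x y} → Reach σ α (σ x) y → Reach σ α x y
  viaα : ∀ {x y} → Reach σ α (α x) y → Reach σ α x y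

record PlaneTriangulation (n : ℕ) : Set where
  field
    d     : ℕ
    tail  : Fin d → Fin n
    α σ σ⁻ : Fin d → Fin d
    α-invol  : ∀ x → α (α x) ≡ x
    α-nofix  : ∀ x → α x ≢ x
    σ-inv₁   : ∀ x → σ (σ⁻ x) ≡ x
    σ-inv₂   : ∀ x → σ⁻ (σ x) ≡ x
    σ-tail   : ∀ x → tail (σ x) ≡ tail x
    σ-trans  : ∀ x y → tail x ≡ tail y → ∃[ k ] iter σ k x ≡ y
    tail-surj : ∀ (v : Fin n) → ∃[ x ] tail x ≡ v
    loopless : ∀ x → tail (α x) ≢ tail x
    no-multi : ∀ x y → tail x ≡ tail y → tail (α x) ≡ tail (α y) → x ≡ y
    connected : ∀ x y → Reach σ α x y
    faces-tri : ∀ x → iter (σ ∘ α) 3 x ≡ x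
    -- genus 0 (Euler's formula V - E + F = 2)
    euler : n + numOrbits d (σ ∘ α) ≡ numOrbits d α + 2

module _ {n : ℕ} (T : PlaneTriangulation n) where
  open PlaneTriangulation T

  head : Fin d → Fin n
  head x = tail (α x)

  Coloring : Set
  Coloring = Σ[ c ∈ (Fin d → ℕ) ] (∀ x → c (α x) ≡ c x)

  numColors : Coloring → ℕ
  numColors (c , _) =
    countF d (λ x → allB d (λ y → not ⌊ c y ≟ℕ c x ⌋ ∨ ⌊ x ≤F? y ⌋))

  ends : (Fin 6 → Fin d) → Fin 6 × Bool → Fin n
  ends e (i , false) = tail (e i)
  ends e (i , true)  = head (e i)

  IsM6 : (Fin 6 → Fin d) → Set
  IsM6 e = ∀ p q → ends e p ≡ ends e q → p ≡ q

  ContainsM6 : Set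
  ContainsM6 = ∃[ e ] IsM6 e

  RainbowM6 : Coloring → Set
  RainbowM6 (c , _) = ∃[ e ] (IsM6 e × (∀ i j → c (e i) ≡ c (e j) → i ≡ j))

{-# OPTIONS --safe #-}

-- Lower bound.  Insert vertices of degree three into faces so that every face keeps a vertex of a fixed K₄ and a vertex
-- outside it.  Then exactly 2n + 2 edges meet the K₄.  Give these edges distinct colours and all other edges one further
-- colour: at most four of six disjoint edges meet the K₄, so two of the six share the last colour.
--
-- Upper bound.  Suppose that there are 2n + 4 colours, and let G consist of one edge of each colour.  Then G has no
-- matching of size six, and this remains true when any edge f of the triangulation T takes the place of the edge of G of
-- the same colour.  Remove from G, as long as possible, vertices covered by all maximum matchings.  By Gallai's lemma the
-- components of what remains are small, and as T has at most 2n - 4 edges between a vertex set and its complement, the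
-- removed vertices P carry almost all edges of G.  In particular G minus any edge still has a matching of size five.  Now
-- |P| ≥ 1, and for a suitable set X of vertices of P of large degree the graph G - X has, even after the loss of any
-- edge, a maximum matching within a set B with |X| + |B| ≤ 11.  A set of at most 11 < (n + 4) / 3 vertices does not cover
-- the edges of T, so some edge f of T avoids X and B.  The matching in B, the edge f and greedily chosen edges at the
-- vertices of X form a matching of size six.

module Submission where

open import Defs
open import Data.Nat using (ℕ; zero; suc; _+_; _*_; _∸_; _≤_; _<_; z≤n; s≤s; _≤ᵇ_; _<ᵇ_; _≤?_; _≟_; _⊓_)
open import Data.Nat.Properties hiding (_≟_)
open import Data.Nat.Tactic.RingSolver using (solve-∀)
open import Data.Bool using (Bool; true; false; not; _∧_; _∨_; if_then_else_; T)
open import Data.Fin using (Fin; zero; suc; toℕ)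
import Data.Fin as Fin
open import Data.Fin using (_↑ˡ_; _↑ʳ_; splitAt)
open import Data.Fin.Patterns using (0F; 1F; 2F; 3F; 4F; 5F)
open import Data.Bool.Properties using (∨-comm) renaming (_≟_ to _≟B_)
open import Data.Fin.Properties using (splitAt-↑ˡ; splitAt⁻¹-↑ˡ; splitAt⁻¹-↑ʳ; toℕ-injective; toℕ-fromℕ<; all?; any?) renaming (_≟_ to _≟F_; suc-injective to Fin-suc-injective)
open import Data.Fin.Permutation using (permutation)
open import Data.List using (List; []; _∷_; map; _++_; concatMap; length)
open import Data.List.Relation.Unary.All using (All; []; _∷_)
open import Data.List.Relation.Unary.AllPairs using ([]; _∷_)
open import Data.List.Relation.Unary.Unique.Propositional using (Unique)
open import Data.Vec using (Vec; []; _∷_; lookup)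
open import Data.Vec.N-ary using (N-ary; _$ⁿ_)
import Data.Vec as Vec
open import Data.Product using (∃-syntax; Σ-syntax; _×_; _,_; proj₁; proj₂)
open import Data.Sum using (_⊎_; inj₁; inj₂; [_,_]′)
open import Data.Empty using (⊥; ⊥-elim)
open import Data.Unit using (⊤; tt)
open import Function using (_∘_; id; flip; case_of_)
open import Relation.Nullary using (¬_; ¬?; Dec; yes; no; ⌊_⌋; _×-dec_; _→-dec_; from-yes)
open import Relation.Binary.PropositionalEquality
open import Relation.Binary.Definitions using (tri<; tri≈; tri>)
import Algebra.Properties.Semiring.Sum +-*-semiring as Sum

-- Linear arithmetic over ℕ by Fourier–Motzkin elimination

-- The edge of `G` that gives way to `f` is the one with the colour of `f`, so it is known only once
-- `f` is chosen, while `f` must avoid the matching that survives the loss. One set `B` therefore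
-- has to serve every lost edge at once. For a maximum matching with `m` edges it consists of the
-- `2 * m` matched vertices and, for each matching edge, one further vertex that suffices for a
-- rerouting around this edge. With two vertices in `X` the matching has `m = 3`, and `2 + 3 * 3` is
-- the constant 11; `n + 4 > 33` is the hypothesis `30 ≤ n`. With a single vertex, `1 + 3 * 4` is
-- too large, and the vertices of the components of `G - P` take the place of `B`. With five
-- vertices in `P` the second largest degree may be too small for the greedy step; then the degrees
-- are balanced enough to put four vertices into `X`. Case distinctions on the existence of
-- matchings are made under double negation, which does no harm because each chain of them ends in a
-- contradiction.

infixl 6 _:+_
infixl 7 _:*_
infix 5 _:≤_ _:<_ _:≡_
infixr 4 _⇒_

data LinExpr (k : ℕ) : Set where
  var : Fin k → LinExpr k
  con : ℕ → LinExpr k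
  _:+_ : LinExpr k → LinExpr k → LinExpr k
  _:*_ : ℕ → LinExpr k → LinExpr k

data LinGoal (k : ℕ) : Set where
  absurd : LinGoal k
  _:≤_ _:<_ _:≡_ : LinExpr k → LinExpr k → LinGoal k
  _⇒_ : LinGoal k → LinGoal k → LinGoal k

module _ {k : ℕ} (ρ : Vec ℕ k) where

  evalE : LinExpr k → ℕ
  evalE (var i)  = lookup ρ i
  evalE (con c)  = c
  evalE (a :+ b) = evalE a + evalE b
  evalE (c :* a) = c * evalE a

  evalG : LinGoal k → Set
  evalG absurd   = ⊥
  evalG (a :≤ b) = evalE a ≤ evalE b
  evalG (a :< b) = evalE a < evalE b
  evalG (a :≡ b) = evalE a ≡ evalE b
  evalG (a ⇒ b)  = evalG a → evalG b

-- A linear form is the vector of its constant and its coefficients.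
Form : ℕ → Set
Form k = Vec ℕ (suc k)

dot : ∀ {k} → Vec ℕ k → Vec ℕ k → ℕ
dot [] [] = 0
dot (x ∷ xs) (y ∷ ys) = x * y + dot xs ys

dot-+ : ∀ {k} (a b ρ : Vec ℕ k) → dot (Vec.zipWith _+_ a b) ρ ≡ dot a ρ + dot b ρ
dot-+ [] [] [] = refl
dot-+ (a ∷ as) (b ∷ bs) (x ∷ ρ) rewrite dot-+ as bs ρ = rearrange a b x (dot as ρ) (dot bs ρ)
  where
  rearrange : ∀ a b x p q → (a + b) * x + (p + q) ≡ a * x + p + (b * x + q)
  rearrange = solve-∀

dot-* : ∀ {k} c (a ρ : Vec ℕ k) → dot (Vec.map (c *_) a) ρ ≡ c * dot a ρ
dot-* c [] [] = sym (*-zeroʳ c)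
dot-* c (a ∷ as) (x ∷ ρ) rewrite dot-* c as ρ | *-distribˡ-+ c (a * x) (dot as ρ) | *-assoc c a x = refl

dot-0 : ∀ {k} (ρ : Vec ℕ k) → dot (Vec.replicate k 0) ρ ≡ 0
dot-0 [] = refl
dot-0 (x ∷ ρ) = dot-0 ρ

unit : ∀ {k} → Fin k → Vec ℕ k
unit {suc k} zero = 1 ∷ Vec.replicate k 0
unit (suc i) = 0 ∷ unit i

dot-unit : ∀ {k} (i : Fin k) ρ → dot (unit i) ρ ≡ lookup ρ i
dot-unit zero (x ∷ ρ) rewrite dot-0 ρ | +-identityʳ x | +-identityʳ x = refl
dot-unit (suc i) (x ∷ ρ) = dot-unit i ρ

form : ∀ {k} → LinExpr k → Form k
form (var i)  = 0 ∷ unit i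
form {k} (con c)  = c ∷ Vec.replicate k 0
form (a :+ b) = Vec.zipWith _+_ (form a) (form b)
form (c :* a) = Vec.map (c *_) (form a)

form-correct : ∀ {k} (ρ : Vec ℕ k) e → dot (form e) (1 ∷ ρ) ≡ evalE ρ e
form-correct ρ (var i)  = dot-unit i ρ
form-correct ρ (con c) rewrite dot-0 ρ | +-identityʳ (c * 1) = *-identityʳ c
form-correct ρ (a :+ b) rewrite dot-+ (form a) (form b) (1 ∷ ρ) | form-correct ρ a | form-correct ρ b = refl
form-correct ρ (c :* a) rewrite dot-* c (form a) (1 ∷ ρ) | form-correct ρ a = refl

Ineq : ℕ → Set
Ineq k = LinExpr k × LinExpr k

evalI : ∀ {k} → Vec ℕ k → Ineq k → Set
evalI ρ (a , b) = evalE ρ a ≤ evalE ρ b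

Hyps : ∀ {k} → Vec ℕ k → List (Ineq k) → Set
Hyps ρ [] = ⊤
Hyps ρ (h ∷ hs) = evalI ρ h × Hyps ρ hs

combine : ∀ {k} → List ℕ → List (Ineq k) → Form k × Form k
combine {k} (m ∷ ms) ((a , b) ∷ hs) with combine ms hs
... | l , r = Vec.zipWith _+_ (Vec.map (m *_) (form a)) l , Vec.zipWith _+_ (Vec.map (m *_) (form b)) r
combine {k} _ _ = Vec.replicate (suc k) 0 , Vec.replicate (suc k) 0

combine-correct : ∀ {k} (ρ : Vec ℕ k) ms hs → Hyps ρ hs →
  dot (proj₁ (combine ms hs)) (1 ∷ ρ) ≤ dot (proj₂ (combine ms hs)) (1 ∷ ρ)
combine-correct ρ [] hs H = ≤-refl
combine-correct ρ (m ∷ ms) [] H = ≤-refl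
combine-correct ρ (m ∷ ms) ((a , b) ∷ hs) (h , H)
  rewrite dot-+ (Vec.map (m *_) (form a)) (proj₁ (combine ms hs)) (1 ∷ ρ)
        | dot-+ (Vec.map (m *_) (form b)) (proj₂ (combine ms hs)) (1 ∷ ρ)
        | dot-* m (form a) (1 ∷ ρ) | dot-* m (form b) (1 ∷ ρ)
        | form-correct ρ a | form-correct ρ b
  = +-mono-≤ (*-monoʳ-≤ m h) (combine-correct ρ ms hs H)

dominated : ∀ {k} → Vec ℕ k → Vec ℕ k → Bool
dominated [] [] = true
dominated (x ∷ xs) (y ∷ ys) = (x ≤ᵇ y) ∧ dominated xs ys

contradictory : ∀ {k} → Form k × Form k → Bool
contradictory (l ∷ ls , r ∷ rs) = (r <ᵇ l) ∧ dominated rs ls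

∧-elim : ∀ {a b} → a ∧ b ≡ true → a ≡ true × b ≡ true
∧-elim {true} e = refl , e

to-T : ∀ {b} → b ≡ true → T b
to-T refl = tt

dominated-correct : ∀ {k} (a b ρ : Vec ℕ k) → dominated a b ≡ true → dot a ρ ≤ dot b ρ
dominated-correct [] [] [] e = z≤n
dominated-correct (a ∷ as) (b ∷ bs) (x ∷ ρ) e with ∧-elim {a ≤ᵇ b} e
... | p , q = +-mono-≤ (*-monoˡ-≤ x (≤ᵇ⇒≤ a b (to-T p))) (dominated-correct as bs ρ q)

-- The variables are natural numbers, so a combined inequality cannot hold if its right side has the
-- smaller constant and no larger coefficient. Thus `ms` is a Farkas certificate.
farkas : ∀ {k} (ρ : Vec ℕ k) ms hs → contradictory (combine ms hs) ≡ true → Hyps ρ hs → ⊥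
farkas ρ ms hs e H with combine ms hs | combine-correct ρ ms hs H
... | l ∷ ls , r ∷ rs | le with ∧-elim {r <ᵇ l} e
... | p , q = <⇒≱ (+-mono-<-≤ (*-monoˡ-< 1 (<ᵇ⇒< r l (to-T p))) (dominated-correct rs ls ρ q)) le

-- A row (m, l, r) of the tableau is the combination l ≤ r with multipliers m;
-- eliminating a variable keeps the rows in which it may be bounded below by 0.
record Row (k : ℕ) : Set where
  constructor row
  field
    mult : List ℕ
    cst : ℕ × ℕ
    lhs rhs : Vec ℕ k

addL : List ℕ → List ℕ → List ℕ
addL [] ys = ys
addL xs [] = xs
addL (x ∷ xs) (y ∷ ys) = x + y ∷ addL xs ys

eliminate : ∀ {k} → List (Row (suc k)) → List (Row k)
eliminate {k} rows = concatMap keep rows ++ concatMap (λ n → concatMap (cross n) rows) rows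
  where
  keep : Row (suc k) → List (Row k)
  keep (row m c (l ∷ ls) (r ∷ rs)) = if r ≤ᵇ l then row m c ls rs ∷ [] else []
  cross : Row (suc k) → Row (suc k) → List (Row k)
  cross (row m (c , c′) (l ∷ ls) (r ∷ rs)) (row n (d , d′) (l′ ∷ ls′) (r′ ∷ rs′)) =
    if (l <ᵇ r) ∧ (r′ <ᵇ l′)
      -- The first row bounds the variable from below and the second from above. Weighted by `q` and
      -- `p`, the excesses `q * p` and `p * q` of the variable on the two sides cancel.
      then (let p = r ∸ l ; q = l′ ∸ r′ in
        row (addL (map (q *_) m) (map (p *_) n)) (q * c + p * d , q * c′ + p * d′)
            (Vec.zipWith _+_ (Vec.map (q *_) ls) (Vec.map (p *_) ls′))
            (Vec.zipWith _+_ (Vec.map (q *_) rs) (Vec.map (p *_) rs′)) ∷ [])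
      else []

search : ∀ {k} → List (Row k) → List ℕ
search {zero} [] = []
search {zero} (row m (c , c′) _ _ ∷ rows) = if c′ <ᵇ c then m else search rows
search {suc k} rows = search (eliminate rows)

tableau : ∀ {k} → List (Ineq k) → List (Row k)
tableau hs = go (1 ∷ []) hs
  where
  go : ∀ {k} → List ℕ → List (Ineq k) → List (Row k)
  go m [] = []
  go m ((a , b) ∷ hs) with form a | form b
  ... | c ∷ l | c′ ∷ r = row m (c , c′) l r ∷ go (0 ∷ m) hs

refutable : ∀ {k} → List (Ineq k) → Bool
refutable hs = contradictory (combine (search (tableau hs)) hs)

-- Only the certificate is verified, so the elimination that finds it needs no correctness proof.
refute : ∀ {k} (ρ : Vec ℕ k) hs → refutable hs ≡ true → Hyps ρ hs → ⊥
refute ρ hs = farkas ρ (search (tableau hs)) hs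

suc′ : ∀ {k} → LinExpr k → LinExpr k
suc′ e = con 1 :+ e

provable : ∀ {k} → List (Ineq k) → LinGoal k → Bool
provable hs absurd   = refutable hs
provable hs (a :≤ b) = refutable ((suc′ b , a) ∷ hs)
provable hs (a :< b) = refutable ((b , a) ∷ hs)
provable hs (a :≡ b) = refutable ((suc′ a , b) ∷ hs) ∧ refutable ((suc′ b , a) ∷ hs)
provable hs ((a :≤ b) ⇒ g) = provable ((a , b) ∷ hs) g
provable hs ((a :< b) ⇒ g) = provable ((suc′ a , b) ∷ hs) g
provable hs ((a :≡ b) ⇒ g) = provable ((a , b) ∷ (b , a) ∷ hs) g
provable hs (absurd ⇒ g) = true
provable hs ((a ⇒ b) ⇒ g) = provable hs g

provable-correct : ∀ {k} (ρ : Vec ℕ k) hs g → provable hs g ≡ true → Hyps ρ hs → evalG ρ g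
provable-correct ρ hs absurd e H = refute ρ hs e H
provable-correct ρ hs (a :≤ b) e H = ≮⇒≥ λ lt → refute ρ _ e (lt , H)
provable-correct ρ hs (a :< b) e H = ≰⇒> λ le → refute ρ _ e (le , H)
provable-correct ρ hs (a :≡ b) e H with ∧-elim {refutable ((suc′ a , b) ∷ hs)} e
... | p , q = ≤-antisym (≮⇒≥ λ lt → refute ρ _ q (lt , H)) (≮⇒≥ λ lt → refute ρ _ p (lt , H))
provable-correct ρ hs ((a :≤ b) ⇒ g) e H h = provable-correct ρ _ g e (h , H)
provable-correct ρ hs ((a :< b) ⇒ g) e H h = provable-correct ρ _ g e (h , H)
provable-correct ρ hs ((a :≡ b) ⇒ g) e H h = provable-correct ρ _ g e (≤-reflexive h , ≤-reflexive (sym h) , H)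
provable-correct ρ hs (absurd ⇒ g) e H h = ⊥-elim h
provable-correct ρ hs ((a ⇒ b) ⇒ g) e H h = provable-correct ρ hs g e H

vars : ∀ k → Vec (LinExpr k) k
vars k = Vec.tabulate var

AllN : ∀ k → (Vec ℕ k → Set) → Set
AllN zero P = P []
AllN (suc k) P = (x : ℕ) → AllN k (P ∘ (x ∷_))

generalize : ∀ k {P : Vec ℕ k → Set} → (∀ ρ → P ρ) → AllN k P
generalize zero f = f []
generalize (suc k) f x = generalize k (f ∘ (x ∷_))

-- In a use, the first explicit `refl` makes the type checker run the search and check its
-- certificate. The terms that follow instantiate the variables; nonlinear subterms are passed as
-- variables of their own.
linear : ∀ k (f : N-ary k (LinExpr k) (LinGoal k)) → provable [] (f $ⁿ vars k) ≡ true →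
  AllN k (λ ρ → evalG ρ (f $ⁿ vars k))
linear k f e = generalize k λ ρ → provable-correct ρ [] (f $ⁿ vars k) e tt

-- Finite sums and counting

⌊⌋-yes : ∀ {p} {P : Set p} (d : Dec P) → P → ⌊ d ⌋ ≡ true
⌊⌋-yes (yes _) p = refl
⌊⌋-yes (no ¬p) p = ⊥-elim (¬p p)

⌊⌋-no : ∀ {p} {P : Set p} (d : Dec P) → ¬ P → ⌊ d ⌋ ≡ false
⌊⌋-no (yes p) ¬p = ⊥-elim (¬p p)
⌊⌋-no (no _) ¬p = refl

⌊⌋-sound : ∀ {p} {P : Set p} (d : Dec P) → ⌊ d ⌋ ≡ true → P
⌊⌋-sound (yes p) e = p

⌊⌋-unsound : ∀ {p} {P : Set p} (d : Dec P) → ⌊ d ⌋ ≡ false → ¬ P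
⌊⌋-unsound (no ¬p) e = ¬p

true≢false : true ≢ false
true≢false ()

ind : Bool → ℕ
ind true  = 1
ind false = 0

_==_ : ∀ {n} → Fin n → Fin n → Bool
x == y = ⌊ x ≟F y ⌋

==-refl : ∀ {n} (x : Fin n) → (x == x) ≡ true
==-refl x = ⌊⌋-yes (x ≟F x) refl

==-sound : ∀ {n} {x y : Fin n} → (x == y) ≡ true → x ≡ y
==-sound = ⌊⌋-sound (_ ≟F _)

≢-== : ∀ {n} {x y : Fin n} → x ≢ y → (x == y) ≡ false
≢-== = ⌊⌋-no (_ ≟F _)

BoolFun : ℕ → Set
BoolFun zero    = ℕ
BoolFun (suc k) = Bool → BoolFun k

AlwaysLE : ∀ k → BoolFun k → BoolFun k → Set
AlwaysLE zero f g = f ≤ g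
AlwaysLE (suc k) f g = ∀ b → AlwaysLE k (f b) (g b)

leTable : ∀ k → BoolFun k → BoolFun k → Bool
leTable zero f g = f ≤ᵇ g
leTable (suc k) f g = leTable k (f true) (g true) ∧ leTable k (f false) (g false)

-- Sums are compared summand by summand. Where the summands depend only on Boolean values, `refl`
-- settles all cases by evaluation.
truth-table : ∀ k (f g : BoolFun k) → leTable k f g ≡ true → AlwaysLE k f g
truth-table zero f g e = ≤ᵇ⇒≤ f g (to-T e)
truth-table (suc k) f g e true = truth-table k _ _ (proj₁ (∧-elim e))
truth-table (suc k) f g e false = truth-table k _ _ (proj₂ (∧-elim {leTable k (f true) (g true)} e))

-- Opaque, so that the summand can be inferred by unification.
opaque
  sum : ∀ {n} → (Fin n → ℕ) → ℕ
  sum = Sum.sum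

count : ∀ {n} → (Fin n → Bool) → ℕ
count p = sum (λ i → ind (p i))

opaque
  unfolding sum

  sum-head : ∀ {n} (f : Fin (suc n) → ℕ) → sum f ≡ f zero + sum (λ i → f (suc i))
  sum-head f = refl

  sum-cong : ∀ {n} {f g : Fin n → ℕ} → (∀ i → f i ≡ g i) → sum f ≡ sum g
  sum-cong = Sum.sum-cong-≗

  sum-+ : ∀ {n} (f g : Fin n → ℕ) → sum (λ i → f i + g i) ≡ sum f + sum g
  sum-+ = Sum.∑-distrib-+

  sum-*ˡ : ∀ {n} c (f : Fin n → ℕ) → sum (λ i → c * f i) ≡ c * sum f
  sum-*ˡ c f = sym (Sum.*-distribˡ-sum c f)

  sum-comm : ∀ {m n} (f : Fin m → Fin n → ℕ) → sum (λ i → sum (λ j → f i j)) ≡ sum (λ j → sum (λ i → f i j))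
  sum-comm = Sum.∑-comm

  sum-reindex : ∀ {n} (π π⁻ : Fin n → Fin n) → (∀ x → π (π⁻ x) ≡ x) → (∀ x → π⁻ (π x) ≡ x) →
    (f : Fin n → ℕ) → sum (λ i → f (π i)) ≡ sum f
  sum-reindex π π⁻ h k f = sym (Sum.∑-permute f (permutation π π⁻ h k))

  sum-mono : ∀ {n} {f g : Fin n → ℕ} → (∀ i → f i ≤ g i) → sum f ≤ sum g
  sum-mono {zero} h = z≤n
  sum-mono {suc n} h = +-mono-≤ (h zero) (sum-mono (h ∘ suc))

  sum-const : ∀ n c → sum {n} (λ _ → c) ≡ n * c
  sum-const zero c = refl
  sum-const (suc n) c = cong (c +_) (sum-const n c)

  sum-zero : ∀ {n} {f : Fin n → ℕ} → (∀ i → f i ≡ 0) → sum f ≡ 0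
  sum-zero {zero} h = refl
  sum-zero {suc n} h = cong₂ _+_ (h zero) (sum-zero (h ∘ suc))

  sum-δ : ∀ {n} (a : Fin n) (f : Fin n → ℕ) → sum (λ u → ind (a == u) * f u) ≡ f a
  sum-δ {suc n} zero f = trans (cong₂ _+_ (+-identityʳ (f zero)) (sum-zero {n} λ _ → refl)) (+-identityʳ (f zero))
  sum-δ {suc n} (suc a) f = trans (sum-cong (λ u → cong (λ b → ind b * f (suc u)) (==-suc u))) (sum-δ a (f ∘ suc))
    where
    ==-suc : ∀ u → (suc a == suc u) ≡ (a == u)
    ==-suc u with a ≟F u
    ... | yes refl = refl
    ... | no _ = refl

  term≤sum : ∀ {n} (f : Fin n → ℕ) i → f i ≤ sum f
  term≤sum f zero = m≤m+n _ _
  term≤sum f (suc i) = ≤-trans (term≤sum (f ∘ suc) i) (m≤n+m _ (f zero))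

  sum-witness : ∀ {n} (f : Fin n → ℕ) → 0 < sum f → ∃[ i ] 0 < f i
  sum-witness {suc n} f h with f zero in eq
  ... | suc k = zero , subst (0 <_) (sym eq) (s≤s z≤n)
  ... | zero with sum-witness (f ∘ suc) h
  ... | i , p = suc i , p

  countF≡count : ∀ d (p : Fin d → Bool) → countF d p ≡ count p
  countF≡count zero p = refl
  countF≡count (suc d) p with p zero
  ... | true = cong suc (countF≡count d (p ∘ suc))
  ... | false = countF≡count d (p ∘ suc)

count-true : ∀ n → count {n} (λ _ → true) ≡ n
count-true n = trans (sum-const n 1) (*-identityʳ n)

count-== : ∀ {n} (a : Fin n) → count (a ==_) ≡ 1
count-== a = trans (sum-cong (λ u → sym (*-identityʳ (ind (a == u))))) (sum-δ a (λ _ → 1))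

count-witness : ∀ {n} (p : Fin n → Bool) → 0 < count p → ∃[ i ] p i ≡ true
count-witness p h with sum-witness (ind ∘ p) h
... | i , q = i , ind-pos (p i) q
  where
  ind-pos : ∀ b → 0 < ind b → b ≡ true
  ind-pos true _ = refl

ind-mono : ∀ {a b} → (a ≡ true → b ≡ true) → ind a ≤ ind b
ind-mono {true} h rewrite h refl = ≤-refl
ind-mono {false} h = z≤n

ind≤1 : ∀ b → ind b ≤ 1
ind≤1 true = ≤-refl
ind≤1 false = z≤n

count-mono : ∀ {n} {p q : Fin n → Bool} → (∀ i → p i ≡ true → q i ≡ true) → count p ≤ count q
count-mono h = sum-mono (λ i → ind-mono (h i))

count-cong : ∀ {n} {p q : Fin n → Bool} → (∀ i → p i ≡ q i) → count p ≡ count q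
count-cong h = sum-cong (λ i → cong ind (h i))

count-complement : ∀ {n} (p : Fin n → Bool) → count p + count (not ∘ p) ≡ n
count-complement {n} p = trans (sym (sum-+ _ _))
  (trans (sum-cong (λ i → compl (p i))) (count-true n))
  where
  compl : ∀ b → ind b + ind (not b) ≡ 1
  compl true = refl
  compl false = refl

count-∨ : ∀ {n} (p q : Fin n → Bool) → count (λ i → p i ∨ q i) ≤ count p + count q
count-∨ p q = ≤-trans (sum-mono λ i → truth-table 2 (λ a b → ind (a ∨ b)) (λ a b → ind a + ind b) refl (p i) (q i))
  (≤-reflexive (sum-+ _ _))

sum-+₃ : ∀ {n} (f g h : Fin n → ℕ) → sum (λ i → f i + g i + h i) ≡ sum f + sum g + sum h
sum-+₃ f g h = trans (sum-+ (λ i → f i + g i) h) (cong (_+ sum h) (sum-+ f g))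

three-terms : ∀ {n} (f : Fin n → ℕ) {a b c} → a ≢ b → b ≢ c → a ≢ c → f a + f b + f c ≤ sum f
three-terms f {a} {b} {c} ab bc ac = subst (_≤ sum f)
  (trans (sum-+₃ _ _ _) (cong₂ _+_ (cong₂ _+_ (sum-δ a f) (sum-δ b f)) (sum-δ c f)))
  (sum-mono λ i → bound i)
  where
  bound : ∀ i → ind (a == i) * f i + ind (b == i) * f i + ind (c == i) * f i ≤ f i
  bound i with a ≟F i | b ≟F i | c ≟F i
  ... | yes refl | yes e | _ = ⊥-elim (ab (sym e))
  ... | yes refl | no _ | yes e = ⊥-elim (ac (sym e))
  ... | yes refl | no _ | no _ = ≤-reflexive (trans (+-identityʳ _) (trans (+-identityʳ _) (+-identityʳ _)))
  ... | no _ | yes refl | yes e = ⊥-elim (bc (sym e))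
  ... | no _ | yes refl | no _ = ≤-reflexive (trans (+-identityʳ _) (+-identityʳ _))
  ... | no _ | no _ | yes refl = ≤-reflexive (+-identityʳ _)
  ... | no _ | no _ | no _ = z≤n

-- Orbits of fixed-point-free involutions and of permutations of order three

distinct⇒1<n : ∀ {n} {x y : Fin n} → x ≢ y → 1 < n
distinct⇒1<n {1} {zero} {zero} ne = ⊥-elim (ne refl)
distinct⇒1<n {suc (suc n)} ne = s≤s (s≤s z≤n)

module _ {d : ℕ} (f : Fin d → Fin d) where

  OrbitMin : Fin d → Set
  OrbitMin x = ∀ k → toℕ x ≤ toℕ (iter f k x)

  isOrbitMin-true : ∀ x → OrbitMin x → isOrbitMin f x ≡ true
  isOrbitMin-true x h = ⌊⌋-yes (all? _) λ k → h (toℕ k)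

  isOrbitMin-false : ∀ x k → k < d → ¬ (toℕ x ≤ toℕ (iter f k x)) → isOrbitMin f x ≡ false
  isOrbitMin-false x k lt h = ⌊⌋-no (all? _) λ al → h (subst (λ j → toℕ x ≤ toℕ (iter f j x)) (toℕ-fromℕ< lt) (al (Fin.fromℕ< lt)))

  iter-suc : ∀ k x → iter f k (f x) ≡ f (iter f k x)
  iter-suc zero x = refl
  iter-suc (suc k) x = cong f (iter-suc k x)

  orbitMin₂ : (∀ x → f (f x) ≡ x) → ∀ x → toℕ x ≤ toℕ (f x) → OrbitMin x
  orbitMin₂ inv x h zero = ≤-refl
  orbitMin₂ inv x h (suc zero) = h
  orbitMin₂ inv x h (suc (suc k)) = subst (toℕ x ≤_) (cong toℕ (sym (inv _))) (orbitMin₂ inv x h k)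

  orbitMin₃ : (∀ x → iter f 3 x ≡ x) → ∀ x → toℕ x ≤ toℕ (f x) → toℕ x ≤ toℕ (f (f x)) → OrbitMin x
  orbitMin₃ inv x h h′ zero = ≤-refl
  orbitMin₃ inv x h h′ (suc zero) = h
  orbitMin₃ inv x h h′ (suc (suc zero)) = h′
  orbitMin₃ inv x h h′ (suc (suc (suc k))) = subst (toℕ x ≤_) (cong toℕ (sym (inv _))) (orbitMin₃ inv x h h′ k)

  numOrbits₂ : (∀ x → f (f x) ≡ x) → (∀ x → f x ≢ x) → 2 * numOrbits d f ≡ d
  numOrbits₂ inv nofix = begin
    2 * numOrbits d f ≡⟨ cong (2 *_) (countF≡count d m) ⟩
    2 * count m ≡⟨ cong (count m +_) (+-identityʳ _) ⟩
    count m + count m ≡⟨ cong (count m +_) (sym (sum-reindex f f inv inv (ind ∘ m))) ⟩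
    count m + count (m ∘ f) ≡⟨ sym (sum-+ _ _) ⟩
    sum (λ x → ind (m x) + ind (m (f x))) ≡⟨ sum-cong one ⟩
    count {d} (λ _ → true) ≡⟨ count-true d ⟩
    d ∎
    where
    open ≡-Reasoning
    m : Fin d → Bool
    m = isOrbitMin f
    one<d : Fin d → 1 < d
    one<d x = distinct⇒1<n (nofix x)
    one : ∀ x → ind (m x) + ind (m (f x)) ≡ 1
    one x with <-cmp (toℕ x) (toℕ (f x))
    ... | tri< lt _ _ rewrite isOrbitMin-true x (orbitMin₂ inv x (<⇒≤ lt))
          | isOrbitMin-false (f x) 1 (one<d x) (subst (λ y → ¬ toℕ (f x) ≤ toℕ y) (sym (inv x)) (<⇒≱ lt)) = refl
    ... | tri≈ _ e _ = ⊥-elim (nofix x (sym (toℕ-injective e)))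
    ... | tri> _ _ gt rewrite isOrbitMin-false x 1 (one<d x) (<⇒≱ gt)
          | isOrbitMin-true (f x) (orbitMin₂ inv (f x) (subst (λ y → toℕ (f x) ≤ toℕ y) (sym (inv x)) (<⇒≤ gt))) = refl

  module _ (inv : ∀ x → iter f 3 x ≡ x) (nofix : ∀ x → f x ≢ x) where

    private
      nofix₂ : ∀ x → f (f x) ≢ x
      nofix₂ x e = nofix x (trans (cong f (sym e)) (inv x))
      -- `isOrbitMin` inspects only iterates with index below `d`, and the second iterate has to be
      -- among them.
      2<d : Fin d → 2 < d
      2<d x = subst (3 ≤_) (count-true d) (three-terms (λ _ → 1) {x} {f x} {f (f x)}
        (λ e → nofix x (sym e)) (λ e → nofix (f x) (sym e)) (λ e → nofix₂ x (sym e)))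
      le : Fin d → Fin d → Bool
      le x y = ⌊ toℕ x ≤? toℕ y ⌋
      m : Fin d → Bool
      m = isOrbitMin f
      m-le : ∀ x → m x ≡ le x (f x) ∧ not (le (f (f x)) x)
      m-le x with toℕ x ≤? toℕ (f x)
      ... | no p = isOrbitMin-false x 1 (<⇒≤ (2<d x)) p
      ... | yes p with toℕ (f (f x)) ≤? toℕ x
      ...   | no q = isOrbitMin-true x (orbitMin₃ inv x p (<⇒≤ (≰⇒> q)))
      ...   | yes q = isOrbitMin-false x 2 (2<d x) (λ r → nofix₂ x (toℕ-injective (≤-antisym q r)))
      -- Here `p`, `q`, `r` stand for `x ≤ f x`, `f x ≤ f (f x)`, `f (f x) ≤ x`. On three different
      -- numbers they are neither all true nor all false, and then exactly one of the three is the
      -- minimum.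
      cyclic : ∀ p q r → ¬ (p ≡ true × q ≡ true × r ≡ true) → ¬ (p ≡ false × q ≡ false × r ≡ false) →
        ind (p ∧ not r) + ind (q ∧ not p) + ind (r ∧ not q) ≡ 1
      cyclic true true true h _ = ⊥-elim (h (refl , refl , refl))
      cyclic true true false _ _ = refl
      cyclic true false true _ _ = refl
      cyclic true false false _ _ = refl
      cyclic false true true _ _ = refl
      cyclic false true false _ _ = refl
      cyclic false false true _ _ = refl
      cyclic false false false _ h = ⊥-elim (h (refl , refl , refl))
      one : ∀ x → ind (m x) + ind (m (f x)) + ind (m (f (f x))) ≡ 1
      one x rewrite m-le x | m-le (f x) | m-le (f (f x)) | inv x = cyclic (le x (f x)) (le (f x) (f (f x))) (le (f (f x)) x)
        (λ where (p , q , r) → nofix₂ x (toℕ-injective (≤-antisym (⌊⌋-sound (_ ≤? _) r) (≤-trans (⌊⌋-sound (_ ≤? _) p) (⌊⌋-sound (_ ≤? _) q)))))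
        (λ where (p , q , r) → <-irrefl refl (<-trans (≰⇒> (⌊⌋-unsound (_ ≤? _) p)) (<-trans (≰⇒> (⌊⌋-unsound (_ ≤? _) r)) (≰⇒> (⌊⌋-unsound (_ ≤? _) q)))))

    numOrbits₃ : 3 * numOrbits d f ≡ d
    numOrbits₃ = begin
      3 * numOrbits d f ≡⟨ cong (3 *_) (countF≡count d m) ⟩
      3 * count m ≡⟨ triple (count m) ⟩
      count m + count m + count m ≡⟨ cong₂ (λ a b → count m + a + b) (sym (reindexed m))
          (trans (sym (reindexed m)) (sym (reindexed (m ∘ f)))) ⟩
      count m + count (m ∘ f) + count (m ∘ f ∘ f) ≡⟨ sym (sum-+₃ _ _ _) ⟩
      sum (λ x → ind (m x) + ind (m (f x)) + ind (m (f (f x)))) ≡⟨ sum-cong one ⟩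
      count {d} (λ _ → true) ≡⟨ count-true d ⟩
      d ∎
      where
      open ≡-Reasoning
      triple : ∀ a → 3 * a ≡ a + a + a
      triple = solve-∀
      reindexed : ∀ p → count (p ∘ f) ≡ count p
      reindexed p = sum-reindex f (f ∘ f) inv inv (ind ∘ p)

-- Counting in plane triangulations

count-three : ∀ {n} (a b c : Fin n) → (∀ x → x ≡ a ⊎ x ≡ b ⊎ x ≡ c) → n ≤ 3
count-three {n} a b c h = subst₂ _≤_ (count-true n)
  (trans (sum-+₃ _ _ _) (cong₂ _+_ (cong₂ _+_ (count-== a) (count-== b)) (count-== c)))
  (sum-mono λ x → hit x (h x))
  where
  hit : ∀ x → x ≡ a ⊎ x ≡ b ⊎ x ≡ c → 1 ≤ ind (a == x) + ind (b == x) + ind (c == x)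
  hit x (inj₁ refl) rewrite ==-refl x = s≤s z≤n
  hit x (inj₂ (inj₁ refl)) rewrite ==-refl x = ≤-trans (m≤n+m 1 (ind (a == x))) (m≤m+n _ _)
  hit x (inj₂ (inj₂ refl)) rewrite ==-refl x = m≤n+m 1 _

module Planar {n : ℕ} (T : PlaneTriangulation n) where
  open PlaneTriangulation T

  hd : Fin d → Fin n
  hd x = tail (α x)

  φ : Fin d → Fin d
  φ x = σ (α x)

  tail-φ : ∀ x → tail (φ x) ≡ hd x
  tail-φ x = σ-tail (α x)

  hd-φφ : ∀ x → hd (φ (φ x)) ≡ tail x
  hd-φφ x = trans (sym (tail-φ _)) (cong tail (faces-tri x))

  hd-α : ∀ x → hd (α x) ≡ tail x
  hd-α x = cong tail (α-invol x)

  -- Euler's formula with `2 * E = d = 3 * F`; equivalently `E = 3 * n - 6`.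
  dart-count : d + 12 ≡ 6 * n
  dart-count = linear 4 (λ n f e d → n :+ f :≡ e :+ con 2 ⇒ 2 :* e :≡ d ⇒ 3 :* f :≡ d ⇒ d :+ con 12 :≡ 6 :* n) refl
    n (numOrbits d φ) (numOrbits d α) d euler (numOrbits₂ α α-invol α-nofix)
    (numOrbits₃ φ faces-tri (λ x e → loopless x (trans (sym (tail-φ x)) (cong tail e))))

  darts : (Fin n → Fin n → ℕ) → ℕ
  darts f = sum (λ x → f (tail x) (hd x))

  darts-flip : ∀ f → darts (flip f) ≡ darts f
  darts-flip f = trans (sum-cong λ x → cong (f (hd x)) (sym (hd-α x)))
    (sum-reindex α α α-invol α-invol λ x → f (tail x) (hd x))

  face-sum : ∀ (f : Fin d → ℕ) → sum (λ x → f x + f (φ x) + f (φ (φ x))) ≡ 3 * sum f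
  face-sum f = trans (sum-+₃ f (λ x → f (φ x)) (λ x → f (φ (φ x))))
    (trans (cong₂ (λ a b → sum f + a + b) once (trans (reindexed λ x → f (φ x)) once)) (triple (sum f)))
    where
    reindexed : ∀ (g : Fin d → ℕ) → sum (λ x → g (φ x)) ≡ sum g
    reindexed = sum-reindex φ (λ x → φ (φ x)) faces-tri faces-tri
    once = reindexed f
    triple : ∀ a → a + a + a ≡ 3 * a
    triple = solve-∀

  -- Only darts leaving `S` are counted, so that each edge of the cut counts once.
  cutSize : (Fin n → Bool) → ℕ
  cutSize S = darts λ a b → ind (S a ∧ not (S b))

  private
    faceCut : ∀ (S : Fin n → Bool) x → let c = λ x → ind (S (tail x) ∧ not (S (hd x))) in
      c x + c (φ x) + c (φ (φ x)) ≡
      ind (S (tail x) ∧ not (S (hd x))) + ind (S (hd x) ∧ not (S (hd (φ x)))) + ind (S (hd (φ x)) ∧ not (S (tail x)))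
    faceCut S x rewrite tail-φ (φ x) | hd-φφ x | tail-φ x = refl

    3cutSize : ∀ (S : Fin n → Bool) → 3 * cutSize S ≡ sum λ x →
      ind (S (tail x) ∧ not (S (hd x))) + ind (S (hd x) ∧ not (S (hd (φ x)))) + ind (S (hd (φ x)) ∧ not (S (tail x)))
    3cutSize S = trans (sym (face-sum λ x → ind (S (tail x) ∧ not (S (hd x))))) (sum-cong (faceCut S))

  -- Every face meets a cut in at most one dart from S to its complement.
  cut-bound : ∀ S → cutSize S + 4 ≤ 2 * n
  cut-bound S = linear 3 (λ c d n → 3 :* c :≤ d ⇒ d :+ con 12 :≡ 6 :* n ⇒ c :+ con 4 :≤ 2 :* n) refl
    (cutSize S) d n
    (subst₂ _≤_ (sym (3cutSize S)) (count-true d) (sum-mono λ x → cyclic (S (tail x)) (S (hd x)) (S (hd (φ x)))))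
    dart-count
    where
    cyclic = truth-table 3 (λ a b c → ind (a ∧ not b) + ind (b ∧ not c) + ind (c ∧ not a)) (λ _ _ _ → 1) refl

  Mixed : (Fin n → Bool) → Fin d → Set
  Mixed S x = ¬ (S (tail x) ≡ S (hd x) × S (hd x) ≡ S (hd (φ x)))

  -- Going around a face with vertices on both sides, one leaves `S` exactly once in three steps. So
  -- the bound of `cut-bound` is attained when all faces are mixed.
  cut-exact : ∀ S → (∀ x → Mixed S x) → cutSize S + 4 ≡ 2 * n
  cut-exact S h = linear 3 (λ c d n → 3 :* c :≡ d ⇒ d :+ con 12 :≡ 6 :* n ⇒ c :+ con 4 :≡ 2 :* n) refl
    (cutSize S) d n
    (trans (3cutSize S) (trans (sum-cong λ x → cyclic (S (tail x)) (S (hd x)) (S (hd (φ x))) (h x)) (count-true d)))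
    dart-count
    where
    cyclic : ∀ a b c → ¬ (a ≡ b × b ≡ c) → ind (a ∧ not b) + ind (b ∧ not c) + ind (c ∧ not a) ≡ 1
    cyclic true true true h = ⊥-elim (h (refl , refl))
    cyclic true true false h = refl
    cyclic true false true h = refl
    cyclic true false false h = refl
    cyclic false true true h = refl
    cyclic false true false h = refl
    cyclic false false true h = refl
    cyclic false false false h = ⊥-elim (h (refl , refl))

  by-tail : (g : Fin n → Fin d → ℕ) →
    sum (λ y → sum (λ x → ind (tail x == y) * g y x)) ≡ sum (λ x → g (tail x) x)
  by-tail g = trans (sum-comm (λ y x → ind (tail x == y) * g y x)) (sum-cong λ x → sum-δ (tail x) (λ y → g y x))

  module _ (4≤n : 4 ≤ n) where

    -- If `x` were the only dart at its vertex, the face containing `α x` would run through `α x`,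
    -- `x` and `σ (α x)`, and its third side would be a loop.
    σ-nofix : ∀ x → σ x ≢ x
    σ-nofix x e = loopless (σ (α x)) (trans (sym (tail-φ _))
      (trans (cong tail (trans (cong (λ z → φ (φ z)) (sym x≡φαx)) (faces-tri (α x)))) (sym (σ-tail (α x)))))
      where
      x≡φαx : φ (α x) ≡ x
      x≡φαx = trans (cong σ (α-invol x)) e

    -- At a vertex of degree two both faces have the same three vertices, so by simplicity their
    -- third sides `z₁` and `z₂` are one edge. The six darts of this triangle are then closed under
    -- `σ` and `α`, and connectedness leaves only three vertices.
    σσ-nofix : ∀ x → σ (σ x) ≢ x
    σσ-nofix x e = <⇒≱ 4≤n (count-three (tail x) (hd x) (hd x₂) λ v → vertex v (tail-surj v))
      where
      x₂ z₁ z₂ : Fin d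
      x₂ = σ x
      z₁ = σ (α x₂)
      z₂ = σ (α x)
      φz₁ : φ z₁ ≡ α x
      φz₁ = trans (cong (λ z → φ (φ (σ z))) (sym (α-invol x))) (faces-tri (α x))
      φz₂ : φ z₂ ≡ α x₂
      φz₂ = trans (cong (λ z → φ (φ z)) (trans (sym e) (cong σ (sym (α-invol x₂))))) (faces-tri (α x₂))
      z₂≡αz₁ : z₂ ≡ α z₁
      z₂≡αz₁ = no-multi z₂ (α z₁)
        (trans (tail-φ x) (trans (sym (cong tail φz₁)) (tail-φ z₁)))
        (trans (sym (tail-φ z₂)) (trans (cong tail φz₂) (trans (sym (tail-φ x₂)) (sym (hd-α z₁)))))
      data Six : Fin d → Set where
        s₁ : Six x
        s₂ : Six x₂
        s₃ : Six (α x)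
        s₄ : Six (α x₂)
        s₅ : Six z₁
        s₆ : Six z₂
      σ-closed : ∀ {y} → Six y → Six (σ y)
      σ-closed s₁ = s₂
      σ-closed s₂ = subst Six (sym e) s₁
      σ-closed s₃ = s₆
      σ-closed s₄ = s₅
      σ-closed s₅ = subst Six (sym (trans (cong σ (trans (sym (α-invol z₁)) (cong α (sym z₂≡αz₁)))) φz₂)) s₄
      σ-closed s₆ = subst Six (sym (trans (cong σ z₂≡αz₁) φz₁)) s₃
      α-closed : ∀ {y} → Six y → Six (α y)
      α-closed s₁ = s₃
      α-closed s₂ = s₄
      α-closed s₃ = subst Six (sym (α-invol x)) s₁
      α-closed s₄ = subst Six (sym (α-invol x₂)) s₂
      α-closed s₅ = subst Six z₂≡αz₁ s₆
      α-closed s₆ = subst Six (trans (sym (α-invol z₁)) (cong α (sym z₂≡αz₁))) s₅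
      reached : ∀ {y z} → Reach σ α y z → Six y → Six z
      reached here s = s
      reached (viaσ r) s = reached r (σ-closed s)
      reached (viaα r) s = reached r (α-closed s)
      endpoint : ∀ {y} → Six y → tail y ≡ tail x ⊎ tail y ≡ hd x ⊎ tail y ≡ hd x₂
      endpoint s₁ = inj₁ refl
      endpoint s₂ = inj₁ (σ-tail x)
      endpoint s₃ = inj₂ (inj₁ refl)
      endpoint s₄ = inj₂ (inj₂ refl)
      endpoint s₅ = inj₂ (inj₂ (σ-tail _))
      endpoint s₆ = inj₂ (inj₁ (σ-tail _))
      vertex : ∀ v → ∃[ y ] tail y ≡ v → v ≡ tail x ⊎ v ≡ hd x ⊎ v ≡ hd x₂
      vertex v (y , refl) = endpoint (reached (connected x y) s₁)

    degree≥3 : ∀ y → 3 ≤ count (λ x → tail x == y)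
    degree≥3 y with tail-surj y
    ... | x , refl = subst (_≤ count λ z → tail z == tail x)
      (cong₂ _+_ (cong₂ _+_ (one refl) (one (σ-tail x))) (one (trans (σ-tail (σ x)) (σ-tail x))))
      (three-terms (λ z → ind (tail z == tail x)) {x} {σ x} {σ (σ x)}
        (λ e → σ-nofix x (sym e)) (λ e → σ-nofix (σ x) (sym e)) (λ e → σσ-nofix x (sym e)))
      where
      one : ∀ {z} → tail z ≡ tail x → ind (tail z == tail x) ≡ 1
      one e = cong ind (⌊⌋-yes (_ ≟F _) e)

    tails≥3 : ∀ (I : Fin n → Bool) → 3 * count I ≤ count (λ x → I (tail x))
    tails≥3 I = begin
      3 * count I ≡⟨ sym (sum-*ˡ 3 _) ⟩
      sum (λ y → 3 * ind (I y)) ≤⟨ sum-mono (λ y → *-monoˡ-≤ (ind (I y)) (degree≥3 y)) ⟩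
      sum (λ y → count (λ x → tail x == y) * ind (I y)) ≡⟨ sum-cong
          (λ y → trans (*-comm _ (ind (I y))) (sym (sum-*ˡ (ind (I y)) _))) ⟩
      sum (λ y → sum (λ x → ind (I y) * ind (tail x == y))) ≡⟨ sum-cong (λ y → sum-cong λ x → *-comm (ind (I y)) _) ⟩
      sum (λ y → sum (λ x → ind (tail x == y) * ind (I y))) ≡⟨ by-tail (λ y x → ind (I y)) ⟩
      count (λ x → I (tail x)) ∎
      where open ≤-Reasoning

    -- A face has at most one vertex outside a cover, and such a vertex has degree at least three.
    cover-bound : ∀ S → (∀ x → S (tail x) ∨ S (hd x) ≡ true) → n + 4 ≤ 3 * count S
    cover-bound S cov = linear 5 (λ n d s i t → d :+ con 12 :≡ 6 :* n ⇒ s :+ i :≡ n ⇒ 3 :* i :≤ t ⇒ 3 :* t :≤ d ⇒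
         n :+ con 4 :≤ 3 :* s) refl
      n d (count S) (count (not ∘ S)) (count λ x → not (S (tail x))) dart-count (count-complement S) (tails≥3 (not ∘ S))
      (subst₂ _≤_ (face-sum λ x → ind (not (S (tail x)))) (count-true d) (sum-mono face))
      where
      at-most-one : ∀ a b c → a ∨ b ≡ true → b ∨ c ≡ true → c ∨ a ≡ true → ind (not a) + ind (not b) + ind (not c) ≤ 1
      at-most-one true true true _ _ _ = z≤n
      at-most-one true true false _ _ _ = s≤s z≤n
      at-most-one true false true _ _ _ = s≤s z≤n
      at-most-one false true true _ _ _ = s≤s z≤n
      face : ∀ x → ind (not (S (tail x))) + ind (not (S (tail (φ x)))) + ind (not (S (tail (φ (φ x))))) ≤ 1
      face x = at-most-one (S (tail x)) (S (tail (φ x))) (S (tail (φ (φ x))))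
        (subst (λ v → S (tail x) ∨ S v ≡ true) (sym (tail-φ x)) (cov x))
        (subst (λ v → S (tail (φ x)) ∨ S v ≡ true) (sym (tail-φ (φ x))) (cov (φ x)))
        (subst (λ v → S (tail (φ (φ x))) ∨ S v ≡ true) (hd-φφ x) (cov (φ (φ x))))

    -- A vertex y has two darts x that leave P or for which the triangle at the corner (x, σ x) has its opposite side in P:
    -- for consecutive darts x, σ x one of the two qualifies, and y has at least three darts.
    module _ (P : Fin n → Bool) where

      private
        corner : Fin d → ℕ
        corner x = ind (not (P (hd x))) + ind (P (hd x) ∧ P (hd (σ x)))

      corners≥2 : ∀ y → 2 ≤ sum (λ x → ind (tail x == y) * corner x)
      corners≥2 y = linear 2 (λ c g → con 3 :≤ c ⇒ c :≤ g :+ g ⇒ con 2 :≤ g) refl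
        (count λ x → tail x == y) (sum λ x → ind (tail x == y) * corner x) (degree≥3 y)
        (begin
          count (λ x → tail x == y) ≤⟨ sum-mono consecutive ⟩
          sum (λ x → at x + at (σ x)) ≡⟨ sum-+ at (λ x → at (σ x)) ⟩
          sum at + sum (λ x → at (σ x)) ≡⟨ cong (sum at +_) (sum-reindex σ σ⁻ σ-inv₁ σ-inv₂ at) ⟩
          sum at + sum at ∎)
        where
        open ≤-Reasoning
        at : Fin d → ℕ
        at x = ind (tail x == y) * corner x
        table = truth-table 4 (λ t a b c → ind t)
          (λ t a b c → ind t * (ind (not a) + ind (a ∧ b)) + ind t * (ind (not b) + ind (b ∧ c))) refl
        consecutive : ∀ x → ind (tail x == y) ≤ at x + at (σ x)
        consecutive x rewrite σ-tail x = table (tail x == y) (P (hd x)) (P (hd (σ x))) (P (hd (σ (σ x))))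

      private
        inside : ℕ
        inside = darts λ a b → ind (P a ∧ P b)

        -- The side opposite to the corner (x, σ x) is φ (σ x).
        opposite-sides : count (λ x → P (hd x) ∧ P (hd (σ x))) ≡ inside
        opposite-sides = begin
          count (λ x → P (hd x) ∧ P (hd (σ x))) ≡⟨ sum-cong opposite ⟩
          sum (λ x → dart (σ x)) ≡⟨ sum-reindex σ σ⁻ σ-inv₁ σ-inv₂ dart ⟩
          sum (λ x → ind (P (hd (φ x)) ∧ P (tail (φ x)))) ≡⟨ sum-reindex φ (λ x → φ (φ x)) faces-tri faces-tri
              (λ x → ind (P (hd x) ∧ P (tail x))) ⟩
          darts (λ a b → ind (P b ∧ P a)) ≡⟨ darts-flip (λ a b → ind (P a ∧ P b)) ⟩
          inside ∎
          where
          open ≡-Reasoning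
          dart : Fin d → ℕ
          dart x = ind (P (hd (φ x)) ∧ P (tail (φ x)))
          hd-φσ : ∀ x → hd (φ (σ x)) ≡ hd x
          hd-φσ x = trans (cong (λ z → hd (φ (σ z))) (sym (α-invol x))) (hd-φφ (α x))
          opposite : ∀ x → ind (P (hd x) ∧ P (hd (σ x))) ≡ dart (σ x)
          opposite x rewrite tail-φ (σ x) | hd-φσ x = refl

      module _ (W : Fin n → Bool) (disj : ∀ x → W x ≡ true → P x ≡ false) where

        private
          Z : Fin n → Bool
          Z x = not (P x) ∧ not (W x)

          Z-darts : 2 * count Z ≤ darts (λ a b → ind (Z a ∧ not (P b))) + inside
          Z-darts = begin
            2 * count Z ≡⟨ sym (sum-*ˡ 2 _) ⟩
            sum (λ y → 2 * ind (Z y)) ≤⟨ sum-mono (λ y → *-monoˡ-≤ (ind (Z y)) (corners≥2 y)) ⟩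
            sum (λ y → sum (λ x → ind (tail x == y) * corner x) * ind (Z y)) ≡⟨ sum-cong
                (λ y → trans (*-comm _ (ind (Z y))) (sym (sum-*ˡ (ind (Z y)) _))) ⟩
            sum (λ y → sum (λ x → ind (Z y) * (ind (tail x == y) * corner x))) ≡⟨ sum-cong
                (λ y → sum-cong λ x → swap (ind (Z y)) (ind (tail x == y)) (corner x)) ⟩
            sum (λ y → sum (λ x → ind (tail x == y) * (ind (Z y) * corner x))) ≡⟨ by-tail (λ y x → ind (Z y) * corner x) ⟩
            sum (λ x → ind (Z (tail x)) * corner x) ≤⟨ sum-mono (λ x → table (Z (tail x)) (P (hd x)) (P (hd (σ x)))) ⟩
            sum (λ x → ind (Z (tail x) ∧ not (P (hd x))) + ind (P (hd x) ∧ P (hd (σ x)))) ≡⟨ sum-+ _ _ ⟩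
            darts (λ a b → ind (Z a ∧ not (P b))) + count (λ x → P (hd x) ∧ P (hd (σ x))) ≡⟨ cong
                (darts (λ a b → ind (Z a ∧ not (P b))) +_) opposite-sides ⟩
            darts (λ a b → ind (Z a ∧ not (P b))) + inside ∎
            where
            open ≤-Reasoning
            swap : ∀ a b c → a * (b * c) ≡ b * (a * c)
            swap = solve-∀
            table = truth-table 3 (λ z p q → ind z * (ind (not p) + ind (p ∧ q))) (λ z p q → ind (z ∧ not p) + ind (p ∧ q)) refl

        -- Let `Z` be the rest of the vertices. The darts inside `W`, between `P` and its complement
        -- in both directions, from `W` to `Z`, from `Z` to vertices outside `P`, and inside `P` are
        -- all different, hence at most `6 * n - 12`. The last two kinds number at least
        -- `2 * count Z`: each vertex of `Z` has two good corners, and every dart inside `P` is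
        -- opposite to just one corner. Replacing `count Z` by `n - count P - count W` gives the
        -- bound.
        partition-bound :
          darts (λ a b → ind (W a ∧ W b)) + 2 * cutSize P + darts (λ a b → ind (W a ∧ not (P b) ∧ not (W b))) + 12
          ≤ 4 * n + 2 * count P + 2 * count W
        partition-bound = linear 9 (λ n d w c k zd i z pw → d :+ con 12 :≡ 6 :* n ⇒ 2 :* z :≤ zd :+ i ⇒ n :≤ pw :+ z ⇒
              w :+ 2 :* c :+ k :+ zd :+ i :≤ d ⇒ w :+ 2 :* c :+ k :+ con 12 :≤ 4 :* n :+ 2 :* pw) refl
            n d dW (cutSize P) cross dZ inside (count Z) (count P + count W)
            dart-count Z-darts vertices total
          <≤> ≤-reflexive (trans (cong (4 * n +_) (*-distribˡ-+ 2 (count P) (count W))) (sym (+-assoc (4 * n) _ _)))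
          where
          _<≤>_ : ∀ {a b c} → a ≤ b → b ≤ c → a ≤ c
          _<≤>_ = ≤-trans
          dW cross dZ : ℕ
          dW = darts (λ a b → ind (W a ∧ W b))
          cross = darts (λ a b → ind (W a ∧ not (P b) ∧ not (W b)))
          dZ = darts (λ a b → ind (Z a ∧ not (P b)))
          vertices : n ≤ count P + count W + count Z
          vertices = subst₂ _≤_ (count-true n) (sum-+₃ _ _ _) (sum-mono λ x →
            truth-table 2 (λ _ _ → 1) (λ p w → ind p + ind w + ind (not p ∧ not w)) refl (P x) (W x))
          types : ∀ pa wa pb wb → (wa ≡ true → pa ≡ false) → (wb ≡ true → pb ≡ false) →
            ind (wa ∧ wb) + ind (pa ∧ not pb) + ind (pb ∧ not pa) + ind (wa ∧ not pb ∧ not wb)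
              + ind ((not pa ∧ not wa) ∧ not pb) + ind (pa ∧ pb) ≤ 1
          types true true _ _ h _ = ⊥-elim (true≢false (h refl))
          types _ _ true true _ h = ⊥-elim (true≢false (h refl))
          types true false true false _ _ = ≤-refl
          types true false false true _ _ = ≤-refl
          types true false false false _ _ = ≤-refl
          types false true true false _ _ = ≤-refl
          types false true false true _ _ = ≤-refl
          types false true false false _ _ = ≤-refl
          types false false true false _ _ = ≤-refl
          types false false false true _ _ = ≤-refl
          types false false false false _ _ = ≤-refl
          total : dW + 2 * cutSize P + cross + dZ + inside ≤ d
          total = begin
            dW + 2 * cutSize P + cross + dZ + inside
              ≡⟨ cong (λ c → dW + c + cross + dZ + inside)
                  (trans (cong (cutSize P +_) (+-identityʳ _))
                  (cong (cutSize P +_) (sym (darts-flip λ a b → ind (P a ∧ not (P b)))))) ⟩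
            dW + (cutSize P + cut′) + cross + dZ + inside
              ≡⟨ cong (λ c → c + cross + dZ + inside) (sym (+-assoc dW _ _)) ⟩
            dW + cutSize P + cut′ + cross + dZ + inside
              ≡⟨ cong (λ c → c + cross + dZ + inside) (sym (sum-+₃ _ _ _)) ⟩
            sum (λ x → w x + c x + c′ x) + cross + dZ + inside
              ≡⟨ cong (_+ inside) (sym (sum-+₃ _ _ _)) ⟩
            sum (λ x → w x + c x + c′ x + k x + z x) + inside
              ≡⟨ sym (sum-+ _ _) ⟩
            sum (λ x → w x + c x + c′ x + k x + z x + i x)
              ≤⟨ sum-mono (λ x → types (P (tail x)) (W (tail x)) (P (hd x)) (W (hd x)) (disj (tail x)) (disj (hd x))) ⟩
            count {d} (λ _ → true)
              ≡⟨ count-true d ⟩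
            d ∎
            where
            open ≤-Reasoning
            cut′ = darts (λ a b → ind (P b ∧ not (P a)))
            w c c′ k z i : Fin d → ℕ
            w x = ind (W (tail x) ∧ W (hd x))
            c x = ind (P (tail x) ∧ not (P (hd x)))
            c′ x = ind (P (hd x) ∧ not (P (tail x)))
            k x = ind (W (tail x) ∧ not (P (hd x)) ∧ not (W (hd x)))
            z x = ind ((not (P (tail x)) ∧ not (W (tail x))) ∧ not (P (hd x)))
            i x = ind (P (tail x) ∧ P (hd x))

  -- Walking around a vertex u from its dart x₀, membership in W of the neighbours stays constant until x₀ comes back.
  rotation-crosses : ∀ (W : Fin n → Bool) (x₀ x y : Fin d) → tail x ≡ tail x₀ → tail y ≡ tail x₀ →
    W (hd x) ≡ true → W (hd y) ≡ false → hd x ≢ hd x₀ → hd y ≢ hd x₀ →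
    ¬ (∀ z → hd z ≢ tail x₀ → hd z ≢ hd x₀ → tail z ≢ tail x₀ → tail z ≢ hd x₀ → W (tail z) ≡ W (hd z))
  rotation-crosses W x₀ x y tx ty wx wy hx hy h =
    true≢false (trans (sym wx) (trans (status x tx hx) (trans (sym (status y ty hy)) wy)))
    where
    b = W (hd (σ x₀))
    tail-iter : ∀ k → tail (iter σ k x₀) ≡ tail x₀
    tail-iter zero = refl
    tail-iter (suc k) = trans (σ-tail _) (tail-iter k)
    other : ∀ z → tail z ≡ tail x₀ → z ≢ x₀ → hd z ≢ hd x₀
    other z t ne e = ne (no-multi z x₀ t e)
    -- The neighbours at the ends of `z` and `σ z` are joined by the third side `w` of the face at
    -- this corner, and this side avoids both ends of `x₀`.
    step : ∀ z → tail z ≡ tail x₀ → z ≢ x₀ → σ z ≢ x₀ → W (hd z) ≡ W (hd (σ z))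
    step z t ne ne′ = trans (cong W (sym tail-w)) (trans (h (α w)
        (subst₂ _≢_ (sym hd-w) t (loopless (σ z) ∘ flip trans (sym (σ-tail z))))
        (subst (_≢ hd x₀) (sym hd-w) (other (σ z) (trans (σ-tail z) t) ne′))
        (subst₂ _≢_ (sym tail-w) t (loopless z))
        (subst (_≢ hd x₀) (sym tail-w) (other z t ne)))
      (cong W hd-w))
      where
      w = φ (φ (α z))
      w≡ : φ (α z) ≡ σ z
      w≡ = cong σ (α-invol z)
      tail-w : tail (α w) ≡ hd z
      tail-w = trans (hd-φφ (α z)) refl
      hd-w : hd (α w) ≡ hd (σ z)
      hd-w = trans (hd-α w) (trans (tail-φ _) (cong hd w≡))
    along : ∀ k → iter σ k x₀ ≡ x₀ ⊎ W (hd (iter σ k x₀)) ≡ b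
    along zero = inj₁ refl
    along (suc k) with iter σ k x₀ ≟F x₀ | iter σ (suc k) x₀ ≟F x₀ | along k
    ... | _ | yes e | _ = inj₁ e
    ... | yes e | no _ | _ = inj₂ (cong (W ∘ hd ∘ σ) e)
    ... | no ne | no _ | inj₁ e = ⊥-elim (ne e)
    ... | no ne | no ne′ | inj₂ e = inj₂ (trans (sym (step _ (tail-iter k) ne ne′)) e)
    status : ∀ z → tail z ≡ tail x₀ → hd z ≢ hd x₀ → W (hd z) ≡ b
    status z t ne with σ-trans x₀ z (sym t)
    ... | k , refl with along k
    ... | inj₁ e = ⊥-elim (ne (cong hd e))
    ... | inj₂ e = e

-- Matchings

infixl 1 _>>=_

-- The double-negation monad makes excluded middle available without postulates. It is left whenever
-- the goal is `⊥`.
_>>=_ : ∀ {A B : Set} → ¬ ¬ A → (A → ¬ ¬ B) → ¬ ¬ B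
(m >>= f) k = m (λ a → f a k)

return : ∀ {A : Set} → A → ¬ ¬ A
return a k = k a

lem : ∀ {A : Set} → ¬ ¬ Dec A
lem k = k (no λ a → k (yes a))

¬¬-all : ∀ {n} {P : Fin n → Set} → (∀ i → ¬ ¬ P i) → ¬ ¬ (∀ i → P i)
¬¬-all {zero} h k = k λ ()
¬¬-all {suc n} {P} h = do
  p ← h zero
  ps ← ¬¬-all (λ i → h (suc i))
  return λ { zero → p ; (suc i) → ps i }

not-injective : ∀ {a b} → not a ≡ not b → a ≡ b
not-injective {true} {true} e = refl
not-injective {false} {false} e = refl

not-true : ∀ {b} → not b ≡ true → b ≡ false
not-true {false} e = refl

∨-elim : ∀ {a b} → a ∨ b ≡ true → a ≡ true ⊎ b ≡ true
∨-elim {true} e = inj₁ refl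
∨-elim {false} e = inj₂ e

∨-introʳ : ∀ a {b} → b ≡ true → a ∨ b ≡ true
∨-introʳ true e = refl
∨-introʳ false e = e

∨-introˡ : ∀ {a b} → a ≡ true → a ∨ b ≡ true
∨-introˡ refl = refl

∧-intro : ∀ {a b} → a ≡ true → b ≡ true → a ∧ b ≡ true
∧-intro refl refl = refl

≡false : ∀ {b} → b ≢ true → b ≡ false
≡false {true} h = ⊥-elim (h refl)
≡false {false} h = refl

bool-ext : ∀ {a b} → (a ≡ true → b ≡ true) → (b ≡ true → a ≡ true) → a ≡ b
bool-ext {true} f g = sym (f refl)
bool-ext {false} {true} f g = g refl
bool-ext {false} {false} f g = refl

Graph : ℕ → Set
Graph n = Fin n → Fin n → Bool

_⊆_ : ∀ {n} → Graph n → Graph n → Set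
g ⊆ h = ∀ x y → g x y ≡ true → h x y ≡ true

Symmetric : ∀ {n} → Graph n → Set
Symmetric g = ∀ x y → g x y ≡ true → g y x ≡ true

Irreflexive : ∀ {n} → Graph n → Set
Irreflexive g = ∀ x → g x x ≡ false

below : ∀ {n} → Fin n → Fin n → Bool
below x y = ⌊ suc (toℕ x) ≤? toℕ y ⌋

-- As an involution whose fixed points are the missed vertices, a matching can be switched,
-- restricted or extended by redefining `mate` pointwise, without handling sets of edges.
record Matching {n} (g : Graph n) : Set where
  no-eta-equality
  field
    mate : Fin n → Fin n
    mate-invol : ∀ x → mate (mate x) ≡ x
    mate-edge : ∀ x → mate x ≢ x → g x (mate x) ≡ true

  moved : Fin n → Bool
  moved x = not (mate x == x)

  moved-true : ∀ x → mate x ≢ x → moved x ≡ true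
  moved-true x ne = cong not (≢-== ne)

  moved-sound : ∀ x → moved x ≡ true → mate x ≢ x
  moved-sound x e = ⌊⌋-unsound (mate x ≟F x) (not-true e)

  moved-false : ∀ x → moved x ≡ false → mate x ≡ x
  moved-false x e = ==-sound (not-injective e)

  moved-mate : ∀ x → moved (mate x) ≡ moved x
  moved-mate x = bool-ext
    (λ e → moved-true x λ f → moved-sound (mate x) e (cong mate f))
    (λ e → moved-true (mate x) λ f → moved-sound x e (trans (sym f) (mate-invol x)))

open Matching public

opaque
  size : ∀ {n} {g : Graph n} → Matching g → ℕ
  size M = count λ x → below x (mate M x)

  size≡ : ∀ {n} {g : Graph n} (M : Matching g) → size M ≡ count λ x → below x (mate M x)
  size≡ M = refl

count-moved : ∀ {n} {g : Graph n} (M : Matching g) → count (moved M) ≡ 2 * size M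
count-moved M = begin
  count (moved M) ≡⟨ sum-cong split ⟩
  sum (λ x → ind (below x (mt x)) + ind (below (mt x) (mt (mt x)))) ≡⟨ sum-+ _ _ ⟩
  s + sum (λ x → ind (below (mt x) (mt (mt x)))) ≡⟨ cong (s +_)
      (sum-reindex mt mt (mate-invol M) (mate-invol M) (λ x → ind (below x (mt x)))) ⟩
  s + s ≡⟨ cong₂ _+_ (sym (size≡ M)) (trans (sym (size≡ M)) (sym (+-identityʳ _))) ⟩
  2 * size M ∎
  where
  open ≡-Reasoning
  mt = mate M
  s = count λ x → below x (mt x)
  split : ∀ x → ind (moved M x) ≡ ind (below x (mt x)) + ind (below (mt x) (mt (mt x)))
  split x rewrite mate-invol M x with <-cmp (toℕ x) (toℕ (mt x))
  ... | tri< lt ne ngt rewrite ≢-== {x = mt x} {x} (λ e → ne (cong toℕ (sym e)))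
            | ⌊⌋-yes (suc (toℕ x) ≤? toℕ (mt x)) lt | ⌊⌋-no (suc (toℕ (mt x)) ≤? toℕ x) ngt = refl
  ... | tri≈ nlt e ngt rewrite ⌊⌋-no (suc (toℕ x) ≤? toℕ (mt x)) nlt | ⌊⌋-no (suc (toℕ (mt x)) ≤? toℕ x) ngt
            | ⌊⌋-yes (mt x ≟F x) (toℕ-injective (sym e)) = refl
  ... | tri> nlt ne gt rewrite ≢-== {x = mt x} {x} (λ e → ne (cong toℕ (sym e)))
            | ⌊⌋-no (suc (toℕ x) ≤? toℕ (mt x)) nlt | ⌊⌋-yes (suc (toℕ (mt x)) ≤? toℕ x) gt = refl


Bounded : ∀ {n} → Graph n → ℕ → Set
Bounded g k = ∀ (M : Matching g) → size M ≤ k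

weaken : ∀ {n} {g h : Graph n} → g ⊆ h → Matching g → Matching h
weaken sub M = record { mate = mate M ; mate-invol = mate-invol M ; mate-edge = λ x ne → sub _ _ (mate-edge M x ne) }

opaque
  unfolding size

  size-weaken : ∀ {n} {g h : Graph n} (sub : g ⊆ h) (M : Matching g) → size (weaken sub M) ≡ size M
  size-weaken sub M = refl

bounded-⊆ : ∀ {n} {g h : Graph n} {k} → g ⊆ h → Bounded h k → Bounded g k
bounded-⊆ sub bd M = subst (_≤ _) (size-weaken sub M) (bd (weaken sub M))

idMatching : ∀ {n} (g : Graph n) → Matching g
idMatching g = record { mate = id ; mate-invol = λ _ → refl ; mate-edge = λ x ne → ⊥-elim (ne refl) }

size-id : ∀ {n} (g : Graph n) → size (idMatching g) ≡ 0
size-id g = trans (size≡ (idMatching g)) (sum-zero λ x → cong ind (⌊⌋-no (suc (toℕ x) ≤? toℕ x) (<-irrefl refl)))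

module _ {n} {g : Graph n} (M : Matching g) (a b : Fin n) (Ma : mate M a ≡ a) (Mb : mate M b ≡ b) (a≢b : a ≢ b)
  (gab : g a b ≡ true) (gba : g b a ≡ true) where

  private
    swap : Fin n → Fin n
    swap x with x ≟F a | x ≟F b
    ... | yes _ | _ = b
    ... | no _ | yes _ = a
    ... | no _ | no _ = mate M x

    swap-a : swap a ≡ b
    swap-a with a ≟F a
    ... | yes _ = refl
    ... | no ne = ⊥-elim (ne refl)

    swap-b : swap b ≡ a
    swap-b with b ≟F a | b ≟F b
    ... | yes e | _ = ⊥-elim (a≢b (sym e))
    ... | no _ | yes _ = refl
    ... | no _ | no ne = ⊥-elim (ne refl)

    swap-other : ∀ {x} → x ≢ a → x ≢ b → swap x ≡ mate M x
    swap-other {x} xa xb with x ≟F a | x ≟F b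
    ... | yes e | _ = ⊥-elim (xa e)
    ... | no _ | yes e = ⊥-elim (xb e)
    ... | no _ | no _ = refl

    mate≢ : ∀ {x y} → mate M y ≡ y → x ≢ y → mate M x ≢ y
    mate≢ {x} my ne e = ne (trans (sym (mate-invol M x)) (trans (cong (mate M) e) my))

    by-cases : ∀ {ℓ} {Q : Fin n → Set ℓ} → Q a → Q b → (∀ x → x ≢ a → x ≢ b → Q x) → ∀ x → Q x
    by-cases qa qb q x with x ≟F a | x ≟F b
    ... | yes refl | _ = qa
    ... | no _ | yes refl = qb
    ... | no xa | no xb = q x xa xb

  addEdge : Matching g
  addEdge = record
    { mate = swap
    ; mate-invol = by-cases (trans (cong swap swap-a) swap-b) (trans (cong swap swap-b) swap-a)
        λ x xa xb → trans (cong swap (swap-other xa xb)) (trans (swap-other (mate≢ Ma xa) (mate≢ Mb xb)) (mate-invol M x))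
    ; mate-edge = by-cases (λ _ → subst (λ y → g a y ≡ true) (sym swap-a) gab) (λ _ → subst (λ y → g b y ≡ true) (sym swap-b) gba)
        λ x xa xb ne → subst (λ y → g x y ≡ true) (sym (swap-other xa xb)) (mate-edge M x (subst (_≢ x) (swap-other xa xb) ne))
    }

  addEdge-other : ∀ {x} → x ≢ a → x ≢ b → mate addEdge x ≡ mate M x
  addEdge-other = swap-other

  private
    moved-addEdge : ∀ x → ind (moved addEdge x) ≡ ind (moved M x) + ind (a == x) + ind (b == x)
    moved-addEdge = by-cases caseA caseB other
      where
      caseA : ind (moved addEdge a) ≡ ind (moved M a) + ind (a == a) + ind (b == a)
      caseA rewrite swap-a | Ma | ==-refl a | ≢-== (λ e → a≢b (sym e)) = refl
      caseB : ind (moved addEdge b) ≡ ind (moved M b) + ind (a == b) + ind (b == b)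
      caseB rewrite swap-b | Mb | ==-refl b | ≢-== a≢b = refl
      other : ∀ x → x ≢ a → x ≢ b → ind (moved addEdge x) ≡ ind (moved M x) + ind (a == x) + ind (b == x)
      other x xa xb rewrite swap-other xa xb | ≢-== (λ e → xa (sym e)) | ≢-== (λ e → xb (sym e))
        = sym (trans (+-identityʳ _) (+-identityʳ _))

  size-addEdge : size addEdge ≡ suc (size M)
  size-addEdge = linear 4 (λ m m′ s s′ → m :≡ 2 :* s ⇒ m′ :≡ 2 :* s′ ⇒ m′ :≡ m :+ con 1 :+ con 1 ⇒ s′ :≡ con 1 :+ s) refl
    (count (moved M)) (count (moved addEdge)) (size M) (size addEdge) (count-moved M) (count-moved addEdge)
    (trans (sum-cong moved-addEdge) (trans (sum-+₃ _ _ _) (cong₂ _+_ (cong (count (moved M) +_) (count-== a)) (count-== b))))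

module _ {n} {g : Graph n} (M N : Matching g) (O : Fin n → Bool)
  (closedM : ∀ x → O (mate M x) ≡ O x) (closedN : ∀ x → O (mate N x) ≡ O x) where

  private
    on : Fin n → Fin n
    on x  = if O x then mate N x else mate M x

    on-in : ∀ {x} → O x ≡ true → on x ≡ mate N x
    on-in e rewrite e = refl

    on-out : ∀ {x} → O x ≡ false → on x ≡ mate M x
    on-out e rewrite e = refl



  -- The closure hypotheses say that `O` is a union of components of the two matchings taken
  -- together, so no edge of either crosses its boundary.
  switch : Matching g
  switch = record
    { mate = on
    ; mate-invol = λ x → invol x (O x) refl
    ; mate-edge = λ x → edge x (O x) refl
    }
    where
    invol : ∀ x b → O x ≡ b → on (on x) ≡ x
    invol x true e = trans (cong on (on-in e)) (trans (on-in (trans (closedN x) e)) (mate-invol N x))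
    invol x false e = trans (cong on (on-out e)) (trans (on-out (trans (closedM x) e)) (mate-invol M x))
    edge : ∀ x b → O x ≡ b → on x ≢ x → g x (on x) ≡ true
    edge x true e ne rewrite e = mate-edge N x ne
    edge x false e ne rewrite e = mate-edge M x ne

  switch-in : ∀ {x} → O x ≡ true → mate switch x ≡ mate N x
  switch-in = on-in

  switch-out : ∀ {x} → O x ≡ false → mate switch x ≡ mate M x
  switch-out = on-out

-- At every vertex the two switches use one mate from `M` and one from `N`. If `M` and `N` are
-- maximum, both switches must therefore be maximum too.
size-switch : ∀ {n} {g : Graph n} (M N : Matching g) (O : Fin n → Bool) cM cN →
  size (switch M N O cM cN) + size (switch N M O cN cM) ≡ size M + size N
size-switch M N O cM cN = trans (cong₂ _+_ (size≡ (switch M N O cM cN)) (size≡ (switch N M O cN cM)))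
  (trans (sym (sum-+ _ _)) (trans (sum-cong pointwise) (trans (sum-+ _ _) (cong₂ _+_ (sym (size≡ M)) (sym (size≡ N))))))
  where
  pointwise : ∀ x → ind (below x (if O x then mate N x else mate M x)) + ind (below x (if O x then mate M x else mate N x))
    ≡ ind (below x (mate M x)) + ind (below x (mate N x))
  pointwise x with O x
  ... | true = +-comm (ind (below x (mate N x))) _
  ... | false = refl

-- The vertices on the alternating path of M and N that starts at t, where t is missed by N; e is its other end.
record AlternatingPath {n} {g : Graph n} (M N : Matching g) (t : Fin n) : Set where
  field
    O : Fin n → Bool
    closedM : ∀ x → O (mate M x) ≡ O x
    closedN : ∀ x → O (mate N x) ≡ O x
    start : O t ≡ true
    e : Fin n
    ends-only : ∀ x → O x ≡ true → mate M x ≡ x ⊎ mate N x ≡ x → x ≡ t ⊎ x ≡ e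

module _ {n} {g : Graph n} (M N : Matching g) (t : Fin n) (Nt : mate N t ≡ t) where

  private
    turn : ℕ → Matching g
    turn 0 = M
    turn 1 = N
    turn (suc (suc k)) = turn k

    w : ℕ → Fin n
    w zero = t
    w (suc k) = mate (turn k) (w k)

    Stationary : ℕ → Set
    Stationary k = w (suc k) ≡ w k

    Fresh : ℕ → Set
    Fresh j = ∀ k → k < j → ¬ Stationary k

    OnPath : Fin n → Set
    OnPath x = ∃[ j ] (Fresh j × w j ≡ x)

    End : Set
    End = ∃[ j ] (Fresh j × Stationary j)

    turns : ∀ j → (turn j ≡ M × turn (suc j) ≡ N) ⊎ (turn j ≡ N × turn (suc j) ≡ M)
    turns zero = inj₁ (refl , refl)
    turns (suc zero) = inj₂ (refl , refl)
    turns (suc (suc j)) = turns j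

    forward : ∀ j → Fresh j → OnPath (mate (turn j) (w j))
    forward j fr with w (suc j) ≟F w j
    ... | yes s = j , fr , sym s
    ... | no ns = suc j , (λ k lt → fresh k (m≤n⇒m<n∨m≡n (≤-pred lt))) , refl
      where
      fresh : ∀ k → k < j ⊎ k ≡ j → ¬ Stationary k
      fresh k (inj₁ lt) = fr k lt
      fresh k (inj₂ refl) = ns

    backward : ∀ j → Fresh j → OnPath (mate (turn (suc j)) (w j))
    backward zero fr = zero , fr , sym Nt
    backward (suc j) fr = j , (λ k lt → fr k (m≤n⇒m≤1+n lt)) , sym (mate-invol (turn j) (w j))

    closed : ∀ x → OnPath x → OnPath (mate M x) × OnPath (mate N x)
    closed x (j , fr , refl) with turns j
    ... | inj₁ (p , q) = subst (λ K → OnPath (mate K (w j))) p (forward j fr) , subst (λ K → OnPath (mate K (w j))) q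
        (backward j fr)
    ... | inj₂ (p , q) = subst (λ K → OnPath (mate K (w j))) q (backward j fr) , subst (λ K → OnPath (mate K (w j))) p
        (forward j fr)

    -- The matching that led into `w (suc j)` covers this vertex, since the step was not stationary.
    -- So if one of the two matchings misses the vertex, it is the one whose turn comes next.
    stationary : ∀ j → Fresh (suc j) → mate M (w (suc j)) ≡ w (suc j) ⊎ mate N (w (suc j)) ≡ w (suc j) → Stationary (suc j)
    stationary j fr fixed with turns j
    stationary j fr (inj₁ m) | inj₁ (p , q) = ⊥-elim
        (fr j ≤-refl (sym (trans (sym (mate-invol (turn j) (w j))) (trans (cong (λ K → mate K (w (suc j))) p) m))))
    stationary j fr (inj₂ m) | inj₁ (p , q) = trans (cong (λ K → mate K (w (suc j))) q) m
    stationary j fr (inj₁ m) | inj₂ (p , q) = trans (cong (λ K → mate K (w (suc j))) q) m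
    stationary j fr (inj₂ m) | inj₂ (p , q) = ⊥-elim
        (fr j ≤-refl (sym (trans (sym (mate-invol (turn j) (w j))) (trans (cong (λ K → mate K (w (suc j))) p) m))))

    unique : ∀ i j → Fresh i → Fresh j → Stationary i → Stationary j → i ≡ j
    unique i j fi fj si sj with <-cmp i j
    ... | tri< lt _ _ = ⊥-elim (fj i lt si)
    ... | tri≈ _ e _ = e
    ... | tri> _ _ gt = ⊥-elim (fi j gt sj)

    lastVertex : Dec End → Fin n
    lastVertex (yes (j , _)) = w j
    -- A default: if the walk never stops, no vertex on it other than `t` is missed. This spares a
    -- proof that the walk terminates.
    lastVertex (no _) = t

    onlyEnds : (D : Dec End) → ∀ x → OnPath x → mate M x ≡ x ⊎ mate N x ≡ x → x ≡ t ⊎ x ≡ lastVertex D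
    onlyEnds D x (zero , fr , refl) fixed = inj₁ refl
    onlyEnds (yes (i , fi , si)) x (suc j , fr , refl) fixed =
      inj₂ (cong w (unique (suc j) i fr fi (stationary j fr fixed) si))
    onlyEnds (no ¬end) x (suc j , fr , refl) fixed = ⊥-elim (¬end (suc j , fr , stationary j fr fixed))

  alternatingPath : ¬ ¬ AlternatingPath M N t
  alternatingPath = do
    D ← lem
    onPath? ← ¬¬-all (λ x → lem {OnPath x})
    let closed-under : (K : Matching g) → (∀ x → OnPath x → OnPath (mate K x)) → ∀ x → ⌊ onPath? (mate K x) ⌋ ≡ ⌊ onPath? x ⌋
        closed-under K c x = bool-ext
          (λ e → ⌊⌋-yes (onPath? x) (subst OnPath (mate-invol K x) (c _ (⌊⌋-sound (onPath? (mate K x)) e))))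
          (λ e → ⌊⌋-yes (onPath? (mate K x)) (c x (⌊⌋-sound (onPath? x) e)))
    return record
      { O = λ x → ⌊ onPath? x ⌋
      ; closedM = closed-under M (λ x p → proj₁ (closed x p))
      ; closedN = closed-under N (λ x p → proj₂ (closed x p))
      ; start = ⌊⌋-yes (onPath? t) (zero , (λ k ()) , refl)
      ; e = lastVertex D
      ; ends-only = λ x o → onlyEnds D x (⌊⌋-sound (onPath? x) o)
      }

-- Barriers and factor-critical components

opaque
  del : ∀ {n} → Graph n → (Fin n → Bool) → Graph n
  del g P x y = g x y ∧ not (P x) ∧ not (P y)

  del-⊆ : ∀ {n} (g : Graph n) P → del g P ⊆ g
  del-⊆ g P x y e = proj₁ (∧-elim e)

  del-outˡ : ∀ {n} (g : Graph n) P {x y} → del g P x y ≡ true → P x ≡ false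
  del-outˡ g P {x} {y} e = not-true (proj₁ (∧-elim (proj₂ (∧-elim {g x y} e))))

  del-outʳ : ∀ {n} (g : Graph n) P {x y} → del g P x y ≡ true → P y ≡ false
  del-outʳ g P {x} {y} e = not-true (proj₂ (∧-elim {not (P x)} (proj₂ (∧-elim {g x y} e))))

  del-intro : ∀ {n} (g : Graph n) P {x y} → g x y ≡ true → P x ≡ false → P y ≡ false → del g P x y ≡ true
  del-intro g P e px py rewrite e | px | py = refl

  del≡ : ∀ {n} (g : Graph n) P x y → del g P x y ≡ g x y ∧ not (P x) ∧ not (P y)
  del≡ g P x y = refl

  del-irr : ∀ {n} {g : Graph n} P → Irreflexive g → Irreflexive (del g P)
  del-irr P i x rewrite i x = refl

del-sym : ∀ {n} {g : Graph n} P → Symmetric g → Symmetric (del g P)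
del-sym {g = g} P s x y e = del-intro g P (s x y (del-⊆ g P x y e)) (del-outʳ g P e) (del-outˡ g P e)

del-mate : ∀ {n} {g : Graph n} {P} (M : Matching (del g P)) {x} → P x ≡ true → mate M x ≡ x
del-mate {g = g} {P} M {x} px with mate M x ≟F x
... | yes e = e
... | no ne = ⊥-elim (true≢false (trans (sym px) (del-outˡ g P (mate-edge M x ne))))

Missed : ∀ {n} → Graph n → ℕ → Fin n → Set
Missed g m v = Σ[ M ∈ Matching g ] (size M ≡ m × mate M v ≡ v)

-- This plays the part of the Gallai-Edmonds decomposition: `missed` is the hypothesis of Gallai's
-- lemma for the graph without `P`, and each vertex of `P` accounts for one edge of the bound `t`.
record Barrier {n} (g : Graph n) (t : ℕ) : Set where
  field
    P : Fin n → Bool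
    m : ℕ
    count+m : count P + m ≡ t
    bounded : Bounded (del g P) m
    missed : ∀ v → Missed (del g P) m v

_∪[_] : ∀ {n} → (Fin n → Bool) → Fin n → Fin n → Bool
(P ∪[ v ]) x = P x ∨ (v == x)

count-∪ : ∀ {n} (P : Fin n → Bool) {v} → P v ≡ false → count (P ∪[ v ]) ≡ suc (count P)
count-∪ P {v} pv = trans (sum-cong pointwise) (trans (sum-+ _ _) (trans (cong (_+ count P) (count-== v)) refl))
  where
  pointwise : ∀ x → ind (P x ∨ (v == x)) ≡ ind (v == x) + ind (P x)
  pointwise x with v ≟F x
  ... | yes refl rewrite pv = refl
  ... | no _ with P x
  ...   | true = refl
  ...   | false = refl

-- A vertex covered by all maximum matchings is moved into P, which lowers the matching number.
barrier : ∀ {n} {g : Graph n} t → t < n → Bounded g t → ¬ ¬ Barrier g t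
barrier {n} {g} t t<n bd = grow t (λ _ → false) (trans (cong (_+ t) (sum-zero λ _ → refl)) refl)
  (bounded-⊆ (del-⊆ g (λ _ → false)) bd)
  where
  outside : (P : Fin n → Bool) → count P ≤ t → ∃[ v ] P v ≡ false
  outside P le with count-witness (not ∘ P) (linear 4 (λ n t p q → t :< n ⇒ p :≤ t ⇒ p :+ q :≡ n ⇒ con 0 :< q) refl
    n t (count P) (count (not ∘ P)) t<n le (count-complement P))
  ... | v , e = v , not-true e
  grow : ∀ m P → count P + m ≡ t → Bounded (del g P) m → ¬ ¬ Barrier g t
  grow m P eq bd = lem {∃[ v ] (P v ≡ false × ¬ Missed (del g P) m v)} >>= λ
    { (no h) → do
        missed ← ¬¬-all λ v → missedOutside h v
        let v₀ , pv₀ = outside P (subst (count P ≤_) eq (m≤m+n _ _))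
        return record { P = P ; m = m ; count+m = eq ; bounded = bd
          ; missed = λ v → choose missed v₀ pv₀ v (P v) refl }
    ; (yes (v , pv , h)) → shrink m P v eq bd pv h }
    where
    missedOutside : ¬ (∃[ v ] (P v ≡ false × ¬ Missed (del g P) m v)) → ∀ v → ¬ ¬ (P v ≡ false → Missed (del g P) m v)
    missedOutside h v k = k λ pv → ⊥-elim (h (v , pv , λ M → k λ _ → M))
    -- A vertex of `P` is isolated in `del g P`, so every maximum matching misses it; the vertex
    -- `v₀` outside `P`, which exists by `t < n`, supplies one.
    choose : (∀ v → P v ≡ false → Missed (del g P) m v) → ∀ v₀ → P v₀ ≡ false → ∀ v b → P v ≡ b → Missed (del g P) m v
    choose missed v₀ pv₀ v false pv = missed v pv
    choose missed v₀ pv₀ v true pv with missed v₀ pv₀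
    ... | M , s , _ = M , s , del-mate M pv
    shrink : ∀ m P v → count P + m ≡ t → Bounded (del g P) m → P v ≡ false → ¬ Missed (del g P) m v → ¬ ¬ Barrier g t
    shrink zero P v eq bd pv h = ⊥-elim (h (idMatching _ , size-id _ , refl))
    shrink (suc m) P v eq bd pv h = grow m (P ∪[ v ]) (trans (cong (_+ m) (count-∪ P pv)) (trans (sym (+-suc _ m)) eq)) λ M →
      ≤-pred (≤∧≢⇒< (bounded-⊆ sub bd M) λ e → h
          (weaken sub M , trans (size-weaken sub M) e , del-mate M (∨-introʳ (P v) (==-refl v))))
      where
      sub : del g (P ∪[ v ]) ⊆ del g P
      sub x y e = del-intro g P (del-⊆ g _ x y e) (off (del-outˡ g _ e)) (off (del-outʳ g _ e))
        where
        off : ∀ {x} → P x ∨ (v == x) ≡ false → P x ≡ false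
        off {x} e with P x
        ... | false = refl

degree : ∀ {n} → Graph n → Fin n → ℕ
degree g x = count (g x)

-- Ordered pairs, so each edge of a symmetric graph counts twice; hence `4 * n + 8` below stands for
-- `2 * n + 4` edges.
pairs : ∀ {n} → Graph n → ℕ
pairs g = sum λ x → count (g x)

isolated : ∀ {n} → Graph n → Fin n → Bool
isolated g x = degree g x ≤ᵇ 0

covered : ∀ {n} → Graph n → Fin n → Bool
covered g x = not (isolated g x)

covered-intro : ∀ {n} (g : Graph n) {x y} → g x y ≡ true → covered g x ≡ true
covered-intro g {x} {y} e = positive (degree g x) (≤-trans (≤-reflexive (cong ind (sym e))) (term≤sum (λ y → ind (g x y)) y))
  where
  positive : ∀ k → 0 < k → not (k ≤ᵇ 0) ≡ true
  positive (suc k) _ = refl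

covered-elim : ∀ {n} (g : Graph n) {x} → covered g x ≡ true → 0 < degree g x
covered-elim g {x} = positive (degree g x)
  where
  positive : ∀ k → not (k ≤ᵇ 0) ≡ true → 0 < k
  positive (suc k) _ = s≤s z≤n

-- By Gallai's lemma the components have `2 * k + 1` vertices, where the numbers `k` add up to `m`.
-- The extremes are `m` triangles for the covered vertices and one complete graph on `2 * m + 1`
-- vertices for the edges. In `concentrated`, either one component carries all `m` edges or each has
-- `k ≤ m - 1`, which lowers the number of pairs to `2 * m * (2 * m - 1)`.
record Blocks {n} (h : Graph n) (m : ℕ) : Set where
  field
    covered≤3m : count (covered h) ≤ 3 * m
    pairs≤ : pairs h ≤ 2 * m * (2 * m + 1)
    concentrated : count (covered h) ≤ 2 * m + 1 ⊎ pairs h + 4 * m ≤ 2 * m * (2 * m + 1)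

-- The counting needs only that the components are the classes of an equivalence R that a matching mt pairs off
-- up to at most one vertex per class.
module Components {n} {h : Graph n} {m : ℕ} (hirr : Irreflexive h) (R : Fin n → Fin n → Bool)
  (R-refl : ∀ u → R u u ≡ true) (R-sym : ∀ {u v} → R u v ≡ true → R v u ≡ true)
  (R-trans : ∀ {u v w} → R u v ≡ true → R v w ≡ true → R u w ≡ true)
  (R-edge : ∀ {u v} → h u v ≡ true → R u v ≡ true)
  (mv : Fin n → Bool) (mt : Fin n → Fin n) (mate-moves : ∀ {x} → mv x ≡ true → mt x ≢ x)
  (mv-mate : ∀ x → mv (mt x) ≡ mv x) (R-mate : ∀ u → R u (mt u) ≡ true) (count-mv : count mv ≡ 2 * m)
  (fixed-distinct : ∀ {y z} → R y z ≡ true → mv y ≡ false → mv z ≡ false → y ≡ z) where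

  class cls-moved cls-fixed : Fin n → ℕ
  class x = count (R x)
  cls-moved x = count λ y → R x y ∧ mv y
  cls-fixed x = count λ y → R x y ∧ not (mv y)

  class-split : ∀ x → class x ≡ cls-moved x + cls-fixed x
  class-split x = trans (sum-cong λ y → split (R x y) (mv y)) (sum-+ _ _)
    where
    split : ∀ a b → ind a ≡ ind (a ∧ b) + ind (a ∧ not b)
    split true true = refl
    split true false = refl
    split false _ = refl

  fixed≤1 : ∀ x → cls-fixed x ≤ 1
  fixed≤1 x with cls-fixed x in eq
  ... | zero = z≤n
  ... | suc k with count-witness (λ y → R x y ∧ not (mv y)) (subst (0 <_) (sym eq) (s≤s z≤n))
  ... | y , e with ∧-elim {R x y} e
  ... | rxy , my = subst (_≤ 1) eq (≤-trans (count-mono only-y) (≤-reflexive (count-== y)))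
    where
    only-y : ∀ z → R x z ∧ not (mv z) ≡ true → (y == z) ≡ true
    only-y z f with ∧-elim {R x z} f | y ≟F z
    ... | _ | yes _ = refl
    ... | rxz , mz | no ne = ⊥-elim (ne (fixed-distinct (R-trans (R-sym rxy) rxz) (not-true my) (not-true mz)))

  degree<class : ∀ x → suc (degree h x) ≤ class x
  degree<class x = subst (_≤ class x) (trans (sum-+ _ _) (cong (_+ degree h x) (count-== x))) (sum-mono le)
    where
    le : ∀ y → ind (x == y) + ind (h x y) ≤ ind (R x y)
    le y with x ≟F y
    ... | yes refl rewrite hirr x | R-refl x = ≤-refl
    ... | no ne with h x y in e
    ...   | true rewrite R-edge e = ≤-refl
    ...   | false = z≤n

  degree≤ : ∀ x → degree h x ≤ cls-moved x
  degree≤ x = linear 4 (λ d c a b → con 1 :+ d :≤ c ⇒ c :≡ a :+ b ⇒ b :≤ con 1 ⇒ d :≤ a) refl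
    (degree h x) (class x) (cls-moved x) (cls-fixed x) (degree<class x) (class-split x) (fixed≤1 x)

  cls-moved≤ : ∀ x → cls-moved x ≤ 2 * m
  cls-moved≤ x = ≤-trans (count-mono λ y e → proj₂ (∧-elim {R x y} e)) (≤-reflexive count-mv)

  -- Summing over moved vertices instead: each class contains at most one fixed vertex.
  sum-cls-moved : ∀ (p : Fin n → Bool) → sum (λ x → ind (p x) * cls-moved x) ≡ sum (λ y → ind (mv y) * count (λ x → R y x ∧ p x))
  sum-cls-moved p = begin
    sum (λ x → ind (p x) * cls-moved x) ≡⟨ sum-cong (λ x → sym (sum-*ˡ (ind (p x)) _)) ⟩
    sum (λ x → sum (λ y → ind (p x) * ind (R x y ∧ mv y))) ≡⟨ sum-comm _ ⟩
    sum (λ y → sum (λ x → ind (p x) * ind (R x y ∧ mv y))) ≡⟨ sum-cong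
        (λ y → sum-cong λ x → trans (cong (λ r → ind (p x) * ind (r ∧ mv y)) (bool-ext R-sym R-sym)) (table (p x) (R y x) (mv y))) ⟩
    sum (λ y → sum (λ x → ind (mv y) * ind (R y x ∧ p x))) ≡⟨ sum-cong (λ y → sum-*ˡ (ind (mv y)) _) ⟩
    sum (λ y → ind (mv y) * count (λ x → R y x ∧ p x)) ∎
    where
    open ≡-Reasoning
    table : ∀ a b c → ind a * ind (b ∧ c) ≡ ind c * ind (b ∧ a)
    table true true true = refl
    table true true false = refl
    table true false true = refl
    table true false false = refl
    table false true true = refl
    table false true false = refl
    table false false true = refl
    table false false false = refl

  -- The degree of a vertex is at most the number of moved vertices in its class. Counted from the
  -- moved vertices instead, each of the `2 * m` of them contributes its whole class, of at most
  -- `c + 1` vertices.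
  pairs-bound : ∀ c → (∀ x → cls-moved x ≤ c) → pairs h ≤ 2 * m * (c + 1)
  pairs-bound c le = begin
    pairs h ≤⟨ sum-mono degree≤ ⟩
    sum cls-moved ≡⟨ sum-cong (λ x → sym (+-identityʳ _)) ⟩
    sum (λ x → ind true * cls-moved x) ≡⟨ sum-cls-moved (λ _ → true) ⟩
    sum (λ y → ind (mv y) * count (λ x → R y x ∧ true)) ≤⟨ sum-mono (λ y → *-monoʳ-≤ (ind (mv y)) (class≤ y)) ⟩
    sum (λ y → ind (mv y) * (c + 1)) ≡⟨ sum-cong (λ y → *-comm (ind (mv y)) (c + 1)) ⟩
    sum (λ y → (c + 1) * ind (mv y)) ≡⟨ sum-*ˡ (c + 1) _ ⟩
    (c + 1) * count mv ≡⟨ trans (*-comm (c + 1) _) (cong (_* (c + 1)) count-mv) ⟩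
    2 * m * (c + 1) ∎
    where
    open ≤-Reasoning
    class≤ : ∀ y → count (λ x → R y x ∧ true) ≤ c + 1
    class≤ y = ≤-trans (count-mono λ x e → proj₁ (∧-elim e))
        (≤-trans (≤-reflexive (class-split y)) (+-mono-≤ {cls-moved y} {c} {cls-fixed y} {1} (le y) (fixed≤1 y)))

  covered-moved : ∀ x → covered h x ≡ true → 2 ≤ cls-moved x
  covered-moved x e with count-witness (λ y → R x y ∧ mv y) (<-≤-trans (covered-elim h e) (degree≤ x))
  ... | y , f with ∧-elim {R x y} f
  ... | rxy , my = subst (_≤ cls-moved x) (trans (sum-+ _ _) (cong₂ _+_ (count-== y) (count-== (mt y)))) (sum-mono le)
    where
    le : ∀ z → ind (y == z) + ind (mt y == z) ≤ ind (R x z ∧ mv z)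
    le z with y ≟F z | mt y ≟F z
    ... | yes refl | yes e = ⊥-elim (mate-moves my e)
    ... | yes refl | no _ rewrite f = ≤-refl
    ... | no _ | yes refl rewrite R-trans rxy (R-mate y) | trans (mv-mate y) my = ≤-refl
    ... | no _ | no _ = z≤n

  -- A covered vertex that the matching misses shares its class with a matched pair, and no class
  -- contains two missed vertices. So there are at most half as many of them as moved vertices, that
  -- is, at most `m`.
  covered-bound : count (covered h) ≤ 3 * m
  covered-bound = linear 4 (λ w f v m → w :≤ v :+ f ⇒ v :≡ 2 :* m ⇒ 2 :* f :≤ v ⇒ w :≤ 3 :* m) refl
    (count (covered h)) (count λ x → covered h x ∧ not (mv x)) (count mv) m
    (≤-trans (sum-mono λ x → truth-table 2 (λ a b → ind a) (λ a b → ind b + ind (a ∧ not b)) refl (covered h x) (mv x))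
        (≤-reflexive (sum-+ _ _)))
    count-mv
    (begin
      2 * count (λ x → covered h x ∧ not (mv x)) ≡⟨ sym (sum-*ˡ 2 _) ⟩
      sum (λ x → 2 * ind (covered h x ∧ not (mv x))) ≤⟨ sum-mono le ⟩
      sum (λ x → ind (not (mv x)) * cls-moved x) ≡⟨ sum-cls-moved (not ∘ mv) ⟩
      sum (λ y → ind (mv y) * cls-fixed y) ≤⟨ sum-mono (λ y → *-monoʳ-≤ (ind (mv y)) (fixed≤1 y)) ⟩
      sum (λ y → ind (mv y) * 1) ≡⟨ sum-cong (λ y → *-identityʳ _) ⟩
      count mv ∎)
    where
    open ≤-Reasoning
    le : ∀ x → 2 * ind (covered h x ∧ not (mv x)) ≤ ind (not (mv x)) * cls-moved x
    le x with covered h x in e | mv x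
    ... | true | true = z≤n
    ... | true | false = ≤-trans (covered-moved x e) (≤-reflexive (sym (+-identityʳ _)))
    ... | false | _ = z≤n

  all-moved : ∀ y → 2 * m ≤ cls-moved y → ∀ z → mv z ≡ true → R y z ≡ true
  all-moved y le z mz with R y z in e
  ... | true = refl
  ... | false = ⊥-elim (<⇒≱ bigger (≤-trans (≤-reflexive count-mv) le))
    where
    pointwise : ∀ x → ind (z == x) + ind (R y x ∧ mv x) ≤ ind (mv x)
    pointwise x with z ≟F x
    ... | yes refl rewrite e | mz = ≤-refl
    ... | no _ = truth-table 2 (λ a b → ind (a ∧ b)) (λ a b → ind b) refl (R y x) (mv x)
    bigger : suc (cls-moved y) ≤ count mv
    bigger = subst (_≤ count mv) (trans (sum-+ _ _) (cong (_+ cls-moved y) (count-== z))) (sum-mono pointwise)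

  in-full-class : ∀ y → 2 * m ≤ cls-moved y → ∀ x → 0 < cls-moved x → R y x ≡ true
  in-full-class y le x pos =
    let z , f = count-witness (λ z → R x z ∧ mv z) pos
        rxz , mz = ∧-elim {R x z} f
    in R-trans (all-moved y le z mz) (R-sym rxz)

  class≤ : ∀ y → class y ≤ 2 * m + 1
  class≤ y = linear 4 (λ a b c d → a :≡ b :+ c ⇒ b :≤ d ⇒ c :≤ con 1 ⇒ a :≤ d :+ con 1) refl
    (class y) (cls-moved y) (cls-fixed y) (2 * m) (class-split y) (cls-moved≤ y) (fixed≤1 y)

  full-class : ∀ y → 2 * m ≤ cls-moved y → count (covered h) ≤ 2 * m + 1
  full-class y le = ≤-trans (count-mono {p = covered h} {q = R y} λ x cx → in-full-class y le x (<⇒≤ (covered-moved x cx)))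
      (class≤ y)

  -- Parity: a moved vertex outside the class has its mate outside as well.
  sub-class : ∀ y → cls-moved y < 2 * m → cls-moved y + 2 ≤ 2 * m
  sub-class y lt with count-witness (λ z → mv z ∧ not (R y z)) (linear 3 (λ c v k → c :< v ⇒ v :≤ c :+ k ⇒ con 0 :< k) refl
      (cls-moved y) (count mv) (count λ z → mv z ∧ not (R y z)) (subst (cls-moved y <_) (sym count-mv) lt)
      (≤-trans (sum-mono λ z → truth-table 2 (λ a b → ind b) (λ a b → ind (a ∧ b) + ind (b ∧ not a)) refl (R y z) (mv z))
          (≤-reflexive (sum-+ _ _))))
  ... | z , f with ∧-elim {mv z} f
  ... | mz , rz = subst₂ _≤_ (trans (sum-+₃ _ _ _)
      (trans (cong₂ (λ a b → cls-moved y + a + b) (count-== z) (count-== (mt z))) (+-assoc (cls-moved y) 1 1)))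
      count-mv (sum-mono le)
    where
    le : ∀ x → ind (R y x ∧ mv x) + ind (z == x) + ind (mt z == x) ≤ ind (mv x)
    le x with z ≟F x | mt z ≟F x
    ... | yes refl | yes e = ⊥-elim (mate-moves mz e)
    ... | yes refl | no _ rewrite not-true rz | mz = ≤-refl
    ... | no _ | yes refl rewrite ≡false (λ r → true≢false (trans (sym (R-trans r (R-sym (R-mate z)))) (not-true rz))) | trans (mv-mate z) mz = ≤-refl
    ... | no _ | no _ = truth-table 2 (λ a b → ind (a ∧ b) + 0 + 0) (λ a b → ind b) refl (R y x) (mv x)

  componentBlocks : Blocks h m
  componentBlocks = record
    { covered≤3m = covered-bound
    ; pairs≤ = pairs-bound (2 * m) cls-moved≤
    ; concentrated = case any? (λ y → 2 * m ≤? cls-moved y) of λ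
        { (yes (y , le)) → inj₁ (full-class y le)
        ; (no none) → inj₂ (spread λ y → sub-class y (≰⇒> λ le → none (y , le)) ) }
    }
    where
    spread : (∀ y → cls-moved y + 2 ≤ 2 * m) → pairs h + 4 * m ≤ 2 * m * (2 * m + 1)
    spread le = lower m le (pairs-bound (2 * m ∸ 2) λ y → m+n≤o⇒m≤o∸n (cls-moved y) (le y))
      where
      lower : ∀ m → (∀ y → cls-moved y + 2 ≤ 2 * m) → pairs h ≤ 2 * m * (2 * m ∸ 2 + 1) → pairs h + 4 * m ≤ 2 * m * (2 * m + 1)
      lower zero _ b = subst (_≤ 0) (sym (+-identityʳ _)) b
      lower (suc k) _ b = ≤-trans (+-monoˡ-≤ (4 * suc k)
          (≤-trans b (≤-reflexive (cong (λ z → 2 * suc k * (z ∸ 2 + 1)) (double k))))) (≤-reflexive (identity k))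
        where
        double : ∀ k → 2 * suc k ≡ 2 + 2 * k
        double = solve-∀
        identity : ∀ k → 2 * suc k * (2 * k + 1) + 4 * suc k ≡ 2 * suc k * (2 * suc k + 1)
        identity = solve-∀

module _ {n} {h : Graph n} {m : ℕ} (hsym : Symmetric h) (hirr : Irreflexive h) (bd : Bounded h m)
  (missed : ∀ v → Missed h m v) where

  private
    BothMissed : Fin n → Fin n → Set
    BothMissed u v = Σ[ M ∈ Matching h ] (size M ≡ m × mate M u ≡ u × mate M v ≡ v)

    adjacent-not-missed : ∀ {u v} → h u v ≡ true → ¬ BothMissed u v
    adjacent-not-missed {u} {v} e (M , s , mu , mv) = <-irrefl s
        (≤-trans (≤-reflexive (sym (size-addEdge M u v mu mv ne e (hsym u v e)))) (bd _))
      where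
      ne : u ≢ v
      ne refl = true≢false (trans (sym e) (hirr u))

    maximum : ∀ (M N : Matching h) (O : Fin n → Bool) (cM : ∀ x → O (mate M x) ≡ O x) (cN : ∀ x → O (mate N x) ≡ O x) → size M
        ≡ m → size N ≡ m → size (switch M N O cM cN) ≡ m
    maximum M N O cM cN sM sN = linear 5 (λ a b c d m → a :+ b :≡ c :+ d ⇒ c :≡ m ⇒ d :≡ m ⇒ a :≤ m ⇒ b :≤ m ⇒ a :≡ m) refl
      (size (switch M N O cM cN)) (size (switch N M O cN cM)) (size M) (size N) m
      (size-switch M N O cM cN) sM sN (bd _) (bd _)

    -- Gallai: if M misses u and w, switching M along the path from v in M Δ N yields a maximum matching
    -- that misses v and one of u, w.
    transitive : ∀ {u v w} → u ≢ v → v ≢ w → u ≢ w → ¬ BothMissed u v → ¬ BothMissed v w → ¬ BothMissed u w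
    transitive {u} {v} {w} u≢v v≢w u≢w uv vw (M , sM , mu , mw) with missed v
    ... | N , sN , nv = alternatingPath M N v nv λ path → out path (AlternatingPath.O path u) (AlternatingPath.O path w) refl refl
      (λ ou → uv (C path , C-maximum path , trans (leaves path ou) mu , covers path))
      (λ ow → vw (C path , C-maximum path , covers path , trans (leaves path ow) mw))
      where
      C : AlternatingPath M N v → Matching h
      C path = switch M N O closedM closedN
        where open AlternatingPath path
      C-maximum : ∀ path → size (C path) ≡ m
      C-maximum path = maximum M N O closedM closedN sM sN
        where open AlternatingPath path
      covers : ∀ path → mate (C path) v ≡ v
      covers path = trans (switch-in M N O closedM closedN start) nv
        where open AlternatingPath path
      leaves : ∀ path {x} → AlternatingPath.O path x ≡ false → mate (C path) x ≡ mate M x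
      leaves path = switch-out M N O closedM closedN
        where open AlternatingPath path
      out : (path : AlternatingPath M N v) → let open AlternatingPath path in
        ∀ a b → O u ≡ a → O w ≡ b → (O u ≡ false → ⊥) → (O w ≡ false → ⊥) → ⊥
      out path false _ ou ow f g = f ou
      out path true false ou ow f g = g ow
      out path true true ou ow f g with AlternatingPath.ends-only path u ou (inj₁ mu) | AlternatingPath.ends-only path w ow (inj₁ mw)
      ... | inj₁ e | _ = u≢v e
      ... | inj₂ _ | inj₁ e = v≢w (sym e)
      ... | inj₂ e | inj₂ e′ = u≢w (trans e (sym e′))

    module Equivalence (missed? : ∀ u v → Dec (BothMissed u v)) (M : Matching h) (sM : size M ≡ m) where

      -- Gallai's relation. Its classes stand in for connected components, so that connectedness
      -- never has to be treated.
      R : Fin n → Fin n → Bool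
      R u v = (u == v) ∨ not ⌊ missed? u v ⌋

      R-refl : ∀ u → R u u ≡ true
      R-refl u = ∨-introˡ (==-refl u)

      R-intro : ∀ {u v} → ¬ BothMissed u v → R u v ≡ true
      R-intro {u} {v} k = ∨-introʳ (u == v) (cong not (⌊⌋-no (missed? u v) k))

      R-cases : ∀ {u v} → R u v ≡ true → u ≡ v ⊎ ¬ BothMissed u v
      R-cases {u} {v} e with ∨-elim {u == v} e
      ... | inj₁ f = inj₁ (==-sound f)
      ... | inj₂ f = inj₂ (⌊⌋-unsound (missed? u v) (not-true f))

      R-sym : ∀ {u v} → R u v ≡ true → R v u ≡ true
      R-sym {u} {v} e with R-cases e
      ... | inj₁ refl = R-refl u
      ... | inj₂ k = R-intro λ { (M , s , a , b) → k (M , s , b , a) }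

      R-trans : ∀ {u v w} → R u v ≡ true → R v w ≡ true → R u w ≡ true
      R-trans {u} {v} {w} a b = go (R-cases a) (R-cases b) (u ≟F v) (v ≟F w) (u ≟F w)
        where
        go : u ≡ v ⊎ ¬ BothMissed u v → v ≡ w ⊎ ¬ BothMissed v w → Dec (u ≡ v) → Dec (v ≡ w) → Dec (u ≡ w) → R u w ≡ true
        go (inj₁ refl) _ _ _ _ = b
        go _ (inj₁ refl) _ _ _ = a
        go _ _ (yes refl) _ _ = b
        go _ _ _ (yes refl) _ = a
        go _ _ _ _ (yes refl) = R-refl u
        go (inj₂ k) (inj₂ l) (no p) (no q) (no r) = R-intro (transitive p q r k l)

      R-edge : ∀ {u v} → h u v ≡ true → R u v ≡ true
      R-edge e = R-intro (adjacent-not-missed e)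

      R-mate : ∀ u → R u (mate M u) ≡ true
      R-mate u with mate M u ≟F u
      ... | yes e = subst (λ v → R u v ≡ true) (sym e) (R-refl u)
      ... | no ne = R-edge (mate-edge M u ne)

      componentBlocks : Blocks h m
      componentBlocks = Components.componentBlocks hirr R R-refl R-sym R-trans R-edge (moved M) (mate M)
        (λ {x} → moved-sound M x) (moved-mate M) R-mate (trans (count-moved M) (cong (2 *_) sM)) distinct
        where
        distinct : ∀ {y z} → R y z ≡ true → moved M y ≡ false → moved M z ≡ false → y ≡ z
        distinct r my mz with R-cases r
        ... | inj₁ e = e
        ... | inj₂ k = ⊥-elim (k (M , sM , moved-false M _ my , moved-false M _ mz))

  blocks : Fin n → ¬ ¬ Blocks h m
  blocks v = do
    missed? ← ¬¬-all λ u → ¬¬-all λ w → lem {BothMissed u w}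
    let M , sM , _ = missed v
    return (Equivalence.componentBlocks missed? M sM)

-- Rerouting matchings around an edge

opaque
  rem : ∀ {n} → Graph n → Fin n → Fin n → Graph n
  rem g a b x y = g x y ∧ not ((x == a ∧ y == b) ∨ (x == b ∧ y == a))

  rem-⊆ : ∀ {n} (g : Graph n) a b → rem g a b ⊆ g
  rem-⊆ g a b x y e = proj₁ (∧-elim e)

  rem-intro : ∀ {n} (g : Graph n) {a b x y} → g x y ≡ true → (x ≡ a → y ≢ b) → (x ≡ b → y ≢ a) → rem g a b x y ≡ true
  rem-intro g {a} {b} {x} {y} e h k rewrite e with x ≟F a | y ≟F b | x ≟F b | y ≟F a
  ... | yes p | yes q | _ | _ = ⊥-elim (h p q)
  ... | _ | _ | yes r | yes s = ⊥-elim (k r s)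
  ... | yes p | no q | yes r | no s = refl
  ... | yes p | no q | no r | _ = refl
  ... | no p | _ | yes r | no s = refl
  ... | no p | _ | no r | _ = refl

  rem-avoidsˡ : ∀ {n} (g : Graph n) {a b x y} → rem g a b x y ≡ true → x ≡ a → y ≢ b
  rem-avoidsˡ g {a} {b} e refl refl rewrite ==-refl a | ==-refl b with g a b
  rem-avoidsˡ g () refl refl | true
  rem-avoidsˡ g () refl refl | false

  rem-avoidsʳ : ∀ {n} (g : Graph n) {a b x y} → rem g a b x y ≡ true → x ≡ b → y ≢ a
  rem-avoidsʳ g {a} {b} e refl refl rewrite ==-refl a | ==-refl b with g b a | (b == a) ∧ (a == b)
  rem-avoidsʳ g () refl refl | true | true
  rem-avoidsʳ g () refl refl | true | false
  rem-avoidsʳ g () refl refl | false | _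

rem-sym : ∀ {n} {g : Graph n} a b → Symmetric g → Symmetric (rem g a b)
rem-sym {g = g} a b s x y e = rem-intro g (s x y (rem-⊆ g a b x y e))
  (λ p q → rem-avoidsʳ g e q p) (λ p q → rem-avoidsˡ g e q p)

rem-del-⊆ : ∀ {n} (g : Graph n) P a b → rem (del g P) a b ⊆ rem g a b
rem-del-⊆ g P a b x y e = rem-intro g (del-⊆ g P x y (rem-⊆ _ a b x y e)) (rem-avoidsˡ _ e) (rem-avoidsʳ _ e)

avoiding : ∀ {n} {g : Graph n} (N : Matching g) a b → a ≡ b ⊎ mate N a ≢ b → Matching (rem g a b)
avoiding {g = g} N a b h = record
  { mate = mate N
  ; mate-invol = mate-invol N
  ; mate-edge = λ x ne → rem-intro g (mate-edge N x ne)
      (λ { refl → λ e → contra h (λ ab → ne (trans e (sym ab))) e })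
      (λ { refl → λ e → contra h (λ ab → ne (trans e ab)) (trans (sym (cong (mate N) e)) (mate-invol N x)) })
  }
  where
  contra : a ≡ b ⊎ mate N a ≢ b → (a ≡ b → ⊥) → mate N a ≡ b → ⊥
  contra (inj₁ e) f _ = f e
  contra (inj₂ ne) _ e = ne e

opaque
  unfolding size

  size-avoiding : ∀ {n} {g : Graph n} (N : Matching g) a b h → size (avoiding N a b h) ≡ size N
  size-avoiding N a b h = refl

module _ {n} {g : Graph n} (M : Matching g) (X : Fin n → Bool) where

  private
    rmate : Fin n → Fin n
    rmate x = if X x ∨ X (mate M x) then x else mate M x

    rmate-cases : ∀ x → rmate x ≡ x ⊎ (rmate x ≡ mate M x × X x ≡ false × X (mate M x) ≡ false)
    rmate-cases x with X x | X (mate M x)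
    ... | true | _ = inj₁ refl
    ... | false | true = inj₁ refl
    ... | false | false = inj₂ (refl , refl , refl)

    rmate-kept : ∀ {x} → X x ≡ false → X (mate M x) ≡ false → rmate x ≡ mate M x
    rmate-kept p q rewrite p | q = refl

  restrict : Matching (del g X)
  restrict = record
    { mate = rmate
    ; mate-invol = invol
    ; mate-edge = edge
    }
    where
    invol : ∀ x → rmate (rmate x) ≡ x
    invol x with rmate-cases x
    ... | inj₁ e = trans (cong rmate e) e
    ... | inj₂ (e , p , q) = trans (cong rmate e)
        (trans (rmate-kept q (subst (λ y → X y ≡ false) (sym (mate-invol M x)) p)) (mate-invol M x))
    edge : ∀ x → rmate x ≢ x → del g X x (rmate x) ≡ true
    edge x ne with rmate-cases x
    ... | inj₁ e = ⊥-elim (ne e)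
    ... | inj₂ (e , p , q) = subst (λ y → del g X x y ≡ true) (sym e) (del-intro g X (mate-edge M x (subst (_≢ x) e ne)) p q)

  restrict-moved : ∀ {x} → mate restrict x ≢ x → mate M x ≢ x
  restrict-moved {x} ne with rmate-cases x
  ... | inj₁ e = ⊥-elim (ne e)
  ... | inj₂ (e , _) = subst (_≢ x) e ne

  restrict-fixes : ∀ {x} → X x ≡ true → mate restrict x ≡ x
  restrict-fixes e rewrite e = refl

  restrict-fixes-mate : ∀ {x} → X (mate M x) ≡ true → mate restrict x ≡ x
  restrict-fixes-mate {x} e with X x
  ... | true = refl
  ... | false rewrite e = refl

  -- A vertex that loses its mate lies in `X` or is the mate of a vertex of `X`. At most
  -- `2 * count X` vertices lose theirs, hence at most `count X` edges are lost.
  size-restrict : size M ≤ size restrict + count X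
  size-restrict = linear 5 (λ m m′ s s′ x → m :≡ 2 :* s ⇒ m′ :≡ 2 :* s′ ⇒ m :≤ m′ :+ x :+ x ⇒ s :≤ s′ :+ x) refl
    (count (moved M)) (count (moved restrict)) (size M) (size restrict) (count X) (count-moved M) (count-moved restrict)
    (≤-trans (sum-mono bound) (≤-reflexive (trans (sum-+₃ _ _ _)
      (cong (count (moved restrict) + count X +_)
          (sum-reindex (mate M) (mate M) (mate-invol M) (mate-invol M) (λ x → ind (X x)))))))
    where
    bound : ∀ x → ind (moved M x) ≤ ind (moved restrict x) + ind (X x) + ind (X (mate M x))
    bound x with X x | X (mate M x)
    ... | true | b = truth-table 3 (λ a b c → ind a) (λ a b c → ind c + 1 + ind b) refl (moved M x) b (not (x == x))
    ... | false | true = truth-table 2 (λ a c → ind a) (λ a c → ind c + 0 + 1) refl (moved M x) (not (x == x))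
    ... | false | false = ≤-reflexive (sym (trans (+-identityʳ _) (+-identityʳ _)))

image : ∀ {n} → (Fin n → Bool) → (Fin n → Fin n) → Fin n → Bool
image p e z = ⌊ any? (λ x → (p x ∧ e x == z) ≟B true) ⌋

image-intro : ∀ {n} (p : Fin n → Bool) (e : Fin n → Fin n) {x} → p x ≡ true → image p e (e x) ≡ true
image-intro p e {x} px = ⌊⌋-yes (any? _) (x , ∧-intro px (==-refl (e x)))

count-image : ∀ {n} (p : Fin n → Bool) (e : Fin n → Fin n) → count (image p e) ≤ count p
count-image p e = begin
  count (image p e) ≤⟨ sum-mono bound ⟩
  sum (λ z → sum (λ x → ind (e x == z) * ind (p x))) ≡⟨ sum-comm (λ z x → ind (e x == z) * ind (p x)) ⟩
  sum (λ x → sum (λ z → ind (e x == z) * ind (p x))) ≡⟨ sum-cong (λ x → sum-δ (e x) (λ _ → ind (p x))) ⟩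
  count p ∎
  where
  open ≤-Reasoning
  bound : ∀ z → ind (image p e z) ≤ sum (λ x → ind (e x == z) * ind (p x))
  bound z with any? (λ x → (p x ∧ e x == z) ≟B true)
  ... | no _ = z≤n
  ... | yes (x , h) with ∧-elim {p x} h
  ...   | px , ex = ≤-trans (≤-reflexive (sym (cong₂ (λ a b → ind a * ind b) ex px)))
      (term≤sum (λ x → ind (e x == z) * ind (p x)) x)

module _ {n} {h : Graph n} {m : ℕ} (hsym : Symmetric h) (bd : Bounded h m) where

  -- The path of A Δ B from the A-missed vertex t either augments A, or B can be rerouted so as to miss t.
  reroute : (A B : Matching h) (t : Fin n) → mate A t ≡ t → m ≤ size A + 1 → size B ≡ m →
    ¬ ¬ (Σ[ C ∈ Matching h ] (size C ≡ m × (∀ x → mate C x ≡ mate A x ⊎ mate C x ≡ mate B x) ×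
      (mate C t ≡ t ⊎ ∃[ e ] (∀ x → mate C x ≢ x → mate A x ≢ x ⊎ x ≡ t ⊎ x ≡ e))))
  reroute A B t At sA sB = do
    path ← alternatingPath B A t At
    return (pick path)
    where
    pick : AlternatingPath B A t → _
    pick path = choose (size C₁ ≟ m)
      where
      open AlternatingPath path
      C₁ C₂ : Matching h
      C₁ = switch A B O closedN closedM
      C₂ = switch B A O closedM closedN
      from : ∀ (M N : Matching h) cM cN x → mate (switch M N O cM cN) x ≡ mate N x ⊎ mate (switch M N O cM cN) x ≡ mate M x
      from M N cM cN x with O x in o
      ... | true = inj₁ refl
      ... | false = inj₂ refl
      augmented : ∀ x → mate C₁ x ≢ x → mate A x ≢ x ⊎ x ≡ t ⊎ x ≡ e
      augmented x ne with mate A x ≟F x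
      ... | no q = inj₁ q
      ... | yes p with O x in o
      ...   | true = inj₂ (ends-only x o (inj₂ p))
      ...   | false = ⊥-elim (ne p)
      choose : Dec (size C₁ ≡ m) → _
      choose (yes s) = C₁ , s , (λ x → [ inj₂ , inj₁ ]′ (from A B closedN closedM x)) , inj₂ (e , augmented)
      -- The two sizes add up to at least `2 * m - 1` and neither exceeds `m`, so one of the
      -- switches has size `m`.
      choose (no s) = C₂ ,
        linear 5 (λ c d a b m → c :+ d :≡ a :+ b ⇒ b :≡ m ⇒ m :≤ a :+ con 1 ⇒ c :< m ⇒ d :≤ m ⇒ d :≡ m) refl
          (size C₁) (size C₂) (size A) (size B) m (size-switch A B O closedN closedM) sB sA (≤∧≢⇒< (bd C₁) s) (bd C₂) ,
        from B A closedM closedN , inj₁ (trans (switch-in B A O closedM closedN start) At)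

  Near : Matching h → Fin n → Fin n → Set
  Near N₁ a b = Σ[ N ∈ Matching h ] (size N ≡ m × mate N a ≢ b × ∃[ e ] (∀ x → mate N x ≢ x → mate N₁ x ≢ x ⊎ x ≡ e))

  -- Remove `ab` from `N₁` and reroute `N₂` along the path that starts at `a`. Either this augments
  -- the rest of `N₁`, and only the far end `e` is new, or the result misses `a`. In the latter case
  -- reroute again, from `b`: a matching that missed both ends could be enlarged by `ab`, so now the
  -- augmentation occurs.
  exchange : (N₁ N₂ : Matching h) (a b : Fin n) → size N₁ ≡ m → size N₂ ≡ m → mate N₁ a ≡ b → a ≢ b → mate N₂ a ≢ b →
    ¬ ¬ Near N₁ a b
  exchange N₁ N₂ a b s₁ s₂ refl a≢b ne = do
    C , sC , fromC , fate ← reroute A N₂ a Aa sA s₂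
    first C sC fromC fate
    where
    X : Fin n → Bool
    X = a ==_
    sub = del-⊆ h X
    A : Matching h
    A = weaken sub (restrict N₁ X)
    Aa : mate A a ≡ a
    Aa = restrict-fixes N₁ X (==-refl a)
    Ab : mate A b ≡ b
    Ab = restrict-fixes-mate N₁ X (subst (λ y → (a == y) ≡ true) (sym (mate-invol N₁ a)) (==-refl a))
    sA : m ≤ size A + 1
    sA = subst₂ _≤_ s₁ (cong₂ _+_ (sym (size-weaken sub (restrict N₁ X))) (count-== a)) (size-restrict N₁ X)
    N₁b : mate N₁ b ≢ b
    N₁b e = a≢b (trans (sym (mate-invol N₁ a)) e)
    second : (C C′ : Matching h) → mate C a ≡ a → size C′ ≡ m →
      (∀ x → mate C′ x ≡ mate A x ⊎ mate C′ x ≡ mate C x) →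
      mate C′ b ≡ b ⊎ ∃[ e ] (∀ x → mate C′ x ≢ x → mate A x ≢ x ⊎ x ≡ b ⊎ x ≡ e) → ¬ ¬ Near N₁ a b
    second C C′ Ca sC′ fromC′ = λ
      { (inj₁ C′b) → ⊥-elim (<-irrefl sC′ (≤-trans (≤-reflexive (sym (size-addEdge C′ a b C′a C′b a≢b edge (hsym a b edge))))
          (bd _)))
      ; (inj₂ (e , f)) → return (C′ , sC′ , (λ p → a≢b (trans (sym C′a) p)) , e , λ x nx → near (f x nx)) }
      where
      C′a : mate C′ a ≡ a
      C′a = [ (λ p → trans p Aa) , (λ p → trans p Ca) ]′ (fromC′ a)
      edge : h a b ≡ true
      edge = mate-edge N₁ a λ e → a≢b (sym e)
      near : ∀ {e x} → mate A x ≢ x ⊎ x ≡ b ⊎ x ≡ e → mate N₁ x ≢ x ⊎ x ≡ e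
      near (inj₁ p) = inj₁ (restrict-moved N₁ X p)
      near (inj₂ (inj₁ refl)) = inj₁ N₁b
      near (inj₂ (inj₂ p)) = inj₂ p
    first : (C : Matching h) → size C ≡ m → (∀ x → mate C x ≡ mate A x ⊎ mate C x ≡ mate N₂ x) →
      mate C a ≡ a ⊎ ∃[ e ] (∀ x → mate C x ≢ x → mate A x ≢ x ⊎ x ≡ a ⊎ x ≡ e) → ¬ ¬ Near N₁ a b
    first C sC fromC (inj₁ Ca) = do
      C′ , sC′ , fromC′ , fate ← reroute A C b Ab sA sC
      second C C′ Ca sC′ fromC′ fate
    first C sC fromC (inj₂ (e , f)) = return (C , sC , avoids , e , λ x nx → near (f x nx))
      where
      avoids : mate C a ≢ b
      avoids p = [ (λ q → a≢b (trans (sym Aa) (trans (sym q) p))) , (λ q → ne (trans (sym q) p)) ]′ (fromC a)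
      near : ∀ {x} → mate A x ≢ x ⊎ x ≡ a ⊎ x ≡ e → mate N₁ x ≢ x ⊎ x ≡ e
      near (inj₁ p) = inj₁ (restrict-moved N₁ X p)
      near (inj₂ (inj₁ refl)) = inj₁ λ e → a≢b (sym e)
      near (inj₂ (inj₂ p)) = inj₂ p

  Localized : (Fin n → Bool) → Set
  Localized B = ∀ a b → Σ[ N ∈ Matching (rem h a b) ] (size N ≡ m × ∀ x → mate N x ≢ x → B x ≡ true)

  -- If `ab` is not an edge of `N₁`, then `N₁` itself survives. Each of its `m` edges needs one
  -- rerouting, with one extra vertex by `exchange`; taking it only at the lower end of the edge
  -- keeps the total at `2 * m + m`.
  localize : (N₁ : Matching h) → size N₁ ≡ m → (∀ a b → ¬ ¬ (Σ[ N ∈ Matching (rem h a b) ] size N ≡ m)) →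
    ¬ ¬ (Σ[ B ∈ (Fin n → Bool) ] (count B ≤ 3 * m × Localized B))
  localize N₁ s₁ robust = do
    E ← ¬¬-all λ x → reroutes x (mate N₁ x ≟F x)
    let hit = image (λ x → below x (mate N₁ x)) (λ x → proj₁ (E x))
        B = λ x → moved N₁ x ∨ hit x
    return (B ,
      ≤-trans (count-∨ (moved N₁) hit)
        (linear 4 (λ a b s m → a :≡ 2 :* s ⇒ b :≤ s ⇒ s :≡ m ⇒ a :+ b :≤ 3 :* m) refl
          (count (moved N₁)) (count hit) (size N₁) m (count-moved N₁)
          (≤-trans (count-image _ _) (≤-reflexive (sym (size≡ N₁)))) s₁) ,
      λ a b → local E a b (a ≟F b) (mate N₁ a ≟F b))
    where
    Rerouted : Fin n → Set
    Rerouted x = ∃[ e ] (mate N₁ x ≢ x →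
      Σ[ N ∈ Matching h ] (size N ≡ m × mate N x ≢ mate N₁ x × (∀ y → mate N y ≢ y → mate N₁ y ≢ y ⊎ y ≡ e)))
    reroutes : ∀ x → Dec (mate N₁ x ≡ x) → ¬ ¬ Rerouted x
    reroutes x (yes p) = return (x , λ ne → ⊥-elim (ne p))
    reroutes x (no ne) = do
      N₂ , s₂ ← robust x (mate N₁ x)
      N , s , av , e , near ← exchange N₁ (weaken (rem-⊆ h _ _) N₂) x (mate N₁ x) s₁ (trans (size-weaken (rem-⊆ h _ _) N₂) s₂) refl
        (λ e → ne (sym e)) (λ e → rem-avoidsˡ h (mate-edge N₂ x λ f → ne (trans (sym e) f)) refl e)
      return (e , λ _ → N , s , av , near)
    local : (E : ∀ x → Rerouted x) → ∀ a b → Dec (a ≡ b) → Dec (mate N₁ a ≡ b) →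
      Σ[ N ∈ Matching (rem h a b) ] (size N ≡ m × ∀ x → mate N x ≢ x →
        moved N₁ x ∨ image (λ x → below x (mate N₁ x)) (λ x → proj₁ (E x)) x ≡ true)
    local E a b (yes e) _ = avoiding N₁ a b (inj₁ e) , trans (size-avoiding N₁ a b (inj₁ e)) s₁ , λ x ne → ∨-introˡ
        (moved-true N₁ x ne)
    local E a b (no _) (no ne) = avoiding N₁ a b (inj₂ ne) , trans (size-avoiding N₁ a b (inj₂ ne)) s₁ , λ x ne → ∨-introˡ
        (moved-true N₁ x ne)
    local E a b (no a≢b) (yes refl) with <-cmp (toℕ a) (toℕ b)
    ... | tri≈ _ e _ = ⊥-elim (a≢b (toℕ-injective e))
    ... | tri< lt _ _ with proj₂ (E a) (λ e → a≢b (sym e))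
    ...   | N , s , av , near = avoiding N a b (inj₂ av) , trans (size-avoiding N a b (inj₂ av)) s , λ x nx →
      [ (λ p → ∨-introˡ (moved-true N₁ x p))
      , (λ { refl → ∨-introʳ (moved N₁ x) (image-intro _ (λ x → proj₁ (E x)) (⌊⌋-yes (_ ≤? _) lt)) }) ]′ (near x nx)
    local E a b (no a≢b) (yes refl) | tri> _ _ gt with proj₂ (E b) (λ e → a≢b (trans (sym (mate-invol N₁ a)) e))
    ...   | N , s , av , near = avoiding N a b (inj₂ av′) , trans (size-avoiding N a b (inj₂ av′)) s , λ x nx →
      [ (λ p → ∨-introˡ (moved-true N₁ x p))
      , (λ { refl → ∨-introʳ (moved N₁ x) (image-intro _ (λ x → proj₁ (E x))
          (⌊⌋-yes (_ ≤? _) (subst (toℕ b <_) (cong toℕ (sym (mate-invol N₁ a))) gt))) }) ]′ (near x nx)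
      where
      av′ : mate N a ≢ b
      av′ e = av (trans (sym (cong (mate N) e)) (trans (mate-invol N a) (sym (mate-invol N₁ a))))

-- Large matchings in subgraphs of plane triangulations

outPairs inPairs : ∀ {n} → Graph n → (Fin n → Bool) → ℕ
outPairs g P = pairs λ u v → g u v ∧ (P u ∧ not (P v))
inPairs g P = pairs λ u v → g u v ∧ (P u ∧ P v)

outdeg : ∀ {n} → Graph n → (Fin n → Bool) → Fin n → ℕ
outdeg g P u = count λ v → g u v ∧ not (P v)

pairs-mono : ∀ {n} {g h : Graph n} → g ⊆ h → pairs g ≤ pairs h
pairs-mono sub = sum-mono λ x → count-mono λ y → sub x y

entry≤pairs : ∀ {n} (g : Graph n) x y → ind (g x y) ≤ pairs g
entry≤pairs g x y = ≤-trans (term≤sum (λ y → ind (g x y)) y) (term≤sum (λ x → count (g x)) x)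

pairs-witness : ∀ {n} (g : Graph n) → 0 < pairs g → ∃[ x ] ∃[ y ] g x y ≡ true
pairs-witness g pos with sum-witness (λ x → count (g x)) pos
... | x , p with count-witness (g x) p
... | y , e = x , y , e

pairs-split : ∀ {n} {g : Graph n} P → Symmetric g → pairs g ≡ pairs (del g P) + 2 * outPairs g P + inPairs g P
pairs-split {n} {g} P gsym = begin
  pairs g
    ≡⟨ sum-cong (λ u → trans (sum-cong (split u))
        (trans (sum-+ _ _) (cong (_+ count (λ v → g u v ∧ (P u ∧ P v))) (sum-+₃ _ _ _)))) ⟩
  sum (λ u → count (del g P u) + count (λ v → g u v ∧ (P u ∧ not (P v))) + count (λ v → g u v ∧ (P v ∧ not (P u)))
     + count (λ v → g u v ∧ (P u ∧ P v)))
    ≡⟨ trans (sum-+ _ _) (cong (_+ inPairs g P) (sum-+₃ _ _ _)) ⟩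
  pairs (del g P) + outPairs g P + pairs (λ u v → g u v ∧ (P v ∧ not (P u))) + inPairs g P
    ≡⟨ cong (λ c → pairs (del g P) + outPairs g P + c + inPairs g P) flipped ⟩
  pairs (del g P) + outPairs g P + outPairs g P + inPairs g P
    ≡⟨ regroup (pairs (del g P)) (outPairs g P) (inPairs g P) ⟩
  pairs (del g P) + 2 * outPairs g P + inPairs g P ∎
  where
  open ≡-Reasoning
  regroup : ∀ a b c → a + b + b + c ≡ a + 2 * b + c
  regroup = solve-∀
  flipped : pairs (λ u v → g u v ∧ (P v ∧ not (P u))) ≡ outPairs g P
  flipped = trans (sum-comm (λ u v → ind (g u v ∧ (P v ∧ not (P u)))))
    (sum-cong λ v → sum-cong λ u → cong (λ b → ind (b ∧ (P v ∧ not (P u)))) (bool-ext (gsym u v) (gsym v u)))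
  split : ∀ u v → ind (g u v) ≡ ind (del g P u v) + ind (g u v ∧ (P u ∧ not (P v))) + ind (g u v ∧ (P v ∧ not (P u)))
    + ind (g u v ∧ (P u ∧ P v))
  split u v rewrite del≡ g P u v with g u v | P u | P v
  ... | false | _ | _ = refl
  ... | true | true | true = refl
  ... | true | true | false = refl
  ... | true | false | true = refl
  ... | true | false | false = refl

inPairs-bound : ∀ {n} {g : Graph n} P → Irreflexive g → inPairs g P + count P ≤ count P * count P
inPairs-bound {n} {g} P irr = begin
  inPairs g P + count P ≡⟨ sym (sum-+ _ _) ⟩
  sum (λ u → count (λ v → g u v ∧ (P u ∧ P v)) + ind (P u)) ≤⟨ sum-mono atRow ⟩
  sum (λ u → count P * ind (P u)) ≡⟨ sum-*ˡ (count P) _ ⟩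
  count P * count P ∎
  where
  open ≤-Reasoning
  atRow : ∀ u → count (λ v → g u v ∧ (P u ∧ P v)) + ind (P u) ≤ count P * ind (P u)
  atRow u with P u in pu
  ... | false = ≤-trans (≤-reflexive (trans (+-identityʳ _) (sum-zero λ v → empty (g u v)))) z≤n
    where
    empty : ∀ b → ind (b ∧ false) ≡ 0
    empty true = refl
    empty false = refl
  ... | true = subst₂ _≤_ (trans (sum-+ _ _) (cong (count (λ v → g u v ∧ P v) +_) (count-== u))) (sym (*-identityʳ (count P)))
      (sum-mono le)
    where
    le : ∀ v → ind (g u v ∧ P v) + ind (u == v) ≤ ind (P v)
    le v with u ≟F v
    ... | yes refl rewrite irr u | pu = ≤-refl
    ... | no _ = truth-table 2 (λ a b → ind (a ∧ b) + 0) (λ a b → ind b) refl (g u v) (P v)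

outPairs-by-vertex : ∀ {n} (g : Graph n) P → outPairs g P ≡ sum λ u → ind (P u) * outdeg g P u
outPairs-by-vertex g P = sum-cong λ u → trans (sum-cong λ v → table (g u v) (P u) (P v)) (sum-*ˡ (ind (P u)) _)
  where
  table : ∀ a b c → ind (a ∧ (b ∧ not c)) ≡ ind b * ind (a ∧ not c)
  table true true c = sym (+-identityʳ _)
  table true false c = refl
  table false true c = refl
  table false false c = refl

outdeg≤ : ∀ {n} (g : Graph n) P u → outdeg g P u ≤ count (not ∘ P)
outdeg≤ g P u = count-mono λ v e → proj₂ (∧-elim {g u v} e)

outPairs≤ : ∀ {n} (g : Graph n) P → outPairs g P ≤ count P * n
outPairs≤ {n} g P = begin
  outPairs g P ≡⟨ outPairs-by-vertex g P ⟩
  sum (λ u → ind (P u) * outdeg g P u) ≤⟨ sum-mono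
      (λ u → *-monoʳ-≤ (ind (P u)) (≤-trans (outdeg≤ g P u) (m+n≤o⇒n≤o (count P) (≤-reflexive (count-complement P))))) ⟩
  sum (λ u → ind (P u) * n) ≡⟨ sum-cong (λ u → *-comm (ind (P u)) n) ⟩
  sum (λ u → n * ind (P u)) ≡⟨ sum-*ˡ n _ ⟩
  n * count P ≡⟨ *-comm n _ ⟩
  count P * n ∎
  where open ≤-Reasoning

pairs-rem : ∀ {n} (g : Graph n) a b → pairs g ≤ pairs (rem g a b) + 2
pairs-rem g a b = begin
  pairs g
    ≤⟨ sum-mono (λ x → sum-mono (bound x)) ⟩
  sum (λ x → sum (λ y → ind (rem g a b x y) + ind (a == x) * ind (b == y) + ind (b == x) * ind (a == y)))
    ≡⟨ sum-cong (λ x → trans (sum-+₃ _ _ _) (cong₂ (λ p q → count (rem g a b x) + p + q) (single a b x) (single b a x))) ⟩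
  sum (λ x → count (rem g a b x) + ind (a == x) + ind (b == x))
    ≡⟨ trans (sum-+₃ _ _ _) (cong₂ (λ p q → pairs (rem g a b) + p + q) (count-== a) (count-== b)) ⟩
  pairs (rem g a b) + 1 + 1
    ≡⟨ +-assoc _ 1 1 ⟩
  pairs (rem g a b) + 2 ∎
  where
  open ≤-Reasoning
  single : ∀ a b x → sum (λ y → ind (a == x) * ind (b == y)) ≡ ind (a == x)
  single a b x = trans (sum-*ˡ (ind (a == x)) _) (trans (cong (ind (a == x) *_) (count-== b)) (*-identityʳ _))
  bound : ∀ x y → ind (g x y) ≤ ind (rem g a b x y) + ind (a == x) * ind (b == y) + ind (b == x) * ind (a == y)
  bound x y = by-cases (a ≟F x) (b ≟F y) (b ≟F x) (a ≟F y)
    where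
    R = ind (rem g a b x y)
    kept : (x ≡ a → y ≢ b) → (x ≡ b → y ≢ a) → ind (g x y) ≤ R + ind (a == x) * ind (b == y) + ind (b == x) * ind (a == y)
    kept h k = ≤-trans (ind-mono λ e → rem-intro g e h k) (≤-trans (m≤m+n R _) (m≤m+n _ _))
    by-cases : Dec (a ≡ x) → Dec (b ≡ y) → Dec (b ≡ x) → Dec (a ≡ y) →
      ind (g x y) ≤ R + ind (a == x) * ind (b == y) + ind (b == x) * ind (a == y)
    by-cases (yes refl) (yes refl) _ _ rewrite ==-refl a | ==-refl b = ≤-trans (ind≤1 (g a b)) (≤-trans (m≤n+m 1 R) (m≤m+n _ _))
    by-cases _ _ (yes refl) (yes refl) rewrite ==-refl a | ==-refl b = ≤-trans (ind≤1 (g b a)) (m≤n+m 1 _)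
    by-cases (no p) _ (no r) _ = kept (λ e → ⊥-elim (p (sym e))) (λ e → ⊥-elim (r (sym e)))
    by-cases (no p) _ _ (no s) = kept (λ e → ⊥-elim (p (sym e))) (λ _ e → s (sym e))
    by-cases _ (no q) (no r) _ = kept (λ _ e → q (sym e)) (λ e → ⊥-elim (r (sym e)))
    by-cases _ (no q) _ (no s) = kept (λ _ e → q (sym e)) (λ _ e → s (sym e))

-- All that the matching arguments know about triangulations. In `cover`, 11 is the largest integer
-- below `(n + 4) / 3` for `n = 30`.
record PlanarFacts {n} (A : Graph n) : Set where
  field
    A-sym : Symmetric A
    A-irr : Irreflexive A
    cover : ∀ (S : Fin n → Bool) → count S ≤ 11 → ∃[ u ] ∃[ v ] (A u v ≡ true × S u ≡ false × S v ≡ false)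
    cut : ∀ (P : Fin n → Bool) → outPairs A P + 4 ≤ 2 * n
    partition : ∀ (P W : Fin n → Bool) → (∀ x → W x ≡ true → P x ≡ false) →
      inPairs A W + 2 * outPairs A P + pairs (λ u v → A u v ∧ (W u ∧ not (P v) ∧ not (W v))) + 12
        ≤ 4 * n + 2 * count P + 2 * count W
    rotation : ∀ (W : Fin n → Bool) {u v x y} → A u v ≡ true → A u x ≡ true → A u y ≡ true → W x ≡ true → W y ≡ false → x ≢ v
        → y ≢ v →
      ¬ (∀ z w → A z w ≡ true → z ≢ u → z ≢ v → w ≢ u → w ≢ v → W z ≡ W w)

module _ {n} {A : Graph n} (30≤n : 30 ≤ n) (planar : PlanarFacts A) where
  open PlanarFacts planar

  module _ {g : Graph n} (gsym : Symmetric g) (girr : Irreflexive g) (g⊆A : g ⊆ A) where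

    private
      module Split (P : Fin n → Bool) where
        W : Fin n → Bool
        W = covered (del g P)
        D C I : ℕ
        D = pairs (del g P)
        C = outPairs g P
        I = inPairs g P
        split : pairs g ≡ D + 2 * C + I
        split = pairs-split P gsym
        C≤A : C ≤ outPairs A P
        C≤A = pairs-mono λ u v e → let p , q = ∧-elim {g u v} e in ∧-intro (g⊆A u v p) q
        C≤ : C + 4 ≤ 2 * n
        C≤ = ≤-trans (+-monoˡ-≤ 4 C≤A) (cut P)
        I≤ : ∀ {p} → count P ≡ p → I + p ≤ p * p
        I≤ refl = inPairs-bound {g = g} P girr
        C≤n : ∀ {p} → count P ≡ p → C ≤ p * n
        C≤n refl = outPairs≤ g P
        W-edge : ∀ {x y} → del g P x y ≡ true → W x ≡ true
        W-edge = covered-intro (del g P)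
        W-disjoint : ∀ x → W x ≡ true → P x ≡ false
        W-disjoint x e with count-witness (del g P x) (covered-elim (del g P) e)
        ... | y , d = del-outˡ g P d

      -- Two vertices joined to everything else, with six vertices in the components: the neighbours of one of the two
      -- form a cycle through the other, along which W and its complement must meet.
      two-hubs : ∀ P → count P ≡ 2 → Blocks (del g P) 2 → 4 * n + 6 ≤ pairs g → ⊥
      two-hubs P p2 bl big = case Blocks.concentrated bl of λ
        -- With at most five vertices in the components, `bound` gives `D + 2 * C ≤ 4 * n + 2`,
        -- whereas `I ≤ 2` demands at least `4 * n + 4`.
        { (inj₁ small) → linear 7 (λ n e d c i w k →
              4 :* n :+ con 6 :≤ e ⇒ e :≡ d :+ 2 :* c :+ i ⇒ i :+ con 2 :≤ con 4 ⇒ w :≤ con 5 ⇒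
              d :+ 2 :* c :+ k :+ con 12 :≤ 4 :* n :+ 2 :* con 2 :+ 2 :* w ⇒ absurd) refl
            n (pairs g) D C I (count W) cross big split (I≤ p2) small bound
        -- With six vertices there is no slack: no edge of `A` joins `W` to a vertex outside `P` and
        -- `W`, the two vertices of `P` are adjacent, and `C` attains `2 * n - 4`.
        ; (inj₂ d12) → crossing
            (linear 7 (λ n e d c i w k →
              4 :* n :+ con 6 :≤ e ⇒ e :≡ d :+ 2 :* c :+ i ⇒ d :+ con 8 :≤ con 20 ⇒ i :+ con 2 :≤ con 4 ⇒ w :≤ con 6 ⇒
              d :+ 2 :* c :+ k :+ con 12 :≤ 4 :* n :+ 2 :* con 2 :+ 2 :* w ⇒ k :≡ con 0) refl
              n (pairs g) D C I (count W) cross big split d12 (I≤ p2) (Blocks.covered≤3m bl) bound)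
            (linear 7 (λ n e d c i w k →
              4 :* n :+ con 6 :≤ e ⇒ e :≡ d :+ 2 :* c :+ i ⇒ d :+ con 8 :≤ con 20 ⇒ i :+ con 2 :≤ con 4 ⇒ w :≤ con 6 ⇒
              d :+ 2 :* c :+ k :+ con 12 :≤ 4 :* n :+ 2 :* con 2 :+ 2 :* w ⇒ con 0 :< w) refl
              n (pairs g) D C I (count W) cross big split d12 (I≤ p2) (Blocks.covered≤3m bl) bound)
            (linear 5 (λ n e d c i →
              4 :* n :+ con 6 :≤ e ⇒ e :≡ d :+ 2 :* c :+ i ⇒ d :+ con 8 :≤ con 20 ⇒ c :+ con 4 :≤ 2 :* n ⇒ con 0 :< i) refl
              n (pairs g) D C I big split d12 C≤)
            (linear 5 (λ n e d c i →
              4 :* n :+ con 6 :≤ e ⇒ e :≡ d :+ 2 :* c :+ i ⇒ d :+ con 8 :≤ con 20 ⇒ i :+ con 2 :≤ con 4 ⇒ 2 :* n :≤ c :+ con 4) refl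
              n (pairs g) D C I big split d12 (I≤ p2))
            (Blocks.covered≤3m bl) }
        where
        open Split P
        cross : ℕ
        cross = pairs (λ u v → A u v ∧ (W u ∧ not (P v) ∧ not (W v)))
        D≤ : D ≤ inPairs A W
        D≤ = pairs-mono λ u v e → ∧-intro (g⊆A u v (del-⊆ g P u v e)) (∧-intro (W-edge e) (W-edge (del-sym P gsym u v e)))
        bound : D + 2 * C + cross + 12 ≤ 4 * n + 2 * 2 + 2 * count W
        bound = linear 8 (λ d d′ c c′ k n p w → d :≤ d′ ⇒ c :≤ c′ ⇒ p :≡ con 2 ⇒
            d′ :+ 2 :* c′ :+ k :+ con 12 :≤ 4 :* n :+ 2 :* p :+ 2 :* w ⇒ d :+ 2 :* c :+ k :+ con 12 :≤ 4 :* n :+ 2 :* con 2 :+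
                2 :* w) refl
          D (inPairs A W) C (outPairs A P) cross n (count P) (count W) D≤ C≤A p2 (partition P W W-disjoint)
        crossing : cross ≡ 0 → 0 < count W → 0 < I → 2 * n ≤ C + 4 → count W ≤ 6 → ⊥
        crossing no-cross w-pos i-pos c-full w≤6 =
          let u , v , e = pairs-witness _ i-pos
              guv , puv = ∧-elim {g u v} e
              pu , pv = ∧-elim {P u} puv
              x , wx = count-witness W w-pos
              px = W-disjoint x wx
              y , f = count-witness (λ y → not (P y) ∧ not (W y)) outside
              py , wy = ∧-elim {not (P y)} f
              ne : ∀ {z} → P z ≡ false → z ≢ v
              ne pz = λ { refl → true≢false (trans (sym pv) pz) }
          in rotation W (g⊆A u v guv) (g⊆A u x (full u pu x px)) (g⊆A u y (full u pu y (not-true py))) wx (not-true wy)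
               (ne px) (ne (not-true py)) (λ z w a zu zv wu wv →
                 bool-ext (closed z w a (only u v guv pu pv w wu wv)) (closed w z (A-sym z w a) (only u v guv pu pv z zu zv)))
          where
          outside : 0 < count (λ y → not (P y) ∧ not (W y))
          outside = linear 4 (λ n p w z → con 30 :≤ n ⇒ p :≡ con 2 ⇒ w :≤ con 6 ⇒ n :≤ p :+ w :+ z ⇒ con 0 :< z) refl
            n (count P) (count W) (count λ y → not (P y) ∧ not (W y)) 30≤n p2 w≤6
            (subst₂ _≤_ (count-true n) (sum-+₃ _ _ _) (sum-mono λ x →
              truth-table 2 (λ _ _ → 1) (λ p w → ind p + ind w + ind (not p ∧ not w)) refl (P x) (W x)))
          closed : ∀ z w → A z w ≡ true → P w ≡ false → W z ≡ true → W w ≡ true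
          closed z w a pw wz with W w in ww
          ... | true = refl
          ... | false = ⊥-elim (<⇒≱ (≤-reflexive (sym (cong ind (∧-intro a (∧-intro wz (∧-intro (cong not pw) (cong not ww)))))))
            (≤-trans (entry≤pairs (λ u v → A u v ∧ (W u ∧ not (P v) ∧ not (W v))) z w) (≤-reflexive no-cross)))
          only : ∀ u v → g u v ≡ true → P u ≡ true → P v ≡ true → ∀ z → z ≢ u → z ≢ v → P z ≡ false
          only u v guv pu pv z zu zv = ≡false λ pz → <⇒≱
              (≤-reflexive (sym (cong₂ _+_ (cong₂ _+_ (cong ind pu) (cong ind pv)) (cong ind pz))))
            (≤-trans (three-terms (ind ∘ P) uv (λ e → zv (sym e)) (λ e → zu (sym e))) (≤-reflexive p2))
            where
            uv : u ≢ v
            uv refl = true≢false (trans (sym guv) (girr u))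
          -- The value `2 * n - 4` of `C` is the number of all pairs between the two vertices of `P`
          -- and the others, so none can be missing.
          full : ∀ u → P u ≡ true → ∀ z → P z ≡ false → g u z ≡ true
          full u pu z pz with g u z in guz
          ... | true = refl
          ... | false = ⊥-elim (linear 5 (λ n c p q s → 2 :* n :≤ c :+ con 4 ⇒ p :≡ con 2 ⇒ p :+ q :≡ n ⇒ s :≡ 2 :* q ⇒ c :+
              con 1 :≤ s ⇒ absurd) refl
              n C (count P) (count (not ∘ P)) (count P * count (not ∘ P)) c-full p2 (count-complement P)
              (cong (_* count (not ∘ P)) p2) missing)
            where
            q = count (not ∘ P)
            short : outdeg g P u + 1 ≤ q
            short = subst (_≤ q) (trans (sum-+ _ _) (cong (outdeg g P u +_) (count-== z))) (sum-mono le)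
              where
              le : ∀ w → ind (g u w ∧ not (P w)) + ind (z == w) ≤ ind (not (P w))
              le w with z ≟F w
              ... | yes refl rewrite guz | pz = ≤-refl
              ... | no _ = truth-table 2 (λ a b → ind (a ∧ b) + 0) (λ a b → ind b) refl (g u w) (not (P w))
            missing : C + 1 ≤ count P * q
            missing = subst₂ _≤_
              (trans (sum-+ _ _) (cong₂ _+_ (sym (outPairs-by-vertex g P)) (count-== u)))
              (trans (sum-*ˡ q _) (*-comm q _)) (sum-mono le)
              where
              le : ∀ x → ind (P x) * outdeg g P x + ind (u == x) ≤ q * ind (P x)
              le x with u ≟F x
              ... | yes refl rewrite pu = subst₂ _≤_ (cong (_+ 1) (sym (+-identityʳ _))) (sym (*-identityʳ q)) short
              ... | no _ = subst₂ _≤_ (sym (+-identityʳ _)) (*-comm (ind (P x)) q) (*-monoʳ-≤ (ind (P x)) (outdeg≤ g P x))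

    -- With four or three vertices in `P` the cut bound leaves at most `4 * n + 4` pairs. With one
    -- or none, `C ≤ count P * n` leaves too few for `30 ≤ n`. With two, the components may hold 20
    -- pairs and counting alone does not suffice, whence `two-hubs`.
    many-pairs⇒matching₅ : 4 * n + 6 ≤ pairs g → ¬ Bounded g 4
    many-pairs⇒matching₅ big bd = (do
      bar ← barrier 4 (≤-trans (≤ᵇ⇒≤ 5 30 tt) 30≤n) bd
      bl ← blocks (del-sym (Barrier.P bar) gsym) (del-irr (Barrier.P bar) girr) (Barrier.bounded bar) (Barrier.missed bar) v₀
      λ _ → by-size (Barrier.P bar) (Barrier.m bar) (Barrier.count+m bar) bl) id
      where
      v₀ : Fin n
      v₀ = proj₁ (cover (λ _ → false) (≤-trans (≤-reflexive (sum-zero λ _ → refl)) z≤n))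
      by-size : ∀ P m → count P + m ≡ 4 → Blocks (del g P) m → ⊥
      by-size P 0 eq bl = linear 5 (λ n e d c i → 4 :* n :+ con 6 :≤ e ⇒ e :≡ d :+ 2 :* c :+ i ⇒ d :≤ con 0 ⇒ c :+ con 4 :≤ 2 :* n ⇒
          i :+ con 4 :≤ con 16 ⇒ absurd) refl n (pairs g) D C I big split (Blocks.pairs≤ bl) C≤ (I≤ (+-cancelʳ-≡ 0 (count P) 4 eq))
        where open Split P
      by-size P 1 eq bl = linear 5 (λ n e d c i → 4 :* n :+ con 6 :≤ e ⇒ e :≡ d :+ 2 :* c :+ i ⇒ d :≤ con 6 ⇒ c :+ con 4 :≤ 2 :* n ⇒
          i :+ con 3 :≤ con 9 ⇒ absurd) refl n (pairs g) D C I big split (Blocks.pairs≤ bl) C≤ (I≤ (+-cancelʳ-≡ 1 (count P) 3 eq))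
        where open Split P
      by-size P 2 eq bl = two-hubs P (+-cancelʳ-≡ 2 (count P) 2 eq) bl big
      by-size P 3 eq bl = linear 5 (λ n e d c i → con 30 :≤ n ⇒ 4 :* n :+ con 6 :≤ e ⇒ e :≡ d :+ 2 :* c :+ i ⇒ d :≤ con 42 ⇒ c
          :≤ 1 :* n ⇒
          i :+ con 1 :≤ con 1 ⇒ absurd) refl n (pairs g) D C I 30≤n big split (Blocks.pairs≤ bl) (C≤n p) (I≤ p)
        where
        open Split P
        p = +-cancelʳ-≡ 3 (count P) 1 eq
      by-size P 4 eq bl = linear 5 (λ n e d c i → con 30 :≤ n ⇒ 4 :* n :+ con 6 :≤ e ⇒ e :≡ d :+ 2 :* c :+ i ⇒ d :≤ con 72 ⇒ c
          :≤ con 0 ⇒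
          i :+ con 0 :≤ con 0 ⇒ absurd) refl n (pairs g) D C I 30≤n big split (Blocks.pairs≤ bl) (C≤n p) (I≤ p)
        where
        open Split P
        p = +-cancelʳ-≡ 4 (count P) 0 eq
      by-size P (suc (suc (suc (suc (suc m))))) eq bl =
        linear 2 (λ p m → p :+ (con 5 :+ m) :≡ con 4 ⇒ absurd) refl (count P) m eq

-- Extending matchings greedily through vertices of large degree

count-escape : ∀ {n} (p q : Fin n → Bool) → count q < count p → ∃[ x ] (p x ≡ true × q x ≡ false)
count-escape p q lt with count-witness (λ x → p x ∧ not (q x)) (linear 3 (λ p q r → q :< p ⇒ p :≤ r :+ q ⇒ con 0 :< r) refl
  (count p) (count q) (count λ x → p x ∧ not (q x)) lt
  (≤-trans (sum-mono λ x → truth-table 2 (λ a b → ind a) (λ a b → ind (a ∧ not b) + ind b) refl (p x) (q x))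
      (≤-reflexive (sum-+ _ _))))
... | x , e with ∧-elim {p x} e
... | px , qx = x , px , not-true qx

-- Here `c` bounds the matched vertices outside `X` at the moment when the head of the list is to be
-- matched. Every new edge adds one, its other end, so the demand on the degrees rises by one along
-- the list and the lists below are ordered by increasing degree.
Wide : ∀ {n} → Graph n → (Fin n → Bool) → ℕ → List (Fin n) → Set
Wide g X c [] = ⊤
Wide g X c (v ∷ vs) = c < outdeg g X v × Wide g X (suc c) vs

module _ {n} (g : Graph n) (gsym : Symmetric g) (X : Fin n → Bool) where

  greedy : ∀ vs (K : Matching g) c → All (λ v → mate K v ≡ v) vs → All (λ v → X v ≡ true) vs → Unique vs →
    count (λ x → moved K x ∧ not (X x)) ≤ c → Wide g X c vs → Σ[ K′ ∈ Matching g ] size K′ ≡ size K + length vs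
  greedy [] K c _ _ _ _ _ = K , sym (+-identityʳ _)
  greedy (v ∷ vs) K c (fv ∷ fixed) (xv ∷ inX) (distinct ∷ unique) few (wide , wider)
    with count-escape (λ w → g v w ∧ not (X w)) (λ x → moved K x ∧ not (X x)) (≤-<-trans few wide)
  ... | w , p , q with ∧-elim {g v w} p
  ... | gvw , xw =
    let K′ , s = greedy vs K₁ (suc c) (still-fixed vs fixed inX distinct) inX unique few₁ wider
    in K′ , trans s (trans (cong (_+ length vs) (size-addEdge K v w fv fw v≢w gvw (gsym v w gvw)))
        (sym (+-suc (size K) (length vs))))
    where
    v≢w : v ≢ w
    v≢w refl = true≢false (trans (sym xv) (not-true xw))
    fw : mate K w ≡ w
    fw = moved-false K w (≡false λ m → true≢false (trans (sym (∧-intro m xw)) q))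
    K₁ : Matching g
    K₁ = addEdge K v w fv fw v≢w gvw (gsym v w gvw)
    still-fixed : ∀ us → All (λ u → mate K u ≡ u) us → All (λ u → X u ≡ true) us → All (v ≢_) us → All (λ u → mate K₁ u ≡ u) us
    still-fixed [] _ _ _ = []
    still-fixed (u ∷ us) (fu ∷ fs) (xu ∷ xs) (d ∷ ds) =
      trans (addEdge-other K v w fv fw v≢w gvw (gsym v w gvw) (λ e → d (sym e))
          (λ { refl → true≢false (trans (sym xu) (not-true xw)) })) fu
      ∷ still-fixed us fs xs ds
    few₁ : count (λ x → moved K₁ x ∧ not (X x)) ≤ suc c
    few₁ = ≤-trans (≤-trans (sum-mono bound)
        (≤-reflexive (trans (sum-+ _ _) (cong (_+ count λ x → moved K x ∧ not (X x)) (count-== w))))) (s≤s few)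
      where
      other : ∀ x → x ≢ v → x ≢ w → ind (moved K₁ x ∧ not (X x)) ≤ ind (w == x) + ind (moved K x ∧ not (X x))
      other x xv xw rewrite addEdge-other K v w fv fw v≢w gvw (gsym v w gvw) xv xw = m≤n+m _ (ind (w == x))
      by-cases : ∀ x → Dec (x ≡ v) → Dec (x ≡ w) → ind (moved K₁ x ∧ not (X x)) ≤ ind (w == x) + ind (moved K x ∧ not (X x))
      by-cases x (yes e) _ = subst (λ b → ind (moved K₁ x ∧ not b) ≤ ind (w == x) + ind (moved K x ∧ not (X x)))
          (sym (trans (cong X e) xv))
        (≤-trans (truth-table 1 (λ a → ind (a ∧ false)) (λ _ → 0) refl (moved K₁ x)) z≤n)
      by-cases x (no _) (yes e) = ≤-trans (ind≤1 (moved K₁ x ∧ not (X x)))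
        (≤-trans (≤-reflexive (sym (cong ind (⌊⌋-yes (w ≟F x) (sym e))))) (m≤m+n _ _))
      by-cases x (no p) (no q) = other x p q
      bound : ∀ x → ind (moved K₁ x ∧ not (X x)) ≤ ind (w == x) + ind (moved K x ∧ not (X x))
      bound x = by-cases x (x ≟F v) (x ≟F w)

Wide-mono : ∀ {n} (g h : Graph n) X c c′ vs → (∀ v → c + outdeg g X v ≤ c′ + outdeg h X v) → Wide g X c′ vs → Wide h X c vs
Wide-mono g h X c c′ [] le _ = tt
Wide-mono g h X c c′ (v ∷ vs) le (w , ws) =
  linear 4 (λ c c′ a b → c :+ a :≤ c′ :+ b ⇒ c′ :< a ⇒ c :< b) refl c c′ (outdeg g X v) (outdeg h X v) (le v) w
  , Wide-mono g h X (suc c) (suc c′) vs (λ v → s≤s (le v)) ws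

-- Sums over sets of vertices, and their largest terms

_∖_ : ∀ {n} → (Fin n → Bool) → Fin n → Fin n → Bool
(P ∖ v) x = P x ∧ not (v == x)

ind-∖ : ∀ {n} (P : Fin n → Bool) {v} → P v ≡ true → ∀ x → ind (P x) ≡ ind (v == x) + ind ((P ∖ v) x)
ind-∖ P {v} pv x with v ≟F x
... | yes refl rewrite pv = refl
... | no _ with P x
...   | true = refl
...   | false = refl

count-∖ : ∀ {n} (P : Fin n → Bool) {v} → P v ≡ true → count P ≡ suc (count (P ∖ v))
count-∖ P {v} pv = trans (sum-cong (ind-∖ P pv)) (trans (sum-+ _ _) (cong (_+ count (P ∖ v)) (count-== v)))

largest : ∀ {n} (o : Fin n → ℕ) (P : Fin n → Bool) →
  (∀ u → P u ≡ false) ⊎ ∃[ v ] (P v ≡ true × (∀ u → P u ≡ true → o u ≤ o v))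
largest {zero} o P = inj₁ λ ()
largest {suc n} o P with largest (o ∘ suc) (P ∘ suc) | P zero in p₀
... | inj₁ none | false = inj₁ λ { zero → p₀ ; (suc u) → none u }
... | inj₁ none | true = inj₂ (zero , p₀ , λ { zero _ → ≤-refl ; (suc u) pu → ⊥-elim (true≢false (trans (sym pu) (none u))) })
... | inj₂ (v , pv , max) | false = inj₂
    (suc v , pv , λ { zero pz → ⊥-elim (true≢false (trans (sym pz) p₀)) ; (suc u) pu → max u pu })
... | inj₂ (v , pv , max) | true with ≤-total (o zero) (o (suc v))
...   | inj₁ le = inj₂ (suc v , pv , λ { zero _ → le ; (suc u) pu → max u pu })
...   | inj₂ ge = inj₂ (zero , p₀ , λ { zero _ → ≤-refl ; (suc u) pu → ≤-trans (max u pu) ge })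

sumOver : ∀ {n} → (Fin n → Bool) → (Fin n → ℕ) → ℕ
sumOver P o = sum λ x → ind (P x) * o x

record Top {n} (o : Fin n → ℕ) (P : Fin n → Bool) (k : ℕ) : Set where
  field
    v : Fin n
    v∈P : P v ≡ true
    maximal : ∀ u → P u ≡ true → o u ≤ o v
    count-rest : count (P ∖ v) ≡ k
    sum-rest : sumOver P o ≡ o v + sumOver (P ∖ v) o
    sum≤ : sumOver P o ≤ suc k * o v

top : ∀ {n} (o : Fin n → ℕ) (P : Fin n → Bool) k → count P ≡ suc k → Top o P k
top o P k eq with largest o P
... | inj₁ none = ⊥-elim (0≢1+n (trans (sym (sum-zero λ x → cong ind (none x))) eq))
... | inj₂ (v , pv , max) = record
  { v = v
  ; v∈P = pv
  ; maximal = max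
  ; count-rest = suc-injective (trans (sym (count-∖ P pv)) eq)
  ; sum-rest = trans (sum-cong λ x → trans (cong (_* o x) (ind-∖ P pv x)) (*-distribʳ-+ (o x) (ind (v == x)) _))
      (trans (sum-+ _ _) (cong (_+ sumOver (P ∖ v) o) (sum-δ v o)))
  ; sum≤ = ≤-trans (sum-mono bound) (≤-reflexive (trans (sum-*ˡ (o v) _) (trans (*-comm (o v) _) (cong (_* o v) eq))))
  }
  where
  bound : ∀ x → ind (P x) * o x ≤ o v * ind (P x)
  bound x with P x in px
  ... | true = ≤-trans (≤-reflexive (+-identityʳ _)) (≤-trans (max x px) (≤-reflexive (sym (*-identityʳ _))))
  ... | false = z≤n

∖-⊆ : ∀ {n} (P : Fin n → Bool) v x → (P ∖ v) x ≡ true → P x ≡ true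
∖-⊆ P v x e = proj₁ (∧-elim e)

∖-≢ : ∀ {n} (P : Fin n → Bool) v x → (P ∖ v) x ≡ true → v ≢ x
∖-≢ P v x e refl = true≢false (trans (sym (proj₂ (∧-elim {P x} e))) (cong not (==-refl x)))

∖-self : ∀ {n} (P : Fin n → Bool) v → (P ∖ v) v ≡ false
∖-self P v rewrite ==-refl v with P v
... | true = refl
... | false = refl

-- Six disjoint edges from 2n + 4 colours

-- This is what remains of the colouring: `ab` is the chosen edge with the colour of `f₁ f₂`, and
-- `g′` is the set of representatives after the exchange.
Swappable : ∀ {n} → Graph n → Graph n → Set
Swappable {n} A g = ∀ f₁ f₂ → A f₁ f₂ ≡ true →
  ∃[ a ] ∃[ b ] Σ[ g′ ∈ Graph n ] (rem g a b ⊆ g′ × Symmetric g′ × g′ f₁ f₂ ≡ true × Bounded g′ 5)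

module _ {n} {A : Graph n} (30≤n : 30 ≤ n) (planar : PlanarFacts A)
  {g : Graph n} (gsym : Symmetric g) (girr : Irreflexive g) (g⊆A : g ⊆ A) (swappable : Swappable A g) where
  open PlanarFacts planar

  -- A matching of g - X inside a small set B leaves room for a new edge f of A, after which the vertices of X are
  -- matched greedily; the edge ab that makes way for f excludes at most one neighbour of each vertex.
  confined-matchings-absurd : ∀ X vs m B → All (λ v → X v ≡ true) vs → Unique vs → m + length vs ≡ 5 → count X + count B ≤ 11 →
    (∀ a b → ¬ ¬ (Σ[ N ∈ Matching (rem (del g X) a b) ] (size N ≡ m × ∀ x → mate N x ≢ x → B x ≡ true))) →
    Wide g X (2 * m + 3) vs → ⊥
  confined-matchings-absurd X vs m B inX unique m+vs small matchings wide
    with cover (λ x → X x ∨ B x) (≤-trans (count-∨ X B) small)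
  ... | f₁ , f₂ , af , sf₁ , sf₂ with swappable f₁ f₂ af
  ... | a , b , g′ , sub , g′sym , gf , bd = matchings a b λ { (N , s , inB) → contra N s inB }
    where
    outX : ∀ {x} → X x ∨ B x ≡ false → X x ≡ false
    outX {x} e with X x
    ... | false = refl
    outB : ∀ {x} → X x ∨ B x ≡ false → B x ≡ false
    outB {x} e with X x
    ... | false = e
    f₁≢f₂ : f₁ ≢ f₂
    f₁≢f₂ refl = true≢false (trans (sym af) (A-irr f₁))
    degrees : ∀ v → 2 * m + 2 + outdeg g X v ≤ 2 * m + 3 + outdeg g′ X v
    degrees v = linear 3 (λ m d d′ → d :≤ d′ :+ con 1 ⇒ 2 :* m :+ con 2 :+ d :≤ 2 :* m :+ con 3 :+ d′) refl m (outdeg g X v)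
        (outdeg g′ X v)
      (≤-trans (sum-mono bound) (≤-reflexive (trans (sum-+ _ _) (cong (outdeg g′ X v +_) (count-== excluded)))))
      where
      excluded : Fin n
      excluded = if v == a then b else a
      kept : ∀ w → excluded ≢ w → g v w ≡ true → rem g a b v w ≡ true
      kept w ne e with v ≟F a
      ... | yes refl = rem-intro g e (λ _ q → ne (sym q)) (λ p q → ne (trans (sym p) (sym q)))
      ... | no p = rem-intro g e (λ q → ⊥-elim (p q)) (λ _ q → ne (sym q))
      bound : ∀ w → ind (g v w ∧ not (X w)) ≤ ind (g′ v w ∧ not (X w)) + ind (excluded == w)
      bound w with excluded ≟F w
      ... | yes _ = ≤-trans (ind≤1 (g v w ∧ not (X w))) (m≤n+m 1 _)
      ... | no ne = ≤-trans (ind-mono λ e → let p , q = ∧-elim {g v w} e in ∧-intro (sub v w (kept w ne p)) q) (m≤m+n _ _)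
    contra : ∀ (N : Matching (rem (del g X) a b)) → size N ≡ m → (∀ x → mate N x ≢ x → B x ≡ true) → ⊥
    contra N s inB = <⇒≱ (linear 4 (λ k k₁ m l → k :≡ k₁ :+ l ⇒ k₁ :≡ con 1 :+ m ⇒ m :+ l :≡ con 5 ⇒ con 5 :< k) refl
        (size (proj₁ K′)) (size K) m (length vs) (proj₂ K′) sizeK m+vs) (bd (proj₁ K′))
      where
      incl : rem (del g X) a b ⊆ g′
      incl x y e = sub x y (rem-del-⊆ g X a b x y e)
      N′ : Matching g′
      N′ = weaken incl N
      fixed : ∀ {x} → B x ≡ false → mate N x ≡ x
      fixed {x} e with mate N x ≟F x
      ... | yes p = p
      ... | no ne = ⊥-elim (true≢false (trans (sym (inB x ne)) e))
      fixedX : ∀ {x} → X x ≡ true → mate N x ≡ x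
      fixedX {x} e = del-mate (weaken (rem-⊆ (del g X) a b) N) e
      F₁ = fixed (outB sf₁)
      F₂ = fixed (outB sf₂)
      gf′ = g′sym f₁ f₂ gf
      K : Matching g′
      K = addEdge N′ f₁ f₂ F₁ F₂ f₁≢f₂ gf gf′
      sizeK : size K ≡ suc m
      sizeK = trans (size-addEdge N′ f₁ f₂ F₁ F₂ f₁≢f₂ gf gf′) (cong suc (trans (size-weaken incl N) s))
      vs-fixed : ∀ us → All (λ v → X v ≡ true) us → All (λ v → mate K v ≡ v) us
      vs-fixed [] [] = []
      vs-fixed (u ∷ us) (xu ∷ xs) =
        trans (addEdge-other N′ f₁ f₂ F₁ F₂ f₁≢f₂ gf gf′ (apart sf₁) (apart sf₂)) (fixedX xu) ∷ vs-fixed us xs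
        where
        apart : ∀ {f} → X f ∨ B f ≡ false → u ≢ f
        apart sf refl = true≢false (trans (sym xu) (outX sf))
      few : count (λ x → moved K x ∧ not (X x)) ≤ 2 * m + 2
      few = ≤-trans (count-mono λ x e → proj₁ (∧-elim {moved K x} e)) (≤-reflexive (trans (count-moved K)
        (trans (cong (2 *_) sizeK) (linear 1 (λ m → 2 :* (con 1 :+ m) :≡ 2 :* m :+ con 2) refl m))))
      K′ : Σ[ K′ ∈ Matching g′ ] size K′ ≡ size K + length vs
      K′ = greedy g′ g′sym X vs K (2 * m + 2) (vs-fixed vs inX) inX unique few
        (Wide-mono g g′ X (2 * m + 2) (2 * m + 3) vs degrees wide)

  module _ (big : 4 * n + 8 ≤ pairs g) where

    -- An edge accounts for two ordered pairs, and `4 * n + 6` of them are still enough for five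
    -- disjoint edges.
    matching₅-avoiding : ∀ a b → ¬ ¬ (Σ[ M ∈ Matching (rem g a b) ] 5 ≤ size M)
    matching₅-avoiding a b k = many-pairs⇒matching₅ 30≤n planar (rem-sym a b gsym)
      (λ x → ≡false λ e → true≢false (trans (sym (rem-⊆ g a b x x e)) (girr x)))
      (λ x y e → g⊆A x y (rem-⊆ g a b x y e))
      (linear 3 (λ n p q → 4 :* n :+ con 8 :≤ p ⇒ p :≤ q :+ con 2 ⇒ 4 :* n :+ con 6 :≤ q) refl n (pairs g) (pairs (rem g a b))
          big (pairs-rem g a b))
      (λ M → ≮⇒≥ λ lt → k (M , lt))

    module _ {X : Fin n → Bool} {m : ℕ} (eq : m + count X ≡ 5) (bdX : Bounded (del g X) m) where

      matchings-avoiding : ∀ a b → ¬ ¬ (Σ[ N ∈ Matching (rem (del g X) a b) ] size N ≡ m)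
      matchings-avoiding a b = do
        M , s ← matching₅-avoiding a b
        let N = restrict M X
            sizeN = size-weaken incl N
        return (weaken incl N , ≤-antisym
          (≤-trans (≤-reflexive (sym (size-weaken (rem-⊆ (del g X) a b) (weaken incl N)))) (bdX _))
          (linear 5 (λ n n′ m x M → con 5 :≤ M ⇒ M :≤ n :+ x ⇒ m :+ x :≡ con 5 ⇒ n′ :≡ n ⇒ m :≤ n′) refl
            (size N) (size (weaken incl N)) m (count X) (size M) s (size-restrict M X) eq sizeN))
        where
        incl : del (rem g a b) X ⊆ rem (del g X) a b
        incl x y e = let r = del-⊆ (rem g a b) X x y e in
          rem-intro (del g X) (del-intro g X (rem-⊆ g a b x y r) (del-outˡ _ X e) (del-outʳ _ X e)) (rem-avoidsˡ g r)
              (rem-avoidsʳ g r)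

      hubs-absurd : ∀ vs → All (λ v → X v ≡ true) vs → Unique vs → m + length vs ≡ 5 → count X + 3 * m ≤ 11 →
        Wide g X (2 * m + 3) vs → Fin n → ⊥
      hubs-absurd vs inX unique m+vs small wide v₀ = (do
        -- There is no loop at `v₀` to remove; this merely produces a first matching of size `m`.
        N , s ← matchings-avoiding v₀ v₀
        let N₁ = weaken (rem-⊆ (del g X) v₀ v₀) N
        B , countB , local ← localize (del-sym X gsym) bdX N₁ (trans (size-weaken (rem-⊆ (del g X) v₀ v₀) N) s) matchings-avoiding
        λ _ → confined-matchings-absurd X vs m B inX unique m+vs (≤-trans (+-monoʳ-≤ (count X) countB) small)
          (λ a b → return (local a b)) wide) id

    module _ (bar : Barrier g 5) (bl : Blocks (del g (Barrier.P bar)) (Barrier.m bar)) (v₀ : Fin n) where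
      open Barrier bar

      private
        o : Fin n → ℕ
        o = outdeg g P

        D I S q : ℕ
        D = pairs (del g P)
        I = inPairs g P
        S = sumOver P o
        q = count (not ∘ P)

        split : pairs g ≡ D + 2 * S + I
        split = trans (pairs-split P gsym) (cong (λ c → D + 2 * c + I) (outPairs-by-vertex g P))

        I≤ : ∀ {p} → count P ≡ p → I + p ≤ p * p
        I≤ refl = inPairs-bound {g = g} P girr

        S≤n : ∀ {p} → count P ≡ p → S ≤ p * n
        S≤n refl = ≤-trans (≤-reflexive (sym (outPairs-by-vertex g P))) (outPairs≤ g P)

        o≤ : ∀ v → o v ≤ q
        o≤ = outdeg≤ g P

        -- A matching of g - X loses at most |Q| edges on removing the rest Q of P, so it has at most m + |Q| edges.
        module Hubs (Q : Fin n → Bool) (Q⊆P : ∀ x → Q x ≡ true → P x ≡ true) where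
          X : Fin n → Bool
          X x = P x ∧ not (Q x)

          countX : count X + count Q ≡ count P
          countX = trans (sym (sum-+ _ _)) (sum-cong λ x → pointwise (P x) (Q x) (Q⊆P x))
            where
            pointwise : ∀ p q → (q ≡ true → p ≡ true) → ind (p ∧ not q) + ind q ≡ ind p
            pointwise true true _ = refl
            pointwise true false _ = refl
            pointwise false true h = ⊥-elim (true≢false (sym (h refl)))
            pointwise false false _ = refl

          eqX : m + count Q + count X ≡ 5
          eqX = linear 4 (λ m q x p → x :+ q :≡ p ⇒ p :+ m :≡ con 5 ⇒ m :+ q :+ x :≡ con 5) refl m (count Q) (count X)
              (count P) countX count+m

          bdX : Bounded (del g X) (m + count Q)
          bdX M = linear 4 (λ M r q m → M :≤ r :+ q ⇒ r :≤ m ⇒ M :≤ m :+ q) refl (size M) (size (restrict M Q)) (count Q) m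
            (size-restrict M Q) (bounded-⊆ incl bounded (restrict M Q))
            where
            incl : del (del g X) Q ⊆ del g P
            incl x y e = let d = del-⊆ (del g X) Q x y e in
              del-intro g P (del-⊆ g X x y d) (out (del-outˡ g X d) (del-outˡ _ Q e)) (out (del-outʳ g X d) (del-outʳ _ Q e))
              where
              out : ∀ {x} → P x ∧ not (Q x) ≡ false → Q x ≡ false → P x ≡ false
              out {x} p q rewrite q with P x
              ... | false = refl

          wider : ∀ v → o v ≤ outdeg g X v
          wider v = count-mono λ w e → let p , q = ∧-elim {g v w} e in ∧-intro p (cong not (notX (not-true q)))
            where
            notX : ∀ {w} → P w ≡ false → P w ∧ not (Q w) ≡ false
            notX e rewrite e = refl

          in-X : ∀ {v} → P v ≡ true → Q v ≡ false → X v ≡ true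
          in-X p q = ∧-intro p (cong not q)

        -- Without the two hubs the matching has three edges. Together with `f` it covers eight
        -- vertices, and one more neighbour may be lost with `ab`, so the hubs need more than 9 and
        -- more than 10 neighbours. The vertex count `2 + 3 * 3` just meets 11.
        two-hubs-absurd : ∀ k → (t₁ : Top o P (suc k)) → (t₂ : Top o (P ∖ Top.v t₁) k) → m + k ≡ 3 → 10 ≤ o (Top.v t₂) → 11 ≤
            o (Top.v t₁) → ⊥
        two-hubs-absurd k t₁ t₂ mk o₂ o₁ = hubs-absurd (subst (λ z → z + count X ≡ 5) m+Q eqX) (subst (Bounded (del g X)) m+Q bdX)
            (v₂ ∷ v₁ ∷ []) (in-X p₂ (∖-self P₁ v₂) ∷ in-X (Top.v∈P t₁) q₁ ∷ []) ((distinct ∷ []) ∷ ([] ∷ [])) refl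
            (linear 1 (λ x → con 3 :+ x :≡ con 5 ⇒ x :+ con 9 :≤ con 11) refl (count X) (subst (λ z → z + count X ≡ 5) m+Q eqX))
            (≤-trans o₂ (wider v₂) , ≤-trans o₁ (wider v₁) , tt) v₀
          where
          v₁ v₂ : Fin n
          v₁ = Top.v t₁
          v₂ = Top.v t₂
          P₁ Q : Fin n → Bool
          P₁ = P ∖ v₁
          Q = P₁ ∖ v₂
          open Hubs Q (λ x e → ∖-⊆ P v₁ x (∖-⊆ P₁ v₂ x e))
          m+Q : m + count Q ≡ 3
          m+Q = trans (cong (m +_) (Top.count-rest t₂)) mk
          p₂ = ∖-⊆ P v₁ v₂ (Top.v∈P t₂)
          distinct : v₂ ≢ v₁
          distinct e = ∖-≢ P v₁ v₂ (Top.v∈P t₂) (sym e)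
          q₁ : Q v₁ ≡ false
          q₁ = ≡false λ e → ∖-≢ P v₁ v₁ (∖-⊆ P₁ v₂ v₁ e) refl

        -- All matchings of `del g P` lie in the covered vertices, which form a single component of
        -- at most nine vertices here. They replace the set of `localize`, which could have twelve.
        one-hub-absurd : m ≡ 4 → count P ≡ 1 → count (covered (del g P)) ≤ 9 → ⊥
        one-hub-absurd refl p1 w9 = confined-matchings-absurd P (v ∷ []) 4 W (Top.v∈P t ∷ []) ([] ∷ []) refl
            (linear 2 (λ p w → p :≡ con 1 ⇒ w :≤ con 9 ⇒ p :+ w :≤ con 11) refl (count P) (count W) p1 w9)
            (λ a b → do
              N , s ← matchings-avoiding {X = P} (trans (+-comm 4 (count P)) count+m) bounded a b
              return (N , s , λ x ne → covered-intro (del g P) (rem-⊆ (del g P) a b _ _ (mate-edge N x ne))))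
            (linear 5 (λ n d i s ov → con 30 :≤ n ⇒ 4 :* n :+ con 8 :≤ d :+ 2 :* s :+ i ⇒ d :≤ con 72 ⇒ i :+ con 1 :≤ con 1 ⇒
                s :≤ 1 :* ov ⇒ con 11 :< ov) refl
              n D I S (o v) 30≤n (subst (4 * n + 8 ≤_) split big) (Blocks.pairs≤ bl) (I≤ p1) (Top.sum≤ t) , tt)
          where
          W = covered (del g P)
          t = top o P 0 p1
          v = Top.v t

        -- One edge remains besides the four hubs. With `f` it covers four vertices, and one
        -- neighbour may be lost with `ab`; so the demands start at more than 5.
        four-hubs-absurd : m ≡ 0 → (t₁ : Top o P 4) (t₂ : Top o (P ∖ Top.v t₁) 3) (t₃ : Top o ((P ∖ Top.v t₁) ∖ Top.v t₂) 2)
          (t₄ : Top o (((P ∖ Top.v t₁) ∖ Top.v t₂) ∖ Top.v t₃) 1) →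
          6 ≤ o (Top.v t₄) → 7 ≤ o (Top.v t₃) → 8 ≤ o (Top.v t₂) → 9 ≤ o (Top.v t₁) → ⊥
        four-hubs-absurd refl t₁ t₂ t₃ t₄ o₄ o₃ o₂ o₁ =
          hubs-absurd (subst (λ z → z + count X ≡ 5) (Top.count-rest t₄) eqX) (subst (Bounded (del g X)) (Top.count-rest t₄) bdX)
            (v₄ ∷ v₃ ∷ v₂ ∷ v₁ ∷ [])
            (in-X p₄ (∖-self P₃ v₄) ∷ in-X p₃ (notQ ne₃) ∷ in-X p₂ (notQ ne₂) ∷ in-X (Top.v∈P t₁) (notQ ne₁) ∷ [])
            ((flip′ ne₃ (Top.v∈P t₄) ∷ flip′ ne₂ (Top.v∈P t₄) ∷ flip′ ne₁ (Top.v∈P t₄) ∷ [])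
              ∷ ((λ e → ∖-≢ P₁ v₂ v₃ (Top.v∈P t₃) (sym e)) ∷ (λ e → ∖-≢ P v₁ v₃ (∖-⊆ P₁ v₂ v₃ (Top.v∈P t₃)) (sym e)) ∷ [])
              ∷ ((λ e → ∖-≢ P v₁ v₂ (Top.v∈P t₂) (sym e)) ∷ []) ∷ ([] ∷ []))
            refl
            (linear 1 (λ x → con 1 :+ x :≡ con 5 ⇒ x :+ con 3 :≤ con 11) refl (count X)
                (subst (λ z → z + count X ≡ 5) (Top.count-rest t₄) eqX))
            (≤-trans o₄ (wider v₄) , ≤-trans o₃ (wider v₃) , ≤-trans o₂ (wider v₂) , ≤-trans o₁ (wider v₁) , tt) v₀
          where
          v₁ v₂ v₃ v₄ : Fin n
          v₁ = Top.v t₁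
          v₂ = Top.v t₂
          v₃ = Top.v t₃
          v₄ = Top.v t₄
          P₁ P₂ P₃ Q : Fin n → Bool
          P₁ = P ∖ v₁
          P₂ = P₁ ∖ v₂
          P₃ = P₂ ∖ v₃
          Q = P₃ ∖ v₄
          open Hubs Q (λ x e → ∖-⊆ P v₁ x (∖-⊆ P₁ v₂ x (∖-⊆ P₂ v₃ x (∖-⊆ P₃ v₄ x e))))
          ne₁ : ∀ {x} → P₃ x ≡ true → v₁ ≢ x
          ne₁ e = ∖-≢ P v₁ _ (∖-⊆ P₁ v₂ _ (∖-⊆ P₂ v₃ _ e))
          ne₂ : ∀ {x} → P₃ x ≡ true → v₂ ≢ x
          ne₂ e = ∖-≢ P₁ v₂ _ (∖-⊆ P₂ v₃ _ e)
          ne₃ : ∀ {x} → P₃ x ≡ true → v₃ ≢ x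
          ne₃ e = ∖-≢ P₂ v₃ _ e
          flip′ : ∀ {u w} → (∀ {x} → P₃ x ≡ true → u ≢ x) → P₃ w ≡ true → w ≢ u
          flip′ ne e p = ne e (sym p)
          notQ : ∀ {u} → (∀ {x} → P₃ x ≡ true → u ≢ x) → Q u ≡ false
          notQ ne = ≡false λ e → ne (∖-⊆ P₃ v₄ _ e) refl
          p₂ = ∖-⊆ P v₁ v₂ (Top.v∈P t₂)
          p₃ = ∖-⊆ P v₁ v₃ (∖-⊆ P₁ v₂ v₃ (Top.v∈P t₃))
          p₄ = ∖-⊆ P v₁ v₄ (∖-⊆ P₁ v₂ v₄ (∖-⊆ P₂ v₃ v₄ (Top.v∈P t₄)))

        total : 4 * n + 8 ≤ D + 2 * S + I
        total = subst (4 * n + 8 ≤_) split big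

        compl : ∀ {p} → count P ≡ p → p + q ≡ n
        compl refl = count-complement P

        D≤ : ∀ {k} → m ≡ k → D ≤ 2 * k * (2 * k + 1)
        D≤ refl = Blocks.pairs≤ bl

        S≤₂ : ∀ {k l} (t₁ : Top o P k) (t₂ : Top o (P ∖ Top.v t₁) l) → S ≤ o (Top.v t₁) + suc l * o (Top.v t₂)
        S≤₂ t₁ t₂ = ≤-trans (≤-reflexive (Top.sum-rest t₁)) (+-monoʳ-≤ (o (Top.v t₁)) (Top.sum≤ t₂))

        -- Since `D` and `I` are bounded by constants, `S` must be large. The largest summand is at
        -- most `q`, the number of vertices outside `P`, and what is left forces a large second one.
        by-size : ∀ k p → m ≡ k → count P ≡ p → p + k ≡ 5 → ⊥
        by-size 5 p mk cp eq = linear 4 (λ n d i s → con 30 :≤ n ⇒ 4 :* n :+ con 8 :≤ d :+ 2 :* s :+ i ⇒ d :≤ con 110 ⇒ i :+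
            con 0 :≤ con 0 ⇒ s :≤ con 0 ⇒ absurd) refl
          n D I S 30≤n total (D≤ mk) (I≤ cp′) (S≤n cp′)
          where cp′ = trans cp (+-cancelʳ-≡ 5 p 0 eq)
        -- If the covered vertices are not at most nine, `D ≤ 56`, and a single vertex in `P` cannot
        -- supply the remaining pairs.
        by-size 4 p mk cp eq = [ one-hub-absurd mk cp′
            , (λ d56 → linear 4 (λ n d i s → con 30 :≤ n ⇒ 4 :* n :+ con 8 :≤ d :+ 2 :* s :+ i ⇒ d :+ con 16 :≤ con 72 ⇒ i :+
                con 1 :≤ con 1 ⇒ s :≤ 1 :* n ⇒ absurd) refl
                n D I S 30≤n total d56 (I≤ cp′) (S≤n cp′)) ]′
            (subst (λ k → count (covered (del g P)) ≤ 2 * k + 1 ⊎ D + 4 * k ≤ 2 * k * (2 * k + 1)) mk (Blocks.concentrated bl))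
          where cp′ = trans cp (+-cancelʳ-≡ 4 p 1 eq)
        by-size 3 p mk cp eq = two-hubs-absurd 0 t₁ t₂ (cong (_+ 0) mk)
            (linear 7 (λ n d i s q a b → con 30 :≤ n ⇒ 4 :* n :+ con 8 :≤ d :+ 2 :* s :+ i ⇒ d :≤ con 42 ⇒ i :+ con 2 :≤ con 4 ⇒
              con 2 :+ q :≡ n ⇒ s :≤ a :+ 1 :* b ⇒ a :≤ q ⇒ con 10 :≤ b) refl n D I S q (o (Top.v t₁)) (o (Top.v t₂)) 30≤n
                  total (D≤ mk) (I≤ cp′) (compl cp′) (S≤₂ t₁ t₂) (o≤ _))
            (linear 5 (λ n d i s a → con 30 :≤ n ⇒ 4 :* n :+ con 8 :≤ d :+ 2 :* s :+ i ⇒ d :≤ con 42 ⇒ i :+ con 2 :≤ con 4 ⇒ s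
                :≤ 2 :* a ⇒ con 11 :≤ a) refl
              n D I S (o (Top.v t₁)) 30≤n total (D≤ mk) (I≤ cp′) (Top.sum≤ t₁))
          where
          cp′ = trans cp (+-cancelʳ-≡ 3 p 2 eq)
          t₁ = top o P 1 cp′
          t₂ = top o (P ∖ Top.v t₁) 0 (Top.count-rest t₁)
        by-size 2 p mk cp eq = two-hubs-absurd 1 t₁ t₂ (cong (_+ 1) mk)
            (linear 7 (λ n d i s q a b → con 30 :≤ n ⇒ 4 :* n :+ con 8 :≤ d :+ 2 :* s :+ i ⇒ d :≤ con 20 ⇒ i :+ con 3 :≤ con 9 ⇒
              con 3 :+ q :≡ n ⇒ s :≤ a :+ 2 :* b ⇒ a :≤ q ⇒ con 10 :≤ b) refl n D I S q (o (Top.v t₁)) (o (Top.v t₂)) 30≤n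
                  total (D≤ mk) (I≤ cp′) (compl cp′) (S≤₂ t₁ t₂) (o≤ _))
            (linear 5 (λ n d i s a → con 30 :≤ n ⇒ 4 :* n :+ con 8 :≤ d :+ 2 :* s :+ i ⇒ d :≤ con 20 ⇒ i :+ con 3 :≤ con 9 ⇒ s
                :≤ 3 :* a ⇒ con 11 :≤ a) refl
              n D I S (o (Top.v t₁)) 30≤n total (D≤ mk) (I≤ cp′) (Top.sum≤ t₁))
          where
          cp′ = trans cp (+-cancelʳ-≡ 2 p 3 eq)
          t₁ = top o P 2 cp′
          t₂ = top o (P ∖ Top.v t₁) 1 (Top.count-rest t₁)
        -- The tight case for two hubs: `S ≥ 2 * n - 5` and the largest summand is at most `n - 4`,
        -- so the other three share at least 29 and the second is at least 10.
        by-size 1 p mk cp eq = two-hubs-absurd 2 t₁ t₂ (cong (_+ 2) mk)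
            (linear 7 (λ n d i s q a b → con 30 :≤ n ⇒ 4 :* n :+ con 8 :≤ d :+ 2 :* s :+ i ⇒ d :≤ con 6 ⇒ i :+ con 4 :≤ con 16 ⇒
              con 4 :+ q :≡ n ⇒ s :≤ a :+ 3 :* b ⇒ a :≤ q ⇒ con 10 :≤ b) refl n D I S q (o (Top.v t₁)) (o (Top.v t₂)) 30≤n
                  total (D≤ mk) (I≤ cp′) (compl cp′) (S≤₂ t₁ t₂) (o≤ _))
            (linear 5 (λ n d i s a → con 30 :≤ n ⇒ 4 :* n :+ con 8 :≤ d :+ 2 :* s :+ i ⇒ d :≤ con 6 ⇒ i :+ con 4 :≤ con 16 ⇒ s
                :≤ 4 :* a ⇒ con 11 :≤ a) refl
              n D I S (o (Top.v t₁)) 30≤n total (D≤ mk) (I≤ cp′) (Top.sum≤ t₁))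
          where
          cp′ = trans cp (+-cancelʳ-≡ 1 p 4 eq)
          t₁ = top o P 3 cp′
          t₂ = top o (P ∖ Top.v t₁) 2 (Top.count-rest t₁)
        by-size 0 p mk cp eq = choose (10 ≤? o₂)
          where
          cp′ = trans cp (+-cancelʳ-≡ 0 p 5 eq)
          t₁ = top o P 4 cp′
          P₁ = P ∖ Top.v t₁
          t₂ = top o P₁ 3 (Top.count-rest t₁)
          P₂ = P₁ ∖ Top.v t₂
          t₃ = top o P₂ 2 (Top.count-rest t₂)
          P₃ = P₂ ∖ Top.v t₃
          t₄ = top o P₃ 1 (Top.count-rest t₃)
          o₁ o₂ o₃ o₄ : ℕ
          o₁ = o (Top.v t₁)
          o₂ = o (Top.v t₂)
          o₃ = o (Top.v t₃)
          o₄ = o (Top.v t₄)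
          S₂ = sumOver P₁ o
          S₃ = sumOver P₂ o
          S₄ = sumOver P₃ o
          S≥ : 2 * n ≤ S + 6
          S≥ = linear 4 (λ n d i s → 4 :* n :+ con 8 :≤ d :+ 2 :* s :+ i ⇒ d :≤ con 0 ⇒ i :+ con 5 :≤ con 25 ⇒ 2 :* n :≤ s :+
              con 6) refl
            n D I S total (D≤ mk) (I≤ cp′)
          11≤o₁ : 11 ≤ o₁
          11≤o₁ = linear 3 (λ n s a → con 30 :≤ n ⇒ 2 :* n :≤ s :+ con 6 ⇒ s :≤ 5 :* a ⇒ con 11 :≤ a) refl n S o₁ 30≤n S≥
              (Top.sum≤ t₁)
          S₂≥ : 29 ≤ S₂
          S₂≥ = linear 5 (λ n s a q s₂ → con 30 :≤ n ⇒ 2 :* n :≤ s :+ con 6 ⇒ s :≡ a :+ s₂ ⇒ a :≤ q ⇒ con 5 :+ q :≡ n ⇒ con 29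
              :≤ s₂) refl
            n S o₁ q S₂ 30≤n S≥ (Top.sum-rest t₁) (o≤ _) (compl cp′)
          8≤o₂ : 8 ≤ o₂
          8≤o₂ = linear 2 (λ s b → con 29 :≤ s ⇒ s :≤ 4 :* b ⇒ con 8 :≤ b) refl S₂ o₂ S₂≥ (Top.sum≤ t₂)
          choose : Dec (10 ≤ o₂) → ⊥
          choose (yes le) = two-hubs-absurd 3 t₁ t₂ (cong (_+ 3) mk) le 11≤o₁
          -- If the second degree is at most 9, the remaining three share at least 20, so the third
          -- is at least 7. Since it is at most 9 as well, the last two share at least 11, and the
          -- fourth is at least 6.
          choose (no nle) = four-hubs-absurd mk t₁ t₂ t₃ t₄ 6≤o₄ 7≤o₃ 8≤o₂ (≤-trans (≤ᵇ⇒≤ 9 11 tt) 11≤o₁)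
            where
            S₃≥ : 20 ≤ S₃
            S₃≥ = linear 3 (λ s b s₃ → con 29 :≤ s ⇒ s :≡ b :+ s₃ ⇒ b :< con 10 ⇒ con 20 :≤ s₃) refl S₂ o₂ S₃ S₂≥
                (Top.sum-rest t₂) (≰⇒> nle)
            7≤o₃ : 7 ≤ o₃
            7≤o₃ = linear 2 (λ s b → con 20 :≤ s ⇒ s :≤ 3 :* b ⇒ con 7 :≤ b) refl S₃ o₃ S₃≥ (Top.sum≤ t₃)
            6≤o₄ : 6 ≤ o₄
            6≤o₄ = linear 5 (λ b c d s₃ s₄ → b :< con 10 ⇒ c :≤ b ⇒ con 20 :≤ s₃ ⇒ s₃ :≡ c :+ s₄ ⇒ s₄ :≤ 2 :* d ⇒ con 6 :≤ d) refl
              o₂ o₃ o₄ S₃ S₄ (≰⇒> nle) (Top.maximal t₂ _ (∖-⊆ P₁ _ _ (Top.v∈P t₃))) S₃≥ (Top.sum-rest t₃) (Top.sum≤ t₄)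
        by-size (suc (suc (suc (suc (suc (suc k)))))) p mk cp eq = linear 2 (λ p k → p :+ (con 6 :+ k) :≡ con 5 ⇒ absurd) refl
            p k eq

      dense-swappable-absurd : ⊥
      dense-swappable-absurd = by-size m (count P) refl refl count+m

    dense-swappable⇒matching₆ : ¬ Bounded g 5
    dense-swappable⇒matching₆ bd = (do
      bar ← barrier 5 (≤-trans (≤ᵇ⇒≤ 6 30 tt) 30≤n) bd
      bl ← blocks (del-sym (Barrier.P bar) gsym) (del-irr (Barrier.P bar) girr) (Barrier.bounded bar) (Barrier.missed bar) v₀
      λ _ → dense-swappable-absurd bar bl v₀) id
      where
      v₀ : Fin n
      v₀ = proj₁ (cover (λ _ → false) (≤-trans (≤-reflexive (sum-zero λ _ → refl)) z≤n))

-- Simple graphs from sets of darts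

allB-elim : ∀ d {p : Fin d → Bool} → allB d p ≡ true → ∀ x → p x ≡ true
allB-elim (suc d) e zero = proj₁ (∧-elim e)
allB-elim (suc d) {p} e (suc x) = allB-elim d (proj₂ (∧-elim {p zero} e)) x

allB-intro : ∀ d {p : Fin d → Bool} → (∀ x → p x ≡ true) → allB d p ≡ true
allB-intro zero h = refl
allB-intro (suc d) h = ∧-intro (h zero) (allB-intro d (λ x → h (suc x)))

least : ∀ {d} (p : Fin d → Bool) {x} → p x ≡ true → ∃[ y ] (p y ≡ true × ∀ z → p z ≡ true → toℕ y ≤ toℕ z)
least {suc d} p {x} px with p zero in p₀
... | true = zero , p₀ , λ _ _ → z≤n
least {suc d} p {zero} px | false = ⊥-elim (true≢false (trans (sym px) p₀))
least {suc d} p {suc x} px | false with least (p ∘ suc) px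
... | y , py , le = suc y , py , λ { zero pz → ⊥-elim (true≢false (trans (sym pz) p₀)) ; (suc z) pz → s≤s (le z pz) }

opaque
  select : ∀ {n} (p : Fin n → Bool) k → k ≤ count p →
    Σ[ s ∈ (Fin k → Fin n) ] ((∀ i → p (s i) ≡ true) × (∀ i j → s i ≡ s j → i ≡ j))
  select p zero le = (λ ()) , (λ ()) , λ ()
  select {n} p (suc k) le with count-witness p (≤-trans (s≤s z≤n) le)
  ... | v , pv with select (p ∖ v) k (≤-pred (≤-trans le (≤-reflexive (count-∖ p pv))))
  ... | s , ps , inj = (λ { zero → v ; (suc i) → s i }) , (λ { zero → pv ; (suc i) → ∖-⊆ p v _ (ps i) }) , λ
    { zero zero _ → refl
    ; zero (suc j) e → ⊥-elim (∖-≢ p v _ (ps j) e)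
    ; (suc i) zero e → ⊥-elim (∖-≢ p v _ (ps i) (sym e))
    ; (suc i) (suc j) e → cong suc (inj i j e) }

module First {d : ℕ} (c : Fin d → ℕ) where

  -- The test of `numColors` word for word, so that counting these darts gives the number of colours
  -- by definition.
  first : Fin d → Bool
  first x = allB d (λ y → not ⌊ c y ≟ c x ⌋ ∨ ⌊ x Fin.≤? y ⌋)

  first-intro : ∀ x → (∀ y → c y ≡ c x → toℕ x ≤ toℕ y) → first x ≡ true
  first-intro x h = allB-intro d λ y → entry y (c y ≟ c x)
    where
    entry : ∀ y (D : Dec (c y ≡ c x)) → not ⌊ D ⌋ ∨ ⌊ x Fin.≤? y ⌋ ≡ true
    entry y (no _) = refl
    entry y (yes e) = ⌊⌋-yes (x Fin.≤? y) (h y e)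

  first-elim : ∀ {x} y → first x ≡ true → c y ≡ c x → toℕ x ≤ toℕ y
  first-elim {x} y f e with ∨-elim {not ⌊ c y ≟ c x ⌋} (allB-elim d f y)
  ... | inj₁ p = ⊥-elim (true≢false (trans (sym (⌊⌋-yes (c y ≟ c x) e)) (not-true p)))
  ... | inj₂ p = ⌊⌋-sound (x Fin.≤? y) p

  first-exists : ∀ f → ∃[ r ] (first r ≡ true × c r ≡ c f)
  first-exists f with least (λ x → ⌊ c x ≟ c f ⌋) {f} (⌊⌋-yes (c f ≟ c f) refl)
  ... | r , p , min = r , first-intro r (λ y e → min y (⌊⌋-yes (c y ≟ c f) (trans e cr))) , cr
    where
    cr : c r ≡ c f
    cr = ⌊⌋-sound (c r ≟ c f) p

module DartGraph {n : ℕ} (T : PlaneTriangulation n) where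
  open PlaneTriangulation T
  open Planar T

  private
    joins : (Fin d → Bool) → Fin n → Fin n → Fin d → Bool
    joins D u v x = D x ∧ (tail x == u ∧ hd x == v)

  opaque
    adj : (Fin d → Bool) → Graph n
    adj D u v = ⌊ any? (λ x → joins D u v x ≟B true) ⌋

    adj-intro : ∀ D {x u v} → D x ≡ true → tail x ≡ u → hd x ≡ v → adj D u v ≡ true
    adj-intro D {x} dx refl refl = ⌊⌋-yes (any? _) (x , ∧-intro dx (∧-intro (==-refl (tail x)) (==-refl (hd x))))

    adj-elim : ∀ D {u v} → adj D u v ≡ true → ∃[ x ] (D x ≡ true × tail x ≡ u × hd x ≡ v)
    adj-elim D {u} {v} e with ⌊⌋-sound (any? λ x → joins D u v x ≟B true) e
    ... | x , j with ∧-elim {D x} j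
    ... | dx , th with ∧-elim {tail x == u} th
    ... | t , h = x , dx , ==-sound t , ==-sound h

  adj-count : ∀ D u v → ind (adj D u v) ≡ sum (λ x → ind (tail x == u) * (ind (hd x == v) * ind (D x)))
  adj-count D u v = by-value (adj D u v) refl
    where
    table : ∀ a b c → ind a * (ind b * ind c) ≡ ind (c ∧ (a ∧ b))
    table true true true = refl
    table true true false = refl
    table true false true = refl
    table true false false = refl
    table false b true = refl
    table false b false = refl
    by-value : ∀ b → adj D u v ≡ b → ind (adj D u v) ≡ sum (λ x → ind (tail x == u) * (ind (hd x == v) * ind (D x)))
    by-value false e = trans (cong ind e) (sym (sum-zero λ x → trans (table (tail x == u) (hd x == v) (D x)) (cong ind (none x))))
      where
      none : ∀ x → joins D u v x ≡ false
      none x = ≡false λ j → let dx , th = ∧-elim {D x} j ; t , h = ∧-elim {tail x == u} th in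
        true≢false (trans (sym (adj-intro D dx (==-sound t) (==-sound h))) e)
    by-value true e with adj-elim D e
    ... | x₀ , dx₀ , refl , refl = trans (cong ind e) (trans (sym (count-== x₀))
        (sum-cong λ x → trans (cong ind (only x)) (sym (table (tail x == tail x₀) (hd x == hd x₀) (D x)))))
      where
      only : ∀ x → (x₀ == x) ≡ joins D (tail x₀) (hd x₀) x
      only x = bool-ext
        (λ p → subst (λ y → joins D (tail x₀) (hd x₀) y ≡ true) (==-sound p)
            (∧-intro dx₀ (∧-intro (==-refl (tail x₀)) (==-refl (hd x₀)))))
        (λ j → let dx , th = ∧-elim {D x} j ; t , h = ∧-elim {tail x == tail x₀} th in
          ⌊⌋-yes (x₀ ≟F x) (sym (no-multi x x₀ (==-sound t) (==-sound h))))

  -- By `no-multi` an adjacent ordered pair comes from exactly one dart. This carries the dart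
  -- counts of the planar part over to graphs.
  adj-pairs : ∀ D (f : Fin n → Fin n → Bool) → pairs (λ u v → adj D u v ∧ f u v) ≡ count (λ x → D x ∧ f (tail x) (hd x))
  adj-pairs D f = begin
    pairs (λ u v → adj D u v ∧ f u v)
      ≡⟨ sum-cong (λ u → sum-cong λ v → trans (and (adj D u v) (f u v))
          (trans (cong (ind (f u v) *_) (adj-count D u v)) (sym (sum-*ˡ (ind (f u v)) _)))) ⟩
    sum (λ u → sum (λ v → sum (λ x → ind (f u v) * (ind (tail x == u) * (ind (hd x == v) * ind (D x))))))
      ≡⟨ sum-cong (λ u → sum-comm _) ⟩
    sum (λ u → sum (λ x → sum (λ v → ind (f u v) * (ind (tail x == u) * (ind (hd x == v) * ind (D x))))))
      ≡⟨ sum-comm _ ⟩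
    sum (λ x → sum (λ u → sum (λ v → ind (f u v) * (ind (tail x == u) * (ind (hd x == v) * ind (D x))))))
      ≡⟨ sum-cong (λ x → trans (sum-cong λ u → trans
          (sum-cong λ v → swap (ind (f u v)) (ind (tail x == u)) (ind (hd x == v)) (ind (D x)))
           (trans (sum-*ˡ (ind (tail x == u)) _) (cong (ind (tail x == u) *_) (sum-δ (hd x) (λ v → ind (f u v) * ind (D x))))))
           (sum-δ (tail x) (λ u → ind (f u (hd x)) * ind (D x)))) ⟩
    sum (λ x → ind (f (tail x) (hd x)) * ind (D x))
      ≡⟨ sum-cong (λ x → sym (and (D x) (f (tail x) (hd x)))) ⟩
    count (λ x → D x ∧ f (tail x) (hd x)) ∎
    where
    open ≡-Reasoning
    and : ∀ a b → ind (a ∧ b) ≡ ind b * ind a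
    and true true = refl
    and true false = refl
    and false true = refl
    and false false = refl
    swap : ∀ a b c e → a * (b * (c * e)) ≡ b * (c * (a * e))
    swap = solve-∀

  adj-sym : ∀ D → (∀ x → D x ≡ true → D (α x) ≡ true) → Symmetric (adj D)
  adj-sym D h u v e with adj-elim D e
  ... | x , dx , refl , refl = adj-intro D (h x dx) refl (hd-α x)

  adj-irr : ∀ D → Irreflexive (adj D)
  adj-irr D u = ≡false λ e → let x , _ , t , h = adj-elim D e in loopless x (trans h (sym t))

  A : Graph n
  A = adj (λ _ → true)

  adj-⊆ : ∀ D → adj D ⊆ A
  adj-⊆ D u v e with adj-elim D e
  ... | x , _ , t , h = adj-intro _ refl t h

  outPairs≡cutSize : ∀ P → outPairs A P ≡ cutSize P
  outPairs≡cutSize P = adj-pairs (λ _ → true) (λ u v → P u ∧ not (P v))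

  planarFacts : 30 ≤ n → PlanarFacts A
  planarFacts 30≤n = record
    { A-sym = adj-sym _ λ _ _ → refl
    ; A-irr = adj-irr _
    ; cover = cover
    ; cut = λ P → subst (λ c → c + 4 ≤ 2 * n) (sym (outPairs≡cutSize P)) (cut-bound P)
    ; partition = λ P W disj → subst₂ (λ a b → a + 2 * b + pairs (λ u v → A u v ∧ (W u ∧ not (P v) ∧ not (W v))) + 12 ≤ 4 * n
        + 2 * count P + 2 * count W)
        (sym (adj-pairs (λ _ → true) (λ u v → W u ∧ W v))) (sym (outPairs≡cutSize P))
        (subst (λ c → darts (λ a b → ind (W a ∧ W b)) + 2 * cutSize P + c + 12 ≤ 4 * n + 2 * count P + 2 * count W)
          (sym (adj-pairs (λ _ → true) (λ u v → W u ∧ not (P v) ∧ not (W v))))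
          (partition-bound 4≤n P W disj))
    ; rotation = rotation
    }
    where
    4≤n : 4 ≤ n
    4≤n = ≤-trans (≤ᵇ⇒≤ 4 30 tt) 30≤n
    cover : ∀ (S : Fin n → Bool) → count S ≤ 11 → ∃[ u ] ∃[ v ] (A u v ≡ true × S u ≡ false × S v ≡ false)
    cover S small with any? (λ x → (S (tail x) ∨ S (hd x)) ≟B false)
    ... | yes (x , e) = tail x , hd x , adj-intro _ refl refl refl , neither e
      where
      neither : ∀ {a b} → a ∨ b ≡ false → a ≡ false × b ≡ false
      neither {false} {false} e = refl , refl
    ... | no none = ⊥-elim (linear 2 (λ n s → con 30 :≤ n ⇒ s :≤ con 11 ⇒ n :+ con 4 :≤ 3 :* s ⇒ absurd) refl n (count S) 30≤n small
      (cover-bound 4≤n S λ x → not-false (S (tail x) ∨ S (hd x)) λ e → none (x , e)))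
      where
      not-false : ∀ b → b ≢ false → b ≡ true
      not-false true _ = refl
      not-false false h = ⊥-elim (h refl)
    rotation : ∀ (W : Fin n → Bool) {u v x y} → A u v ≡ true → A u x ≡ true → A u y ≡ true → W x ≡ true → W y ≡ false → x ≢ v
        → y ≢ v →
      ¬ (∀ z w → A z w ≡ true → z ≢ u → z ≢ v → w ≢ u → w ≢ v → W z ≡ W w)
    rotation W av ax ay wx wy xv yv h with adj-elim _ av | adj-elim _ ax | adj-elim _ ay
    ... | x₀ , _ , refl , refl | x , _ , tx , refl | y , _ , ty , refl =
      rotation-crosses W x₀ x y tx ty wx wy xv yv λ z hu hv tu tv → h (tail z) (hd z) (adj-intro _ refl refl refl) tu tv hu hv

-- The upper bound

module _ {n : ℕ} (T : PlaneTriangulation n) where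
  open PlaneTriangulation T
  open Planar T
  open DartGraph T

  -- Each edge is directed upwards: its tail is the smaller end. Six different tails then suffice,
  -- since no tail can be the head of another edge.
  matching⇒M6 : ∀ {h : Graph n} (M : Matching h) (Q : Fin d → Set) →
    (∀ u v → h u v ≡ true → ∃[ x ] (tail x ≡ u × hd x ≡ v × Q x)) →
    6 ≤ size M → Σ[ e ∈ (Fin 6 → Fin d) ] (IsM6 T e × ∀ i → Q (e i))
  matching⇒M6 {h} M Q dart six with select (λ x → below x (mate M x)) 6 (≤-trans six (≤-reflexive (size≡ M)))
  ... | s , low , s-inj = (λ i → proj₁ (chosen i)) , m6 , λ i → proj₂ (proj₂ (proj₂ (chosen i)))
    where
    lt : ∀ i → toℕ (s i) < toℕ (mate M (s i))
    lt i = ⌊⌋-sound (_ ≤? _) (low i)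
    chosen : ∀ i → ∃[ x ] (tail x ≡ s i × hd x ≡ mate M (s i) × Q x)
    chosen i = dart (s i) (mate M (s i)) (mate-edge M (s i) λ e → <-irrefl (cong toℕ (sym e)) (lt i))
    e : Fin 6 → Fin d
    e i = proj₁ (chosen i)
    tl : ∀ i → tail (e i) ≡ s i
    tl i = proj₁ (proj₂ (chosen i))
    hl : ∀ i → hd (e i) ≡ mate M (s i)
    hl i = proj₁ (proj₂ (proj₂ (chosen i)))
    low≢high : ∀ i j → s i ≢ mate M (s j)
    low≢high i j eq = <-asym (lt i) (subst (λ z → toℕ (mate M z) < toℕ z) (sym eq)
        (subst (λ z → toℕ z < toℕ (mate M (s j))) (sym (mate-invol M (s j))) (lt j)))
    m6 : IsM6 T e
    m6 (i , false) (j , false) eq = cong (_, false) (s-inj i j (trans (sym (tl i)) (trans eq (tl j))))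
    m6 (i , false) (j , true) eq = ⊥-elim (low≢high i j (trans (sym (tl i)) (trans eq (hl j))))
    m6 (i , true) (j , false) eq = ⊥-elim (low≢high j i (trans (sym (tl j)) (trans (sym eq) (hl i))))
    m6 (i , true) (j , true) eq = cong (_, true) (s-inj i j (trans (sym (mate-invol M (s i)))
      (trans (cong (mate M) (trans (sym (hl i)) (trans eq (hl j)))) (mate-invol M (s j)))))

  module _ (30≤n : 30 ≤ n) (col : Coloring T) (no-rainbow : ¬ RainbowM6 T col) where

    private
      c : Fin d → ℕ
      c = proj₁ col

      c-α : ∀ x → c (α x) ≡ c x
      c-α = proj₂ col

      open First c

      first-unique : ∀ {x y} → first x ≡ true → first y ≡ true → c x ≡ c y → x ≡ y
      first-unique {x} {y} fx fy e = toℕ-injective (≤-antisym (first-elim y fx (sym e)) (first-elim x fy e))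

      D : Fin d → Bool
      D x = first x ∨ first (α x)

      D-α : ∀ x → D x ≡ true → D (α x) ≡ true
      D-α x e with ∨-elim {first x} e
      ... | inj₁ p = ∨-introʳ (first (α x)) (subst (λ y → first y ≡ true) (sym (α-invol x)) p)
      ... | inj₂ p = ∨-introˡ p

      D-first : ∀ x → D x ≡ true → ∃[ x′ ] (first x′ ≡ true × c x′ ≡ c x × (x ≡ x′ ⊎ x ≡ α x′))
      D-first x e with ∨-elim {first x} e
      ... | inj₁ p = x , p , refl , inj₁ refl
      ... | inj₂ p = α x , p , c-α x , inj₂ (sym (α-invol x))

      -- A dart and its reverse have the same colour, so they are never both first.
      count-D : count D ≡ 2 * numColors T col
      count-D = begin
        count D ≡⟨ sum-cong (λ x → split (first x) (first (α x)) (exclusive x)) ⟩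
        sum (λ x → ind (first x) + ind (first (α x))) ≡⟨ sum-+ _ _ ⟩
        count first + sum (λ x → ind (first (α x))) ≡⟨ cong (count first +_)
            (sum-reindex α α α-invol α-invol (λ x → ind (first x))) ⟩
        count first + count first ≡⟨ cong (count first +_) (sym (+-identityʳ _)) ⟩
        2 * count first ≡⟨ cong (2 *_) (sym (countF≡count d first)) ⟩
        2 * numColors T col ∎
        where
        open ≡-Reasoning
        exclusive : ∀ x → ¬ (first x ≡ true × first (α x) ≡ true)
        exclusive x (p , q) = α-nofix x (sym (first-unique p q (sym (c-α x))))
        split : ∀ a b → ¬ (a ≡ true × b ≡ true) → ind (a ∨ b) ≡ ind a + ind b
        split true true h = ⊥-elim (h (refl , refl))
        split true false h = refl
        split false b h = refl

      g : Graph n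
      g = adj D

      same-edge : ∀ x y → D x ≡ true → D y ≡ true → c x ≡ c y → x ≡ y ⊎ x ≡ α y
      same-edge x y dx dy e with D-first x dx | D-first y dy
      ... | x′ , fx , cx , x≡ | y′ , fy , cy , y≡ with first-unique fx fy (trans cx (trans e (sym cy)))
      ... | refl = glue x≡ y≡
        where
        glue : x ≡ x′ ⊎ x ≡ α x′ → y ≡ x′ ⊎ y ≡ α x′ → x ≡ y ⊎ x ≡ α y
        glue (inj₁ p) (inj₁ q) = inj₁ (trans p (sym q))
        glue (inj₁ p) (inj₂ q) = inj₂ (trans p (trans (sym (α-invol x′)) (cong α (sym q))))
        glue (inj₂ p) (inj₁ q) = inj₂ (trans p (cong α (sym q)))
        glue (inj₂ p) (inj₂ q) = inj₁ (trans p (sym q))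

      rainbow : (e : Fin 6 → Fin d) → IsM6 T e → (∀ i j → c (e i) ≡ c (e j) → e i ≡ e j ⊎ e i ≡ α (e j)) → ⊥
      rainbow e m6 sep = no-rainbow (e , m6 , λ i j eq → same i j (sep i j eq))
        where
        same : ∀ i j → e i ≡ e j ⊎ e i ≡ α (e j) → i ≡ j
        same i j (inj₁ p) = cong proj₁ (m6 (i , false) (j , false) (cong tail p))
        same i j (inj₂ p) = cong proj₁ (m6 (i , false) (j , true) (cong tail p))

      -- The swapped-in edge f takes over the colour of the edge ab that it replaces.
      swappable : Swappable A g
      swappable f₁ f₂ af with adj-elim _ af
      ... | f , _ , refl , refl with first-exists f
      ... | r , fr , cr = tail r , hd r , g′ , (λ x y e → ∨-introˡ e) , g′-sym ,
          ∨-introʳ (rem g a b (tail f) (hd f)) (∨-introˡ (∧-intro (==-refl (tail f)) (==-refl (hd f)))) , bound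
        where
        a b : Fin n
        a = tail r
        b = hd r
        g′ : Graph n
        g′ u v = rem g a b u v ∨ ((u == tail f ∧ v == hd f) ∨ (u == hd f ∧ v == tail f))
        Old New : Fin d → Set
        Old x = D x ≡ true × x ≢ r × x ≢ α r
        New x = x ≡ f ⊎ x ≡ α f
        dart : ∀ u v → g′ u v ≡ true → ∃[ x ] (tail x ≡ u × hd x ≡ v × (Old x ⊎ New x))
        dart u v e with ∨-elim {rem g a b u v} e
        ... | inj₁ old = let x , dx , t , h = adj-elim D (rem-⊆ g a b u v old) in
          x , t , h , inj₁ (dx , (λ p → rem-avoidsˡ g old (trans (sym t) (cong tail p)) (trans (sym h) (cong hd p)))
            , (λ p → rem-avoidsʳ g old (trans (sym t) (cong tail p)) (trans (sym h) (trans (cong hd p) (hd-α r)))))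
        ... | inj₂ new with ∨-elim {u == tail f ∧ v == hd f} new
        ...   | inj₁ p = let q , s = ∧-elim {u == tail f} p in f , sym (==-sound q) , sym (==-sound s) , inj₂ (inj₁ refl)
        ...   | inj₂ p = let q , s = ∧-elim {u == hd f} p in α f , sym (==-sound q) , trans (hd-α f) (sym (==-sound s)) , inj₂ (inj₂ refl)
        undart : ∀ x → Old x ⊎ New x → g′ (tail x) (hd x) ≡ true
        undart x (inj₁ (dx , ne , ne′)) = ∨-introˡ (rem-intro g (adj-intro D dx refl refl)
          (λ p q → ne (no-multi x r p q)) (λ p q → ne′ (no-multi x (α r) p (trans q (sym (hd-α r))))))
        undart x (inj₂ (inj₁ refl)) = ∨-introʳ (rem g a b (tail x) (hd x)) (∨-introˡ (∧-intro (==-refl (tail x)) (==-refl (hd x))))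
        undart x (inj₂ (inj₂ refl)) = ∨-introʳ (rem g a b (tail x) (hd x)) (∨-introʳ (tail x == tail f ∧ hd x == hd f)
          (∧-intro (==-refl (hd f)) (⌊⌋-yes (hd x ≟F tail f) (hd-α f))))
        g′-sym : Symmetric g′
        g′-sym u v e with dart u v e
        ... | x , refl , refl , q = subst (λ w → g′ (hd x) w ≡ true) (hd-α x) (undart (α x) (reverse q))
          where
          reverse : Old x ⊎ New x → Old (α x) ⊎ New (α x)
          reverse (inj₁ (dx , ne , ne′)) = inj₁ (D-α x dx , (λ p → ne′ (trans (sym (α-invol x)) (cong α p))) ,
            (λ p → ne (trans (sym (α-invol x)) (trans (cong α p) (α-invol r)))))
          reverse (inj₂ (inj₁ p)) = inj₂ (inj₂ (cong α p))
          reverse (inj₂ (inj₂ p)) = inj₂ (inj₁ (trans (cong α p) (α-invol f)))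
        new-colour : ∀ {x} → New x → c x ≡ c r
        new-colour (inj₁ refl) = sym cr
        new-colour (inj₂ refl) = trans (c-α f) (sym cr)
        clash : ∀ {x} → Old x → c x ≡ c r → ⊥
        clash {x} (dx , ne , ne′) e = [ ne , ne′ ]′ (same-edge x r dx (∨-introˡ fr) e)
        sep : ∀ x y → Old x ⊎ New x → Old y ⊎ New y → c x ≡ c y → x ≡ y ⊎ x ≡ α y
        sep x y (inj₁ (dx , _)) (inj₁ (dy , _)) e = same-edge x y dx dy e
        sep x y (inj₁ o) (inj₂ w) e = ⊥-elim (clash o (trans e (new-colour w)))
        sep x y (inj₂ w) (inj₁ o) e = ⊥-elim (clash o (trans (sym e) (new-colour w)))
        sep x y (inj₂ (inj₁ p)) (inj₂ (inj₁ q)) e = inj₁ (trans p (sym q))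
        sep x y (inj₂ (inj₁ p)) (inj₂ (inj₂ q)) e = inj₂ (trans p (trans (sym (α-invol f)) (cong α (sym q))))
        sep x y (inj₂ (inj₂ p)) (inj₂ (inj₁ q)) e = inj₂ (trans p (cong α (sym q)))
        sep x y (inj₂ (inj₂ p)) (inj₂ (inj₂ q)) e = inj₁ (trans p (sym q))
        bound : Bounded g′ 5
        bound M = ≮⇒≥ λ six → let e , m6 , q = matching⇒M6 M (λ x → Old x ⊎ New x) dart six in
          rainbow e m6 λ i j → sep (e i) (e j) (q i) (q j)

    few-colours : numColors T col ≤ 2 * n + 3
    few-colours = ≮⇒≥ λ many → dense-swappable⇒matching₆ 30≤n (planarFacts 30≤n) (adj-sym D D-α) (adj-irr D) (adj-⊆ D) swappable
      (linear 3 (λ n k p → 2 :* n :+ con 3 :< k ⇒ p :≡ 2 :* k ⇒ 4 :* n :+ con 8 :≤ p) refl n (numColors T col) (pairs g) many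
        (trans (sum-cong λ u → sum-cong λ v → cong ind (and-true (g u v))) (trans (adj-pairs D (λ _ _ → true))
          (trans (count-cong λ x → sym (and-true (D x))) count-D))))
      λ M → ≮⇒≥ λ six → let e , m6 , q = matching⇒M6 M (λ x → D x ≡ true)
                                (λ u v a → let x , dx , t , h = adj-elim D a in x , t , h , dx) six in
        rainbow e m6 λ i j → same-edge (e i) (e j) (q i) (q j)
      where
      and-true : ∀ b → b ≡ b ∧ true
      and-true true = refl
      and-true false = refl

-- Inserting a vertex of degree three into a face

reach-trans : ∀ {d} {σ α : Fin d → Fin d} {x y z} → Reach σ α x y → Reach σ α y z → Reach σ α x z
reach-trans here q = q
reach-trans (viaσ p) q = viaσ (reach-trans p q)
reach-trans (viaα p) q = viaα (reach-trans p q)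

module Insertion {n : ℕ} (T : PlaneTriangulation n) (x₀ : Fin (PlaneTriangulation.d T)) where
  open PlaneTriangulation T
  open Planar T

  x : Fin 3 → Fin d
  x 0F = x₀
  x 1F = φ x₀
  x 2F = φ (φ x₀)

  next prev : Fin 3 → Fin 3
  next 0F = 1F
  next 1F = 2F
  next 2F = 0F
  prev 0F = 2F
  prev 1F = 0F
  prev 2F = 1F

  next-prev : ∀ i → next (prev i) ≡ i
  next-prev 0F = refl
  next-prev 1F = refl
  next-prev 2F = refl

  prev-next : ∀ i → prev (next i) ≡ i
  prev-next 0F = refl
  prev-next 1F = refl
  prev-next 2F = refl

  φ-x : ∀ i → φ (x i) ≡ x (next i)
  φ-x 0F = refl
  φ-x 1F = refl
  φ-x 2F = faces-tri x₀

  t : Fin 3 → Fin n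
  t i = tail (x i)

  hd-x : ∀ i → hd (x i) ≡ t (next i)
  hd-x i = trans (sym (tail-φ (x i))) (cong tail (φ-x i))

  t-next : ∀ i → t i ≢ t (next i)
  t-next i e = loopless (x i) (trans (hd-x i) (sym e))

  t-injective : ∀ i j → t i ≡ t j → i ≡ j
  t-injective 0F 0F e = refl
  t-injective 1F 1F e = refl
  t-injective 2F 2F e = refl
  t-injective 0F 1F e = ⊥-elim (t-next 0F e)
  t-injective 1F 2F e = ⊥-elim (t-next 1F e)
  t-injective 2F 0F e = ⊥-elim (t-next 2F e)
  t-injective 1F 0F e = ⊥-elim (t-next 0F (sym e))
  t-injective 2F 1F e = ⊥-elim (t-next 1F (sym e))
  t-injective 0F 2F e = ⊥-elim (t-next 2F (sym e))

  x-injective : ∀ {i j} → x i ≡ x j → i ≡ j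
  x-injective e = t-injective _ _ (cong tail e)

  Dart : Set
  Dart = Fin (3 + (3 + d))

  -- s i and r i are the darts between the new vertex and t i, starting and ending at the new vertex, respectively.
  s r : Fin 3 → Dart
  s i = i ↑ˡ (3 + d)
  r i = 3 ↑ʳ (i ↑ˡ d)

  old : Fin d → Dart
  old y = 3 ↑ʳ (3 ↑ʳ y)

  data Kind : Dart → Set where
    sᵏ : ∀ i → Kind (s i)
    rᵏ : ∀ i → Kind (r i)
    oᵏ : ∀ y → Kind (old y)

  kind : ∀ w → Kind w
  kind w with splitAt 3 {3 + d} w in e
  ... | inj₁ i = subst Kind (splitAt⁻¹-↑ˡ e) (sᵏ i)
  ... | inj₂ v with splitAt 3 {d} v in f
  ...   | inj₁ i = subst Kind (trans (cong (3 ↑ʳ_) (splitAt⁻¹-↑ˡ f)) (splitAt⁻¹-↑ʳ {3} e)) (rᵏ i)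
  ...   | inj₂ y = subst Kind (trans (cong (3 ↑ʳ_) (splitAt⁻¹-↑ʳ {3} f)) (splitAt⁻¹-↑ʳ {3} e)) (oᵏ y)

  module _ {B : Set} (f g : Fin 3 → B) (h : Fin d → B) where

    on : Dart → B
    on w = [ f , (λ v → [ g , h ]′ (splitAt 3 v)) ]′ (splitAt 3 w)

    on-s : ∀ i → on (s i) ≡ f i
    on-s i rewrite splitAt-↑ˡ 3 i (3 + d) = refl

    on-r : ∀ i → on (r i) ≡ g i
    on-r i rewrite splitAt-↑ˡ 3 i d = refl

  -- In the rotation around `t i` the new dart `r i` is placed directly before `x i`: whatever led
  -- to `x i` now leads to `r i`.
  redirect : Fin d → Dart
  redirect z with any? (λ i → z ≟F x i)
  ... | yes (i , _) = r i
  ... | no _ = old z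

  redirect-x : ∀ i → redirect (x i) ≡ r i
  redirect-x i with any? (λ j → x i ≟F x j)
  ... | yes (j , e) = cong r (sym (x-injective e))
  ... | no none = ⊥-elim (none (i , refl))

  redirect-cases : ∀ z → (∃[ i ] (z ≡ x i × redirect z ≡ r i)) ⊎ ((∀ i → z ≢ x i) × redirect z ≡ old z)
  redirect-cases z with any? (λ j → z ≟F x j)
  ... | yes (j , e) = inj₁ (j , e , refl)
  ... | no none = inj₂ ((λ i e → none (i , e)) , refl)

  redirect-old : ∀ {z} → (∀ i → z ≢ x i) → redirect z ≡ old z
  redirect-old {z} ne with redirect-cases z
  ... | inj₁ (i , e , _) = ⊥-elim (ne i e)
  ... | inj₂ (_ , e) = e

  back : Fin d → Dart
  back z with any? (λ i → z ≟F x i)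
  ... | yes (i , _) = r i
  ... | no _ = old (σ⁻ z)

  back-x : ∀ i → back (x i) ≡ r i
  back-x i with any? (λ j → x i ≟F x j)
  ... | yes (j , e) = cong r (sym (x-injective e))
  ... | no none = ⊥-elim (none (i , refl))

  back-old : ∀ {z} → (∀ i → z ≢ x i) → back z ≡ old (σ⁻ z)
  back-old {z} ne with any? (λ j → z ≟F x j)
  ... | yes (j , e) = ⊥-elim (ne j e)
  ... | no _ = refl

  tail′ : Dart → Fin (suc n)
  tail′ = on (λ _ → zero) (λ i → suc (t i)) (λ y → suc (tail y))

  α′ σ′ σ⁻′ φ′ : Dart → Dart
  α′ = on r s (λ y → old (α y))
  σ′ = on (λ i → s (prev i)) (λ i → old (x i)) (λ y → redirect (σ y))
  σ⁻′ = on (λ i → s (next i)) (λ i → old (σ⁻ (x i))) back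
  φ′ w = σ′ (α′ w)

  tail-s : ∀ i → tail′ (s i) ≡ zero
  tail-s = on-s _ _ _

  tail-r : ∀ i → tail′ (r i) ≡ suc (t i)
  tail-r = on-r (λ _ → zero) _ _

  α-s : ∀ i → α′ (s i) ≡ r i
  α-s = on-s _ _ _

  α-r : ∀ i → α′ (r i) ≡ s i
  α-r = on-r r _ _

  σ-s : ∀ i → σ′ (s i) ≡ s (prev i)
  σ-s = on-s _ _ _

  σ-r : ∀ i → σ′ (r i) ≡ old (x i)
  σ-r = on-r (λ i → s (prev i)) _ _

  hd-s : ∀ i → tail′ (α′ (s i)) ≡ suc (t i)
  hd-s i = trans (cong tail′ (α-s i)) (tail-r i)

  hd-r : ∀ i → tail′ (α′ (r i)) ≡ zero
  hd-r i = trans (cong tail′ (α-r i)) (tail-s i)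

  redirect-tail : ∀ z → tail′ (redirect z) ≡ suc (tail z)
  redirect-tail z with redirect-cases z
  ... | inj₁ (i , refl , e) = trans (cong tail′ e) (tail-r i)
  ... | inj₂ (_ , e) = cong tail′ e

  α-invol′ : ∀ w → α′ (α′ w) ≡ w
  α-invol′ w with kind w
  ... | sᵏ i = trans (cong α′ (α-s i)) (α-r i)
  ... | rᵏ i = trans (cong α′ (α-r i)) (α-s i)
  ... | oᵏ y = cong old (α-invol y)

  loopless′ : ∀ w → tail′ (α′ w) ≢ tail′ w
  loopless′ w e with kind w
  ... | sᵏ i = case trans (sym (hd-s i)) (trans e (tail-s i)) of λ ()
  ... | rᵏ i = case trans (sym (hd-r i)) (trans e (tail-r i)) of λ ()
  ... | oᵏ y = loopless y (Fin-suc-injective e)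

  σ-inv₁′ : ∀ w → σ′ (σ⁻′ w) ≡ w
  σ-inv₁′ w with kind w
  ... | sᵏ i = trans (cong σ′ (on-s _ _ _ i)) (trans (σ-s (next i)) (cong s (prev-next i)))
  ... | rᵏ i = trans (cong σ′ (on-r (λ i → s (next i)) _ _ i)) (trans (cong redirect (σ-inv₁ (x i))) (redirect-x i))
  ... | oᵏ z with redirect-cases z
  ...   | inj₁ (i , refl , _) = trans (cong σ′ (back-x i)) (σ-r i)
  ...   | inj₂ (ne , e) = trans (cong σ′ (back-old ne)) (trans (cong redirect (σ-inv₁ z)) e)

  σ-inv₂′ : ∀ w → σ⁻′ (σ′ w) ≡ w
  σ-inv₂′ w with kind w
  ... | sᵏ i = trans (cong σ⁻′ (σ-s i)) (trans (on-s _ _ _ (prev i)) (cong s (next-prev i)))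
  ... | rᵏ i = trans (cong σ⁻′ (σ-r i)) (back-x i)
  ... | oᵏ y with redirect-cases (σ y)
  ...   | inj₁ (i , e , f) = trans (cong σ⁻′ f)
      (trans (on-r (λ i → s (next i)) _ _ i) (cong old (trans (cong σ⁻ (sym e)) (σ-inv₂ y))))
  ...   | inj₂ (ne , f) = trans (cong σ⁻′ f) (trans (back-old ne) (cong old (σ-inv₂ y)))

  σ-tail′ : ∀ w → tail′ (σ′ w) ≡ tail′ w
  σ-tail′ w with kind w
  ... | sᵏ i = trans (cong tail′ (σ-s i)) (trans (tail-s (prev i)) (sym (tail-s i)))
  ... | rᵏ i = trans (cong tail′ (σ-r i)) (sym (tail-r i))
  ... | oᵏ y = trans (redirect-tail (σ y)) (cong suc (σ-tail y))

  private
    _↝_ : Dart → Dart → Set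
    u ↝ v = ∃[ k ] iter σ′ k u ≡ v

    ↝-refl : ∀ {u} → u ↝ u
    ↝-refl = 0 , refl

    ↝-step : ∀ {u v} → u ↝ v → u ↝ σ′ v
    ↝-step (k , refl) = suc k , refl

    ↝-trans : ∀ {u v w} → u ↝ v → v ↝ w → u ↝ w
    ↝-trans p (zero , refl) = p
    ↝-trans p (suc k , refl) = ↝-step (↝-trans p (k , refl))

    ↝-≡ : ∀ {u v w} → u ↝ v → v ≡ w → u ↝ w
    ↝-≡ p refl = p

    old-step : ∀ y → old y ↝ old (σ y)
    old-step y with redirect-cases (σ y)
    ... | inj₁ (i , e , f) = ↝-≡ (↝-step (↝-≡ (↝-step ↝-refl) f)) (trans (σ-r i) (cong old (sym e)))
    ... | inj₂ (_ , f) = ↝-≡ (↝-step ↝-refl) f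

    old-orbit : ∀ k y → old y ↝ old (iter σ k y)
    old-orbit zero y = ↝-refl
    old-orbit (suc k) y = ↝-trans (old-orbit k y) (old-step _)

    old-same : ∀ {y z} → tail y ≡ tail z → old y ↝ old z
    old-same {y} {z} e with σ-trans y z e
    ... | k , refl = old-orbit k y

    leave : ∀ i → r i ↝ old (x i)
    leave i = ↝-≡ (↝-step ↝-refl) (σ-r i)

    enter : ∀ i → old (σ⁻ (x i)) ↝ r i
    enter i = ↝-≡ (↝-step ↝-refl) (trans (cong redirect (σ-inv₁ (x i))) (redirect-x i))

    tail-σ⁻ : ∀ y → tail (σ⁻ y) ≡ tail y
    tail-σ⁻ y = trans (sym (σ-tail (σ⁻ y))) (cong tail (σ-inv₁ y))

    s-step : ∀ i → s i ↝ s (prev i)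
    s-step i = ↝-≡ (↝-step ↝-refl) (σ-s i)

    s-orbit : ∀ i j → s i ↝ s j
    s-orbit 0F 0F = ↝-refl
    s-orbit 1F 1F = ↝-refl
    s-orbit 2F 2F = ↝-refl
    s-orbit 0F 2F = s-step 0F
    s-orbit 1F 0F = s-step 1F
    s-orbit 2F 1F = s-step 2F
    s-orbit 0F 1F = ↝-trans (s-step 0F) (s-step 2F)
    s-orbit 1F 2F = ↝-trans (s-step 1F) (s-step 0F)
    s-orbit 2F 0F = ↝-trans (s-step 2F) (s-step 1F)

  σ-trans′ : ∀ u w → tail′ u ≡ tail′ w → ∃[ k ] iter σ′ k u ≡ w
  σ-trans′ u w e with kind u | kind w
  ... | sᵏ i | sᵏ j = s-orbit i j
  ... | sᵏ i | rᵏ j = case trans (sym (tail-s i)) (trans e (tail-r j)) of λ ()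
  ... | sᵏ i | oᵏ z = case trans (sym (tail-s i)) e of λ ()
  ... | rᵏ i | sᵏ j = case trans (sym (tail-r i)) (trans e (tail-s j)) of λ ()
  ... | oᵏ y | sᵏ j = case trans e (tail-s j) of λ ()
  ... | rᵏ i | rᵏ j = ↝-trans (leave i) (↝-trans
      (old-same (trans (Fin-suc-injective (trans (sym (tail-r i)) (trans e (tail-r j)))) (sym (tail-σ⁻ (x j))))) (enter j))
  ... | rᵏ i | oᵏ z = ↝-trans (leave i) (old-same (Fin-suc-injective (trans (sym (tail-r i)) e)))
  ... | oᵏ y | rᵏ j = ↝-trans (old-same (trans (Fin-suc-injective (trans e (tail-r j))) (sym (tail-σ⁻ (x j))))) (enter j)
  ... | oᵏ y | oᵏ z = old-same (Fin-suc-injective e)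

  no-multi′ : ∀ u w → tail′ u ≡ tail′ w → tail′ (α′ u) ≡ tail′ (α′ w) → u ≡ w
  no-multi′ u w e f with kind u | kind w
  ... | sᵏ i | sᵏ j = cong s (t-injective i j (Fin-suc-injective (trans (sym (hd-s i)) (trans f (hd-s j)))))
  ... | sᵏ i | rᵏ j = case trans (sym (tail-s i)) (trans e (tail-r j)) of λ ()
  ... | sᵏ i | oᵏ z = case trans (sym (tail-s i)) e of λ ()
  ... | rᵏ i | sᵏ j = case trans (sym (tail-r i)) (trans e (tail-s j)) of λ ()
  ... | oᵏ y | sᵏ j = case trans e (tail-s j) of λ ()
  ... | rᵏ i | rᵏ j = cong r (t-injective i j (Fin-suc-injective (trans (sym (tail-r i)) (trans e (tail-r j)))))
  ... | rᵏ i | oᵏ z = case trans (sym (hd-r i)) f of λ ()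
  ... | oᵏ y | rᵏ j = case trans f (hd-r j) of λ ()
  ... | oᵏ y | oᵏ z = cong old (no-multi y z (Fin-suc-injective e) (Fin-suc-injective f))

  private
    reach-σ : ∀ {u v} → u ↝ v → Reach σ′ α′ u v
    reach-σ (zero , refl) = here
    reach-σ (suc k , refl) = reach-trans (reach-σ (k , refl)) (viaσ here)

    reach-old : ∀ {y z} → Reach σ α y z → Reach σ′ α′ (old y) (old z)
    reach-old here = here
    reach-old (viaσ p) = reach-trans (reach-σ (old-step _)) (reach-old p)
    reach-old (viaα p) = viaα (reach-old p)

    to-old : ∀ w → ∃[ y ] Reach σ′ α′ w (old y)
    to-old w with kind w
    ... | sᵏ i = x i , viaα (subst (λ v → Reach σ′ α′ v (old (x i))) (sym (α-s i)) (reach-σ (leave i)))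
    ... | rᵏ i = x i , reach-σ (leave i)
    ... | oᵏ y = y , here

    from-old : ∀ w → ∃[ y ] Reach σ′ α′ (old y) w
    from-old w with kind w
    ... | sᵏ i = σ⁻ (x i) , reach-trans (reach-σ (enter i)) (viaα (subst (λ v → Reach σ′ α′ v (s i)) (sym (α-r i)) here))
    ... | rᵏ i = σ⁻ (x i) , reach-σ (enter i)
    ... | oᵏ y = y , here

  -- The old face splits into the three faces `x i`, `r (next i)`, `s i`. This is why `σ′` turns
  -- through the darts `s i` by `prev`.
  φ-old-x : ∀ i → φ′ (old (x i)) ≡ r (next i)
  φ-old-x i = trans (cong redirect (φ-x i)) (redirect-x (next i))

  φ-r : ∀ i → φ′ (r (next i)) ≡ s i
  φ-r i = trans (cong σ′ (α-r (next i))) (trans (σ-s (next i)) (cong s (prev-next i)))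

  φ-s : ∀ i → φ′ (s i) ≡ old (x i)
  φ-s i = trans (cong σ′ (α-s i)) (σ-r i)

  φ-old : ∀ {y} → (∀ i → y ≢ x i) → φ′ (old y) ≡ old (φ y) × (∀ i → φ y ≢ x i)
  φ-old {y} ne = redirect-old ne′ , ne′
    where
    ne′ : ∀ i → φ y ≢ x i
    ne′ i e = ne (prev i) (trans (sym (faces-tri y))
        (trans (cong (λ z → φ (φ z)) (trans e (sym (trans (φ-x (prev i)) (cong x (next-prev i)))))) (faces-tri (x (prev i)))))

  faces-tri′ : ∀ w → iter (σ′ ∘ α′) 3 w ≡ w
  faces-tri′ w with kind w
  ... | sᵏ i = trans (cong (λ v → φ′ (φ′ v)) (φ-s i)) (trans (cong φ′ (φ-old-x i)) (φ-r i))
  ... | rᵏ i = trans (cong (λ j → φ′ (φ′ (φ′ (r j)))) (sym (next-prev i)))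
      (trans (cong (λ v → φ′ (φ′ v)) (φ-r (prev i)))
          (trans (cong φ′ (φ-s (prev i))) (trans (φ-old-x (prev i)) (cong r (next-prev i)))))
  ... | oᵏ y with redirect-cases y
  ...   | inj₁ (i , refl , _) = trans (cong (λ v → φ′ (φ′ v)) (φ-old-x i)) (trans (cong φ′ (φ-r i)) (φ-s i))
  ...   | inj₂ (ne , _) = let e₁ , ne₁ = φ-old ne ; e₂ , ne₂ = φ-old ne₁ ; e₃ , _ = φ-old ne₂ in
      trans (cong (λ v → φ′ (φ′ v)) e₁) (trans (cong φ′ e₂) (trans e₃ (cong old (faces-tri y))))

  insert : PlaneTriangulation (suc n)
  insert = record
    { d = 3 + (3 + d)
    ; tail = tail′
    ; α = α′
    ; σ = σ′
    ; σ⁻ = σ⁻′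
    ; α-invol = α-invol′
    ; α-nofix = α-nofix′
    ; σ-inv₁ = σ-inv₁′
    ; σ-inv₂ = σ-inv₂′
    ; σ-tail = σ-tail′
    ; σ-trans = σ-trans′
    ; tail-surj = λ { zero → s 0F , refl ; (suc v) → old (proj₁ (tail-surj v)) , cong suc (proj₂ (tail-surj v)) }
    ; loopless = loopless′
    ; no-multi = no-multi′
    ; connected = λ u w → let y , p = to-old u ; z , q = from-old w in
        reach-trans p (reach-trans (reach-old (connected y z)) q)
    ; faces-tri = faces-tri′
    -- Euler's formula follows from the dart count alone: six new darts are three new edges and, all
    -- faces being triangles, two more faces.
    ; euler = linear 4 (λ n d e f → 2 :* e :≡ con 6 :+ d ⇒ 3 :* f :≡ con 6 :+ d ⇒ d :+ con 12 :≡ 6 :* n ⇒ con 1 :+ n :+ f :≡ e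
        :+ con 2) refl
        n d (numOrbits (3 + (3 + d)) α′) (numOrbits (3 + (3 + d)) (σ′ ∘ α′))
        (numOrbits₂ α′ α-invol′ α-nofix′)
        (numOrbits₃ (σ′ ∘ α′) faces-tri′ λ w e → loopless′ w (trans (sym (σ-tail′ (α′ w))) (cong tail′ e)))
        dart-count
    }
    where
    α-nofix′ : ∀ w → α′ w ≢ w
    α-nofix′ w e = loopless′ w (cong tail′ e)

-- The extremal triangulations

sum-shift : ∀ m {d} (f : Fin (m + d) → ℕ) → (∀ i → f (i ↑ˡ d) ≡ 0) → sum f ≡ sum (λ y → f (m ↑ʳ y))
sum-shift zero f h = refl
sum-shift (suc m) f h = trans (sum-head f)
    (trans (cong (_+ sum (λ i → f (suc i))) (h zero)) (sum-shift m (λ i → f (suc i)) (λ i → h (suc i))))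

triangle : PlaneTriangulation 3
triangle = record
  { d = 6
  ; tail = tl
  ; α = a
  ; σ = s
  ; σ⁻ = s
  ; α-invol = from-yes (all? λ x → a (a x) ≟F x)
  ; α-nofix = from-yes (all? λ x → ¬? (a x ≟F x))
  ; σ-inv₁ = from-yes (all? λ x → s (s x) ≟F x)
  ; σ-inv₂ = from-yes (all? λ x → s (s x) ≟F x)
  ; σ-tail = from-yes (all? λ x → tl (s x) ≟F tl x)
  ; σ-trans = λ x y e → let k , p = orbits x y e in toℕ k , p
  ; tail-surj = λ { 0F → 0F , refl ; 1F → 1F , refl ; 2F → 2F , refl }
  ; loopless = from-yes (all? λ x → ¬? (tl (a x) ≟F tl x))
  ; no-multi = from-yes (all? λ x → all? λ y → (tl x ≟F tl y) →-dec ((tl (a x) ≟F tl (a y)) →-dec (x ≟F y)))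
  ; connected = λ x y → reach-trans (to x) (from y)
  ; faces-tri = from-yes (all? λ x → iter (s ∘ a) 3 x ≟F x)
  ; euler = refl
  }
  where
  tl : Fin 6 → Fin 3
  tl 0F = 0F
  tl 1F = 1F
  tl 2F = 2F
  tl 3F = 1F
  tl 4F = 2F
  tl 5F = 0F
  a s : Fin 6 → Fin 6
  a 0F = 3F
  a 1F = 4F
  a 2F = 5F
  a 3F = 0F
  a 4F = 1F
  a 5F = 2F
  s 0F = 5F
  s 1F = 3F
  s 2F = 4F
  s 3F = 1F
  s 4F = 2F
  s 5F = 0F
  orbits : ∀ x y → tl x ≡ tl y → ∃[ k ] iter s (toℕ {2} k) x ≡ y
  orbits = from-yes (all? λ x → all? λ y → (tl x ≟F tl y) →-dec any? λ (k : Fin 2) → iter s (toℕ k) x ≟F y)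
  to : ∀ x → Reach s a x 0F
  to 0F = here
  to 1F = viaσ (viaα here)
  to 2F = viaα (viaσ here)
  to 3F = viaα here
  to 4F = viaσ (viaα (viaσ here))
  to 5F = viaσ here
  from : ∀ y → Reach s a 0F y
  from 0F = here
  from 1F = viaα (viaσ here)
  from 2F = viaσ (viaα here)
  from 3F = viaα here
  from 4F = viaα (viaσ (viaα here))
  from 5F = viaσ here

-- By inner and four, S is a clique; each face has a vertex in S and one outside.
record Extremal (n : ℕ) : Set where
  field
    tri : PlaneTriangulation n
    S : Fin n → Bool
    x₀ : Fin (PlaneTriangulation.d tri)
  open PlaneTriangulation tri public
  open Planar tri public
  field
    tail∈S : S (tail x₀) ≡ true
    hd∈S : S (hd x₀) ≡ true
    mixed : ∀ x → Mixed S x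
    inner : count (λ x → S (tail x) ∧ S (hd x)) ≡ 12
    four : count S ≡ 4

-- K₄ with a further vertex in each of its four faces.
base : Extremal 8
base = record
  { tri = T₈
  ; S = S
  ; x₀ = x₀
  ; tail∈S = refl
  ; hd∈S = refl
  ; mixed = from-yes (all? λ x → ¬? ((S (tail x) ≟B S (hd x)) ×-dec (S (hd x) ≟B S (hd (φ x)))))
  ; inner = trans (sym (countF≡count d (λ x → S (tail x) ∧ S (hd x)))) refl
  ; four = trans (sym (countF≡count 8 S)) refl
  }
  where
  ↥ : ∀ {d} → Fin d → Fin (3 + (3 + d))
  ↥ y = 3 ↑ʳ (3 ↑ʳ y)
  T₄ = Insertion.insert triangle 0F
  T₅ = Insertion.insert T₄ (↥ 0F)
  T₆ = Insertion.insert T₅ (↥ (↥ 1F))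
  T₇ = Insertion.insert T₆ (↥ (↥ (↥ 2F)))
  T₈ = Insertion.insert T₇ (↥ (↥ (↥ (↥ 3F))))
  open PlaneTriangulation T₈
  open Planar T₈
  S : Fin 8 → Bool
  -- An inserted vertex becomes vertex 0 and shifts the others, so after four insertions the
  -- vertices of the K₄ are the numbers from 4 on.
  S v = 4 ≤ᵇ toℕ v
  x₀ : Fin d
  x₀ = ↥ (↥ (↥ (↥ (↥ 0F))))

-- The dart `x₀` has both ends in `S`, so any two corners of its face include a vertex of `S`; with
-- the new vertex outside `S`, all three new faces are mixed. The dart `old x₀` still has both ends
-- in `S` and serves the next insertion.
extend : ∀ {n} → Extremal n → Extremal (suc n)
extend {n} E = record
  { tri = insert
  ; S = S′
  ; x₀ = old x₀
  ; tail∈S = tail∈S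
  ; hd∈S = hd∈S
  ; mixed = mixed′
  ; inner = trans (sum-shift 3 inside (λ i → cong ind (start i)))
      (trans (sum-shift 3 (λ y → inside (3 ↑ʳ y)) (λ i → cong ind (end i))) inner)
  ; four = trans (sum-head (λ v → ind (S′ v))) four
  }
  where
  open Extremal E
  open Insertion tri x₀
  S′ : Fin (suc n) → Bool
  S′ zero = false
  S′ (suc v) = S v
  inside : Dart → ℕ
  inside w = ind (S′ (tail′ w) ∧ S′ (tail′ (α′ w)))
  start : ∀ i → S′ (tail′ (s i)) ∧ S′ (tail′ (α′ (s i))) ≡ false
  start i rewrite tail-s i = refl
  end : ∀ i → S′ (tail′ (r i)) ∧ S′ (tail′ (α′ (r i))) ≡ false
  end i rewrite hd-r i = ≡false λ e → true≢false (sym (proj₂ (∧-elim {S′ (tail′ (r i))} e)))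
  module P′ = Planar insert
  -- Being mixed is a property of the whole face, so for each new face one dart is enough.
  rotate : ∀ w → P′.Mixed S′ w → P′.Mixed S′ (φ′ w)
  rotate w h (p , q) = h (sym (trans p′ q′) , p′)
    where
    p′ : S′ (tail′ (α′ w)) ≡ S′ (tail′ (α′ (φ′ w)))
    p′ = trans (cong S′ (sym (P′.tail-φ w))) p
    q′ : S′ (tail′ (α′ (φ′ w))) ≡ S′ (tail′ w)
    q′ = trans q (cong S′ (P′.hd-φφ w))
  at-x : ∀ i → P′.Mixed S′ (old (x i))
  at-x i (p , q) = outer-pair i (trans p both) both
    where
    both : S (hd (x i)) ≡ false
    both = trans q (cong S′ (trans (cong (λ v → tail′ (α′ v)) (φ-old-x i)) (hd-r (next i))))
    t₁ : S (t 1F) ≡ true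
    t₁ = trans (cong S (sym (hd-x 0F))) hd∈S
    outer-pair : ∀ i → S (t i) ≡ false → S (hd (x i)) ≡ false → ⊥
    outer-pair 0F a _ = true≢false (trans (sym tail∈S) a)
    outer-pair 1F a _ = true≢false (trans (sym t₁) a)
    outer-pair 2F _ b = true≢false (trans (sym tail∈S) (trans (cong S (sym (hd-x 2F))) b))
  mixed′ : ∀ w → P′.Mixed S′ w
  mixed′ w with kind w
  ... | sᵏ i = subst (P′.Mixed S′) (φ-r i) (rotate (r (next i)) (subst (P′.Mixed S′) (φ-old-x i) (rotate (old (x i)) (at-x i))))
  ... | rᵏ i = subst (λ j → P′.Mixed S′ (r j)) (next-prev i)
      (subst (P′.Mixed S′) (φ-old-x (prev i)) (rotate (old (x (prev i))) (at-x (prev i))))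
  ... | oᵏ y with redirect-cases y
  ...   | inj₁ (i , refl , _) = at-x i
  ...   | inj₂ (ne , _) = λ { (p , q) → mixed y (p , trans q (cong (λ v → S′ (tail′ (α′ v))) (proj₁ (φ-old ne)))) }

extremal : ∀ k → Extremal (k + 8)
extremal zero = base
extremal (suc k) = extend (extremal k)

-- The colouring of the extremal triangulations

from-T : ∀ {b} → T b → b ≡ true
from-T {true} _ = refl

count≤1 : ∀ {n} (p : Fin n → Bool) → (∀ i j → p i ≡ true → p j ≡ true → i ≡ j) → count p ≤ 1
count≤1 p h with count p in eq
... | zero = z≤n
... | suc k with count-witness p (subst (0 <_) (sym eq) (s≤s z≤n))
... | i , pi = subst (_≤ 1) eq (≤-trans (count-mono λ j pj → ⌊⌋-yes (i ≟F j) (h i j pi pj)) (≤-reflexive (count-== i)))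

count-injective : ∀ {m n} (f : Fin m → Fin n) → (∀ i j → f i ≡ f j → i ≡ j) → (S : Fin n → Bool) → count (λ i → S (f i)) ≤ count S
count-injective f inj S = begin
  count (λ i → S (f i)) ≡⟨ sum-cong (λ i → sym (sum-δ (f i) (λ v → ind (S v)))) ⟩
  sum (λ i → sum (λ v → ind (f i == v) * ind (S v))) ≡⟨ sum-comm (λ i v → ind (f i == v) * ind (S v)) ⟩
  sum (λ v → sum (λ i → ind (f i == v) * ind (S v))) ≡⟨ sum-cong
      (λ v → trans (sum-cong λ i → *-comm (ind (f i == v)) (ind (S v))) (sum-*ˡ (ind (S v)) _)) ⟩
  sum (λ v → ind (S v) * count (λ i → f i == v)) ≤⟨ sum-mono
      (λ v → *-monoʳ-≤ (ind (S v)) (count≤1 (λ i → f i == v) λ i j p q → inj i j (trans (==-sound p) (sym (==-sound q))))) ⟩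
  sum (λ v → ind (S v) * 1) ≡⟨ sum-cong (λ v → *-identityʳ _) ⟩
  count S ∎
  where open ≤-Reasoning

-- At most five disjoint edges cover at most ten vertices, which is no vertex cover, so a further
-- disjoint edge exists.
containsM6 : ∀ {n} (T : PlaneTriangulation n) → 30 ≤ n → ContainsM6 T
containsM6 {n} T 30≤n = let M , s = build 6 ≤-refl
                            e , m6 , _ = matching⇒M6 T M (λ _ → ⊤) (λ u v a → let x , _ , t , h = adj-elim _ a in x , t , h , tt) (≤-reflexive (sym s))
                        in e , m6
  where
  open DartGraph T
  open PlanarFacts (planarFacts 30≤n)
  build : ∀ k → k ≤ 6 → Σ[ M ∈ Matching A ] size M ≡ k
  build zero _ = idMatching A , size-id A
  build (suc k) le with build k (<⇒≤ le)
  ... | M , s with cover (moved M) (linear 3 (λ c s k → c :≡ 2 :* s ⇒ s :≡ k ⇒ con 1 :+ k :≤ con 6 ⇒ c :≤ con 11) refl (count (moved M)) (size M) k (count-moved M) s le)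
  ... | u , v , a , mu , mv = addEdge M u v fu fv u≢v a (A-sym u v a) , trans (size-addEdge M u v fu fv u≢v a (A-sym u v a))
      (cong suc s)
    where
    fu = moved-false M u mu
    fv = moved-false M v mv
    u≢v : u ≢ v
    u≢v refl = true≢false (trans (sym a) (A-irr u))

module _ {n : ℕ} (E : Extremal n) (30≤n : 30 ≤ n) where
  open Extremal E

  private
    touching low : Fin d → Bool
    touching x = S (tail x) ∨ S (hd x)
    low x = toℕ x ≤ᵇ toℕ (α x)

    touching-α : ∀ x → touching (α x) ≡ touching x
    touching-α x = trans (cong (λ v → S (hd x) ∨ S v) (hd-α x)) (∨-comm (S (hd x)) _)

    -- The smaller of its two darts names an edge. Colours of edges meeting `S` are shifted by one
    -- to keep 0 for all other edges.
    code : Fin d → ℕ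
    code x = toℕ x ⊓ toℕ (α x)

    code-α : ∀ x → code (α x) ≡ code x
    code-α x = trans (cong (λ y → toℕ (α x) ⊓ toℕ y) (α-invol x)) (⊓-comm (toℕ (α x)) _)

    c : Fin d → ℕ
    c x = if touching x then suc (code x) else 0

    c-true : ∀ {x} → touching x ≡ true → c x ≡ suc (code x)
    c-true e rewrite e = refl

    c-false : ∀ {x} → touching x ≡ false → c x ≡ 0
    c-false e rewrite e = refl

    c-α : ∀ x → c (α x) ≡ c x
    c-α x = cong₂ (λ b k → if b then suc k else 0) (touching-α x) (code-α x)

  colouring : Coloring tri
  colouring = c , c-α

  private
    -- Twelve darts inside the K₄ and, in both directions, the `2 * n - 4` edges of the cut.
    count-touching : count touching ≡ 4 * n + 4
    count-touching = linear 4 (λ t i c n → t :≡ i :+ c :+ c ⇒ i :≡ con 12 ⇒ c :+ con 4 :≡ 2 :* n ⇒ t :≡ 4 :* n :+ con 4) refl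
      (count touching) (count λ x → S (tail x) ∧ S (hd x)) (cutSize S) n
      (trans (sum-cong λ x → split (S (tail x)) (S (hd x))) (trans (sum-+₃ _ _ _)
        (cong (count (λ x → S (tail x) ∧ S (hd x)) + cutSize S +_) (darts-flip λ a b → ind (S a ∧ not (S b))))))
      inner (cut-exact S mixed)
      where
      split : ∀ a b → ind (a ∨ b) ≡ ind (a ∧ b) + ind (a ∧ not b) + ind (b ∧ not a)
      split true true = refl
      split true false = refl
      split false true = refl
      split false false = refl

    low-or-high : ∀ x → ind (low x) + ind (low (α x)) ≡ 1
    low-or-high x rewrite α-invol x with <-cmp (toℕ x) (toℕ (α x))
    ... | tri< lt _ ngt rewrite from-T (≤⇒≤ᵇ (<⇒≤ lt)) | ≡false {toℕ (α x) ≤ᵇ toℕ x} (λ e → <⇒≱ lt (≤ᵇ⇒≤ _ _ (to-T e))) = refl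
    ... | tri≈ _ e _ = ⊥-elim (α-nofix x (sym (toℕ-injective e)))
    ... | tri> nlt _ gt rewrite from-T (≤⇒≤ᵇ (<⇒≤ gt)) | ≡false {toℕ x ≤ᵇ toℕ (α x)} (λ e → <⇒≱ gt (≤ᵇ⇒≤ _ _ (to-T e))) = refl

    count-low : 2 * count (λ x → touching x ∧ low x) ≡ count touching
    count-low = trans (cong (count tl +_) (+-identityʳ _))
        (trans (cong (count tl +_) (sym (sum-reindex α α α-invol α-invol (λ x → ind (tl x)))))
      (trans (sym (sum-+ _ _)) (sum-cong λ x → trans
          (cong (λ b → ind (touching x ∧ low x) + ind (b ∧ low (α x))) (touching-α x))
          (pointwise (touching x) (low x) (low (α x)) (low-or-high x)))))
      where
      tl : Fin d → Bool
      tl x = touching x ∧ low x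
      pointwise : ∀ a b c → ind b + ind c ≡ 1 → ind (a ∧ b) + ind (a ∧ c) ≡ ind a
      pointwise true b c h = h
      pointwise false b c h = refl

    opaque
      untouched : ∃[ z ] (not (touching z) ≡ true × ∀ y → not (touching y) ≡ true → toℕ z ≤ toℕ y)
      untouched = least (not ∘ touching) (proj₂ (count-witness (not ∘ touching) positive))
        where
        positive : 0 < count (not ∘ touching)
        positive = linear 4 (λ t u d n → t :+ u :≡ d ⇒ t :≡ 4 :* n :+ con 4 ⇒ d :+ con 12 :≡ 6 :* n ⇒ con 30 :≤ n ⇒ con 0 :< u) refl
          (count touching) (count (not ∘ touching)) d n (count-complement touching) count-touching dart-count 30≤n

    z₀ : Fin d
    z₀ = proj₁ untouched

    open First c

    suc≢0 : ∀ {k} → suc k ≢ 0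
    suc≢0 ()

    same-class : ∀ {x y b} → touching x ≡ b → c y ≡ c x → touching y ≡ b
    same-class {x} {y} {true} tx e with touching y in ty
    ... | true = refl
    ... | false = ⊥-elim (suc≢0 (trans (sym (c-true tx)) (sym e)))
    same-class {x} {y} {false} tx e with touching y in ty
    ... | false = refl
    ... | true = ⊥-elim (suc≢0 (trans e (c-false tx)))

    -- A nonzero colour belongs to a single edge and first appears at its smaller dart; colour 0
    -- first appears at `z₀`.
    first-value : ∀ x → ind (first x) ≡ ind (touching x ∧ low x) + ind (z₀ == x)
    first-value x = by-touch (touching x) refl
      where
      by-touch : ∀ b → touching x ≡ b → ind (first x) ≡ ind (touching x ∧ low x) + ind (z₀ == x)
      by-touch true e = begin
        ind (first x) ≡⟨ cong ind (bool-ext to from) ⟩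
        ind (low x) ≡⟨ sym (+-identityʳ _) ⟩
        ind (true ∧ low x) + 0 ≡⟨ cong₂ (λ a k → ind (a ∧ low x) + ind k) (sym e) (sym (≢-== ne)) ⟩
        ind (touching x ∧ low x) + ind (z₀ == x) ∎
        where
        open ≡-Reasoning
        ne : z₀ ≢ x
        ne refl = true≢false (trans (sym e) (not-true (proj₁ (proj₂ untouched))))
        to : first x ≡ true → low x ≡ true
        to f = from-T (≤⇒≤ᵇ (first-elim (α x) f (c-α x)))
        from : low x ≡ true → first x ≡ true
        from l = first-intro x λ y ey → ≤-trans (≤-reflexive (sym (m≤n⇒m⊓n≡m (≤ᵇ⇒≤ (toℕ x) (toℕ (α x)) (to-T l)))))
          (≤-trans (≤-reflexive (sym (suc-injective (trans (sym (c-true (same-class e ey))) (trans ey (c-true e))))))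
              (m⊓n≤m (toℕ y) _))
      by-touch false e = begin
        ind (first x) ≡⟨ cong ind (bool-ext to from) ⟩
        ind (false ∧ low x) + ind (z₀ == x) ≡⟨ cong (λ a → ind (a ∧ low x) + ind (z₀ == x)) (sym e) ⟩
        ind (touching x ∧ low x) + ind (z₀ == x) ∎
        where
        open ≡-Reasoning
        to : first x ≡ true → (z₀ == x) ≡ true
        to f = ⌊⌋-yes (z₀ ≟F x) (toℕ-injective (≤-antisym (proj₂ (proj₂ untouched) x (cong not e))
          (first-elim z₀ f (trans (c-false (not-true (proj₁ (proj₂ untouched)))) (sym (c-false e))))))
        from : (z₀ == x) ≡ true → first x ≡ true
        from p with ==-sound p
        ... | refl = first-intro x λ y ey → proj₂ (proj₂ untouched) y (cong not (same-class e ey))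

  colour-count : numColors tri colouring ≡ 2 * n + 3
  colour-count = linear 4 (λ k l t n → k :≡ l :+ con 1 ⇒ 2 :* l :≡ t ⇒ t :≡ 4 :* n :+ con 4 ⇒ k :≡ 2 :* n :+ con 3) refl
    (numColors tri colouring) (count λ x → touching x ∧ low x) (count touching) n
    (trans (countF≡count d first) (trans (sum-cong first-value)
        (trans (sum-+ _ _) (cong (count (λ x → touching x ∧ low x) +_) (count-== z₀)))))
    count-low count-touching

  not-rainbow : ¬ RainbowM6 tri colouring
  not-rainbow (e , m6 , inj) = linear 3 (λ t u f → t :+ u :≡ con 6 ⇒ t :≤ f ⇒ f :≡ con 4 ⇒ u :≤ con 1 ⇒ absurd) refl
    (count λ i → touching (e i)) (count λ i → not (touching (e i))) (count S)
    (count-complement (λ i → touching (e i)))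
    (≤-trans (count-mono λ i → meets i) (count-injective end end-injective S))
    four
    (count≤1 _ λ i j p q → inj i j (trans (c-false (not-true p)) (sym (c-false (not-true q)))))
    where
    side : Fin 6 → Fin 6 × Bool
    -- The end chosen is the tail if it lies in `S` and the head otherwise, so an edge that meets
    -- `S` is sent to a vertex of `S`.
    side i = i , not (S (tail (e i)))
    end : Fin 6 → Fin n
    end i = ends tri e (side i)
    end-injective : ∀ i j → end i ≡ end j → i ≡ j
    end-injective i j p = cong proj₁ (m6 (side i) (side j) p)
    meets : ∀ i → touching (e i) ≡ true → S (end i) ≡ true
    meets i h = by-tail-value (S (tail (e i))) refl
      where
      by-tail-value : ∀ b → S (tail (e i)) ≡ b → S (end i) ≡ true
      by-tail-value true p = trans (cong (λ b → S (ends tri e (i , not b))) p) p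
      by-tail-value false p = trans (cong (λ b → S (ends tri e (i , not b))) p) (trans (cong (_∨ S (hd (e i))) (sym p)) h)

theorem4 : ∀ (n : ℕ) → 30 ≤ n →
    (Σ[ T ∈ PlaneTriangulation n ] (ContainsM6 T ×
    Σ[ c ∈ Coloring T ] (numColors T c ≡ 2 * n + 3 × ¬ RainbowM6 T c)))
    × (∀ (T : PlaneTriangulation n) → ContainsM6 T → (c : Coloring T) →
    ¬ RainbowM6 T c → numColors T c ≤ 2 * n + 3)
theorem4 n 30≤n = (tri , containsM6 tri 30≤n , colouring E 30≤n , colour-count E 30≤n , not-rainbow E 30≤n)
  , λ T _ c → few-colours T 30≤n c
  where
  E : Extremal n
  E = subst Extremal (m∸n+n≡m (≤-trans (≤ᵇ⇒≤ 8 30 tt) 30≤n)) (extremal (n ∸ 8))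
  open Extremal E using (tri)
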